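{- Every $2$-rose graph other than $R(3,4)$ and $R(3,5)$ is determined by its Laplacian spectrum. Each of $R(3,4)$ and $R(3,5)$ has exactly one Laplacian cospectral mate (up to isomorphism).
   Context: Graphs are finite, simple and undirected. A $2$-rose graph is a graph consisting of two cycles sharing exactly one vertex; equivalently, a connected graph with one vertex of degree $4$ and all other vertices of degree $2$. For $\ell\ge3$, $R(3,\ell)$ denotes the $2$-rose graph whose two cycles are a triangle and a cycle of length $\ell$. The Laplacian spectrum of a graph is the multiset of eigenvalues of $L=D-A$, where $A$ is the adjacency matrix and $D$ the diagonal degree matrix. A graph is determined by its Laplacian spectrum if every graph with the same Laplacian spectrum is isomorphic to it; a Laplacian cospectral mate of $G$ is a graph not isomorphic to $G$ with the same Laplacian spectrum. -}

module Defs where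

open import Data.Bool using (Bool; true; false; if_then_else_; _∧_; _∨_; not)
open import Data.Nat using (ℕ; zero; suc; _∸_; _≡ᵇ_; _<ᵇ_)
open import Data.Fin using (Fin; zero; suc; toℕ; punchIn; _≟_)
open import Data.List using (List; foldr; map; allFin)
open import Data.Integer as ℤ using (ℤ; +_; -_)
open import Data.Product using (Σ; _×_; _,_)
open import Data.Empty using (⊥)
open import Relation.Nullary using (¬_; yes; no; does)
open import Relation.Binary.PropositionalEquality using (_≡_; refl) renaming (sym to ≡-sym)
open import Function.Bundles using (_↔_; Inverse)

record Graph (n : ℕ) : Set where
  field
    adj    : Fin n → Fin n → Bool
    adj-sym : ∀ i j → adj i j ≡ adj j i
    irrefl : ∀ i → adj i i ≡ false
open Graph public

_≅_ : ∀ {n m} → Graph n → Graph m → Set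
_≅_ {n} {m} G H =
  Σ (Fin n ↔ Fin m) λ π →
    ∀ i j → adj G i j ≡ adj H (Inverse.to π i) (Inverse.to π j)

deg : ∀ {n} → Graph n → Fin n → ℕ
deg {n} G i = foldr Data.Nat._+_ 0 (map (λ j → if adj G i j then 1 else 0) (allFin n))

data Reach {n} (G : Graph n) : Fin n → Fin n → Set where
  here : ∀ {i} → Reach G i i
  step : ∀ {i j k} → adj G i j ≡ true → Reach G j k → Reach G i k

Connected : ∀ {n} → Graph n → Set
Connected {n} G = ∀ (i j : Fin n) → Reach G i j

IsRose : ∀ {n} → Graph n → Set
IsRose {n} G = Connected G × Σ (Fin n) λ v → deg G v ≡ 4 × (∀ w → ¬ (w ≡ v) → deg G w ≡ 2)

sumℤ : List ℤ → ℤ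
sumℤ = foldr ℤ._+_ (+ 0)

det : ∀ n → (Fin n → Fin n → ℤ) → ℤ
det zero    M = + 1
det (suc n) M =
  sumℤ (map (λ j → sign (toℕ j) ℤ.* (M zero j ℤ.* det n (λ a b → M (suc a) (punchIn j b))))
            (allFin (suc n)))
  where
  sign : ℕ → ℤ
  sign zero          = + 1
  sign (suc zero)    = - (+ 1)
  sign (suc (suc k)) = sign k

laplacian : ∀ {n} → Graph n → Fin n → Fin n → ℤ
laplacian G i j =
  if does (i ≟ j) then + (deg G i) else (if adj G i j then - (+ 1) else + 0)

lapCharPoly : ∀ {n} → Graph n → ℤ → ℤ
lapCharPoly {n} G x =
  det n (λ i j → (if does (i ≟ j) then x else + 0) ℤ.- laplacian G i j)

-- Same Laplacian spectrum (= same Laplacian characteristic polynomial; two monic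
-- integer polynomials agree as polynomials iff they agree at every integer).
LapCospectral : ∀ {n m} → Graph n → Graph m → Set
LapCospectral G H = ∀ (x : ℤ) → lapCharPoly G x ≡ lapCharPoly H x

simpleGraph : ∀ {n} → (Fin n → Fin n → Bool) → Graph n
simpleGraph {n} r = record { adj = a ; adj-sym = s ; irrefl = ir }
  where
  a : Fin n → Fin n → Bool
  a i j = if does (i ≟ j) then false else (r i j ∨ r j i)
  ∨-comm : ∀ x y → (x ∨ y) ≡ (y ∨ x)
  ∨-comm false false = refl
  ∨-comm false true  = refl
  ∨-comm true  false = refl
  ∨-comm true  true  = refl
  s : ∀ i j → a i j ≡ a j i
  s i j with i ≟ j | j ≟ i
  ... | yes _ | yes _ = refl
  ... | no _  | no _  = ∨-comm (r i j) (r j i)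
  ... | yes p | no q with q (≡-sym p)
  ... | ()
  s i j | no q | yes p with q (≡-sym p)
  ... | ()
  ir : ∀ i → a i i ≡ false
  ir i with i ≟ i
  ... | yes _ = refl
  ... | no q with q refl
  ... | ()

-- R(3,ℓ) on vertices 0,…,ℓ+1: vertex 0 is the centre, 0-1-…-(ℓ-1)-0 is the ℓ-cycle,
-- and 0,ℓ,ℓ+1 is the triangle.
roseEdge : ℕ → ℕ → ℕ → Bool
roseEdge ℓ a b =
  ((suc a ≡ᵇ b) ∧ (b <ᵇ ℓ))
  ∨ ((a ≡ᵇ 0) ∧ (b ≡ᵇ (ℓ ∸ 1)))
  ∨ ((a ≡ᵇ 0) ∧ (b ≡ᵇ ℓ))
  ∨ ((a ≡ᵇ 0) ∧ (b ≡ᵇ suc ℓ))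
  ∨ ((a ≡ᵇ ℓ) ∧ (b ≡ᵇ suc ℓ))

R3 : (ℓ : ℕ) → Graph (suc (suc ℓ))
R3 ℓ = simpleGraph (λ i j → roseEdge ℓ (toℕ i) (toℕ j))

{-# OPTIONS --safe #-}
module Submission where

-- Write Q = L - 2 I = W - A with W = diag (deg - 2).  Cospectral graphs have the same traces tr Qᵏ (resolvent
-- B = adj (z - Q): tr B is the derivative of det (z - Q), z tr (B X) = det (z - Q) tr X + tr (B Q X), and tr (B X) grows
-- more slowly than det (z - Q)), and the same number of spanning trees, which is positive exactly for connected graphs.
-- From tr Q and tr Q² a mate H of a 2-rose G is a 2-rose or has degrees 3, 3, 3, 2, …, 2, 1.
-- The rose with cycles of lengths p and q has p q spanning trees and p + q - 1 vertices, hence roses are told apart.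
-- In the other case tr Q³ forces G to have one triangle more than H; so G = R(3,ℓ), ℓ ≥ 4, and H is triangle-free.
-- Then tr Q⁵ forces two 4-cycles of H through one vertex, so that H contains K₂₃ or the 2 × 3 grid,
-- and tr Q⁴ leaves room for nothing more than a single pendant vertex, giving the mates of R(3,4) and R(3,5).

open import Defs renaming (here to reach-refl; step to reach-step)
open import Data.Bool using (Bool; true; false; if_then_else_; _∧_; _∨_; not)
import Data.Bool.Properties as BoolP
open import Data.Nat as ℕ using (ℕ; zero; suc; z≤n; s≤s)
import Data.Nat.Properties as ℕP
open import Data.Fin using (Fin; zero; suc; toℕ; punchIn; punchOut; inject₁; _≟_)
open import Data.Fin.Patterns using (0F; 1F; 2F; 3F; 4F; 5F; 6F)
import Data.Fin.Properties as FinP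
open import Data.Integer as ℤ using (ℤ; +_; -[1+_]; _+_; _*_; -_; _-_; ∣_∣; _≤_)
import Data.Integer.Properties as ℤP
open import Data.Integer.Tactic.RingSolver using (solve-∀)
open import Data.List using (List; []; _∷_; map; allFin; tabulate; filter; foldr; length)
import Data.List.Properties as ListP
import Data.List.Membership.DecPropositional as DecMem
open import Data.List.Membership.Propositional using (_∈_; _∉_)
open import Data.List.Membership.Propositional.Properties using (∈-allFin; ∈-filter⁺; ∈-filter⁻; ∈-map⁺; ∈-map⁻)
open import Data.List.Relation.Unary.All as All using (All; []; _∷_)
open import Data.List.Relation.Unary.AllPairs using ([]; _∷_)
open import Data.List.Relation.Unary.Any using (here; there)
open import Data.List.Relation.Unary.Unique.DecPropositional using () renaming (unique? to unique-dec)
open import Data.List.Relation.Unary.Unique.Propositional using (Unique)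
open import Data.List.Relation.Unary.Unique.Propositional.Properties using (allFin⁺) renaming (filter⁺ to unique-filter⁺)
open import Data.Product using (Σ; _×_; _,_; proj₁; proj₂)
open import Data.Sum using (_⊎_; inj₁; inj₂)
open import Data.Empty using (⊥; ⊥-elim)
open import Function using (_∘_; id)
open import Function.Bundles using (Inverse; mk↔ₛ′)
open import Relation.Nullary using (¬_; yes; no; does; Dec)
open import Relation.Nullary.Decidable using (dec-true; dec-false; from-yes; _×-dec_; _⊎-dec_; ¬?)
open import Relation.Binary.PropositionalEquality using (_≡_; _≢_; refl; sym; trans; cong; cong₂; subst; subst₂; ≢-sym)
import Algebra.Properties.CommutativeMonoid.Sum ℕP.+-0-commutativeMonoid as SumN
import Algebra.Properties.Semiring.Sum ℤP.+-*-semiring as Sum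

-- Subtracting 2 makes the weight `deg - 2` vanish at every vertex of degree two. In tr Qᵏ, k ≤ 5,
-- each term that is not a plain walk count carries a weight, so a rose contributes only at its
-- centre and a mate only at its three vertices of degree three and its leaf; the trace identities
-- become small integer equations. Eigenvalues never occur. The spectrum is given by the integer
-- values of a polynomial, and derivatives, constant terms and leading coefficients are extracted
-- from these values by congruences modulo every positive integer and by growth bounds. The plain
-- count tr A⁵ is global. In the rose it is computed, since odd closed walks must pass the centre;
-- in the mate it only has to be nonnegative. Two small orders disturb the general argument. The
-- rose with two triangles has five vertices, and its mate would keep a triangle; it is excluded
-- separately. R(3,4) contains a 4-cycle itself, so the count from tr Q⁴ is used only from seven
-- vertices on; with six, K₂₃ and one more vertex already exhaust the graph.

private variable
  n m : ℕ

-- Determinants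

Mat : ℕ → Set
Mat n = Fin n → Fin n → ℤ

-- Summation is kept opaque, since otherwise sums over Fin (suc n) unfold during unification.
abstract
  ∑ : (Fin n → ℤ) → ℤ
  ∑ = Sum.sum

  ∑-empty : (f : Fin 0 → ℤ) → ∑ f ≡ + 0
  ∑-empty f = refl

  ∑-suc : (f : Fin (suc n) → ℤ) → ∑ f ≡ f zero + ∑ (f ∘ suc)
  ∑-suc f = refl

  ∑-cong : {f g : Fin n → ℤ} → (∀ i → f i ≡ g i) → ∑ f ≡ ∑ g
  ∑-cong = Sum.sum-cong-≗

  ∑-zero : {f : Fin n → ℤ} → (∀ i → f i ≡ + 0) → ∑ f ≡ + 0
  ∑-zero {n} h = trans (∑-cong h) (Sum.sum-replicate-zero n)

  ∑-add : (f g : Fin n → ℤ) → ∑ (λ i → f i + g i) ≡ ∑ f + ∑ g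
  ∑-add = Sum.∑-distrib-+

  ∑-comm : (f : Fin m → Fin n → ℤ) → ∑ (λ i → ∑ (λ j → f i j)) ≡ ∑ (λ j → ∑ (λ i → f i j))
  ∑-comm = Sum.∑-comm

  ∑-scale : (a : ℤ) (f : Fin n → ℤ) → ∑ (λ i → a * f i) ≡ a * ∑ f
  ∑-scale a f = sym (Sum.*-distribˡ-sum a f)

  ∑-scaleʳ : (a : ℤ) (f : Fin n → ℤ) → ∑ (λ i → f i * a) ≡ ∑ f * a
  ∑-scaleʳ a f = sym (Sum.*-distribʳ-sum a f)

  ∑-remove : (i : Fin (suc n)) (f : Fin (suc n) → ℤ) → ∑ f ≡ f i + ∑ (λ j → f (punchIn i j))
  ∑-remove i f = Sum.sum-remove {i = i} f

∑-neg : (f : Fin n → ℤ) → ∑ (λ i → - f i) ≡ - ∑ f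
∑-neg f = trans (∑-cong (λ i → sym (ℤP.-1*i≡-i (f i)))) (trans (∑-scale (- + 1) f) (ℤP.-1*i≡-i (∑ f)))

∑-sub : (f g : Fin n → ℤ) → ∑ (λ i → f i - g i) ≡ ∑ f - ∑ g
∑-sub f g = trans (∑-add f (λ i → - g i)) (cong (λ t → ∑ f + t) (∑-neg g))

∑-lin : (a b : ℤ) (f g : Fin n → ℤ) → ∑ (λ i → a * f i + b * g i) ≡ a * ∑ f + b * ∑ g
∑-lin a b f g = trans (∑-add (λ i → a * f i) (λ i → b * g i)) (cong₂ _+_ (∑-scale a f) (∑-scale b g))

∑-single : (c : Fin n) {f : Fin n → ℤ} → (∀ j → j ≢ c → f j ≡ + 0) → ∑ f ≡ f c
∑-single {suc n} c {f} h =
  trans (∑-remove c f)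
        (trans (cong (λ t → f c + t) (∑-zero (λ j → h (punchIn c j) (FinP.punchInᵢ≢i c j))))
               (ℤP.+-identityʳ (f c)))

∑-pair : (c d : Fin n) {f : Fin n → ℤ} → c ≢ d →
         (∀ j → j ≢ c → j ≢ d → f j ≡ + 0) → ∑ f ≡ f c + f d
∑-pair {suc n} c d {f} c≢d h =
  trans (∑-remove c f)
        (cong (λ t → f c + t)
          (trans (∑-single (punchOut c≢d)
                   (λ j j≢ → h (punchIn c j) (FinP.punchInᵢ≢i c j)
                     (λ e → j≢ (FinP.punchIn-injective c j (punchOut c≢d) (trans e (sym (FinP.punchIn-punchOut c≢d)))))))
                 (cong f (FinP.punchIn-punchOut c≢d))))

δ : Fin n → Fin n → ℤ
δ i j = if does (i ≟ j) then + 1 else + 0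

δ-refl : (i : Fin n) → δ i i ≡ + 1
δ-refl i rewrite dec-true (i ≟ i) refl = refl

δ-≢ : {i j : Fin n} → i ≢ j → δ i j ≡ + 0
δ-≢ {i = i} {j} i≢j rewrite dec-false (i ≟ j) i≢j = refl

∑-δˡ : (i : Fin n) (f : Fin n → ℤ) → ∑ (λ k → δ i k * f k) ≡ f i
∑-δˡ i f = trans (∑-single i (λ j j≢i → cong (_* f j) (δ-≢ (≢-sym j≢i))))
                 (trans (cong (_* f i) (δ-refl i)) (ℤP.*-identityˡ (f i)))

∑-δʳ : (i : Fin n) (f : Fin n → ℤ) → ∑ (λ k → δ k i * f k) ≡ f i
∑-δʳ i f = trans (∑-single i (λ j j≢i → cong (_* f j) (δ-≢ j≢i)))
                 (trans (cong (_* f i) (δ-refl i)) (ℤP.*-identityˡ (f i)))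

sgn : ℕ → ℤ
sgn zero          = + 1
sgn (suc zero)    = - (+ 1)
sgn (suc (suc k)) = sgn k

sgn-suc : ∀ k → sgn (suc k) ≡ - sgn k
sgn-suc zero          = refl
sgn-suc (suc zero)    = refl
sgn-suc (suc (suc k)) = sgn-suc k

minor : Fin (suc n) → Mat (suc n) → Mat n
minor j M a b = M (suc a) (punchIn j b)

cofactorTerm : Mat (suc n) → Fin (suc n) → ℤ
cofactorTerm {n} M j = sgn (toℕ j) * (M zero j * det n (minor j M))

private
  mutual
    -- The sign function local to det has no name here; unification with the body of det supplies it.
    detTerm : (M : Mat (suc n)) → Fin (suc n) → ℤ
    detTerm M = _

    det-unfold : (M : Mat (suc n)) →
      det (suc n) M ≡ + 1 * (M zero zero * det n (minor zero M)) + foldr _+_ (+ 0) (map (detTerm M) (tabulate suc))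
    det-unfold M = refl

  mutual
    SignLaw : (M : Mat (suc n)) (j : Fin (suc n)) → ℕ → Set
    SignLaw M j k = _

    -- Once `toℕ j` is abstracted, the goal speaks of an arbitrary `k`, and unification records it
    -- as `SignLaw`. Only in this form can one recurse on `k` in steps of two, as the sign function
    -- does.
    detTerm-law : (M : Mat (suc n)) (j : Fin (suc n)) → (∀ k → SignLaw M j k) → detTerm M j ≡ cofactorTerm M j
    detTerm-law M j h with toℕ j
    ... | k = h k

  signLaw : (M : Mat (suc n)) (j : Fin (suc n)) (k : ℕ) → SignLaw M j k
  signLaw M j zero          = refl
  signLaw M j (suc zero)    = refl
  signLaw M j (suc (suc k)) = signLaw M j k

  detTerm≡ : (M : Mat (suc n)) (j : Fin (suc n)) → detTerm M j ≡ cofactorTerm M j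
  detTerm≡ M j = detTerm-law M j (signLaw M j)

sumℤ-tabulate : ∀ {k} (f : Fin m → ℤ) (t : Fin k → Fin m) → sumℤ (map f (tabulate t)) ≡ ∑ (f ∘ t)
sumℤ-tabulate {k = zero}  f t = sym (∑-empty (f ∘ t))
sumℤ-tabulate {k = suc k} f t = trans (cong (λ s → f (t zero) + s) (sumℤ-tabulate f (t ∘ suc))) (sym (∑-suc (f ∘ t)))

det-expand : (M : Mat (suc n)) → det (suc n) M ≡ ∑ (cofactorTerm M)
det-expand M = trans (det-unfold M)
  (trans (cong (λ t → cofactorTerm M zero + t) (trans (sumℤ-tabulate (detTerm M) suc) (∑-cong (λ j → detTerm≡ M (suc j)))))
         (sym (∑-suc (cofactorTerm M))))

det-cong : {M N : Mat n} → (∀ i j → M i j ≡ N i j) → det n M ≡ det n N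
det-cong {zero}  h = refl
det-cong {suc n} {M} {N} h =
  trans (det-expand M) (trans (∑-cong term) (sym (det-expand N)))
  where
  term : ∀ j → cofactorTerm M j ≡ cofactorTerm N j
  term j = cong (λ t → sgn (toℕ j) * t)
    (cong₂ _*_ (h zero j) (det-cong (λ a b → h (suc a) (punchIn j b))))

det-zeroRow : (M : Mat n) (r : Fin n) → (∀ j → M r j ≡ + 0) → det n M ≡ + 0
det-zeroRow {suc n} M zero    h = trans (det-expand M) (∑-zero λ j →
  trans (cong (λ t → sgn (toℕ j) * (t * det n (minor j M))) (h j)) (ℤP.*-zeroʳ (sgn (toℕ j))))
det-zeroRow {suc n} M (suc r) h = trans (det-expand M) (∑-zero λ j →
  trans (cong (λ t → sgn (toℕ j) * (M zero j * t)) (det-zeroRow (minor j M) r (λ b → h (punchIn j b))))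
        (zz (sgn (toℕ j)) (M zero j)))
  where
  zz : ∀ a b → a * (b * + 0) ≡ + 0
  zz = solve-∀

-- Induction along the first-row expansion: the minor at `c` has lost the special column, and every
-- other minor contains it at the position given by `punchOut`, where the hypotheses hold again.
det-lin : (M N P : Mat n) (c : Fin n) (a b : ℤ) →
          (∀ i j → j ≢ c → P i j ≡ M i j) → (∀ i j → j ≢ c → P i j ≡ N i j) →
          (∀ i → P i c ≡ a * M i c + b * N i c) →
          det n P ≡ a * det n M + b * det n N
det-lin {suc n} M N P c a b hM hN hc =
  trans (det-expand P)
    (trans (∑-cong term)
      (trans (∑-lin a b (cofactorTerm M) (cofactorTerm N))
        (sym (cong₂ (λ s t → a * s + b * t) (det-expand M) (det-expand N)))))
  where
  at-c : ∀ s x y d → s * ((a * x + b * y) * d) ≡ a * (s * (x * d)) + b * (s * (y * d))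
  at-c = at-c′ a b
    where
    at-c′ : ∀ a b s x y d → s * ((a * x + b * y) * d) ≡ a * (s * (x * d)) + b * (s * (y * d))
    at-c′ = solve-∀
  off-c : ∀ s x d e → s * (x * (a * d + b * e)) ≡ a * (s * (x * d)) + b * (s * (x * e))
  off-c = off-c′ a b
    where
    off-c′ : ∀ a b s x d e → s * (x * (a * d + b * e)) ≡ a * (s * (x * d)) + b * (s * (x * e))
    off-c′ = solve-∀
  term : ∀ j → cofactorTerm P j ≡ a * cofactorTerm M j + b * cofactorTerm N j
  term j with j ≟ c
  ... | yes refl = trans (cong (λ t → sgn (toℕ j) * (t * det n (minor j P))) (hc zero))
      (trans (at-c (sgn (toℕ j)) (M zero j) (N zero j) (det n (minor j P)))
        (cong₂ (λ s t → a * (sgn (toℕ j) * (M zero j * s)) + b * (sgn (toℕ j) * (N zero j * t)))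
          (det-cong (λ i k → hM (suc i) (punchIn j k) (FinP.punchInᵢ≢i j k)))
          (det-cong (λ i k → hN (suc i) (punchIn j k) (FinP.punchInᵢ≢i j k)))))
  ... | no j≢c =
      trans (cong (λ t → sgn (toℕ j) * (P zero j * t))
              (det-lin (minor j M) (minor j N) (minor j P) c′ a b
                (λ i k k≢ → hM (suc i) (punchIn j k) (off k k≢))
                (λ i k k≢ → hN (suc i) (punchIn j k) (off k k≢))
                (λ i → subst (λ q → P (suc i) q ≡ a * M (suc i) q + b * N (suc i) q) (sym c′-eq) (hc (suc i)))))
        (trans (off-c (sgn (toℕ j)) (P zero j) (det n (minor j M)) (det n (minor j N)))
          (cong₂ (λ s t → a * (sgn (toℕ j) * (s * det n (minor j M))) + b * (sgn (toℕ j) * (t * det n (minor j N))))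
            (hM zero j j≢c) (hN zero j j≢c)))
    where
    c′ = punchOut j≢c
    c′-eq : punchIn j c′ ≡ c
    c′-eq = FinP.punchIn-punchOut j≢c
    off : ∀ k → k ≢ c′ → punchIn j k ≢ c
    off k k≢ e = k≢ (FinP.punchIn-injective j k c′ (trans e (sym c′-eq)))

_[_≔_] : Mat n → Fin n → (Fin n → ℤ) → Mat n
(M [ c ≔ v ]) i j = if does (j ≟ c) then v i else M i j

≔-at : (M : Mat n) (c : Fin n) (v : Fin n → ℤ) (i : Fin n) → (M [ c ≔ v ]) i c ≡ v i
≔-at M c v i rewrite dec-true (c ≟ c) refl = refl

≔-off : (M : Mat n) (c : Fin n) (v : Fin n → ℤ) (i : Fin n) {j : Fin n} → j ≢ c → (M [ c ≔ v ]) i j ≡ M i j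
≔-off M c v i {j} j≢c rewrite dec-false (j ≟ c) j≢c = refl

≔-ext : (M N : Mat n) (c : Fin n) {v : Fin n → ℤ} →
        (∀ i j → j ≢ c → N i j ≡ M i j) → (∀ i → N i c ≡ v i) → ∀ i j → (M [ c ≔ v ]) i j ≡ N i j
≔-ext M N c {v} off at i j with j ≟ c
... | yes refl = sym (at i)
... | no j≢c   = sym (off i j j≢c)

≔-self : (M : Mat n) (c : Fin n) → det n (M [ c ≔ (λ i → M i c) ]) ≡ det n M
≔-self M c = det-cong (≔-ext M M c (λ _ _ _ → refl) (λ _ → refl))

det-≔-cong : (M : Mat n) (c : Fin n) {u v : Fin n → ℤ} → (∀ i → u i ≡ v i) → det n (M [ c ≔ u ]) ≡ det n (M [ c ≔ v ])
det-≔-cong M c {u} {v} h = det-cong (≔-ext M (M [ c ≔ v ]) c (λ i j → ≔-off M c v i) (λ i → trans (≔-at M c v i) (sym (h i))))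

det-≔-lin : (M : Mat n) (c : Fin n) (a b : ℤ) (u v : Fin n → ℤ) →
            det n (M [ c ≔ (λ i → a * u i + b * v i) ]) ≡ a * det n (M [ c ≔ u ]) + b * det n (M [ c ≔ v ])
det-≔-lin M c a b u v = det-lin _ _ _ c a b
  (λ i j j≢ → trans (≔-off M c w i j≢) (sym (≔-off M c u i j≢)))
  (λ i j j≢ → trans (≔-off M c w i j≢) (sym (≔-off M c v i j≢)))
  (λ i → trans (≔-at M c w i) (sym (cong₂ (λ s t → a * s + b * t) (≔-at M c u i) (≔-at M c v i))))
  where
  w : Fin _ → ℤ
  w i = a * u i + b * v i

det-≔-scale : (M : Mat n) (c : Fin n) (a : ℤ) (u : Fin n → ℤ) →
              det n (M [ c ≔ (λ i → a * u i) ]) ≡ a * det n (M [ c ≔ u ])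
det-≔-scale M c a u = trans (det-≔-cong M c (λ i → sym (lem a (u i))))
  (trans (det-≔-lin M c a (+ 0) u u) (lem a (det _ (M [ c ≔ u ]))))
  where
  lem : ∀ a x → a * x + + 0 * x ≡ a * x
  lem = solve-∀

det-≔-add : (M : Mat n) (c : Fin n) (u v : Fin n → ℤ) →
            det n (M [ c ≔ (λ i → u i + v i) ]) ≡ det n (M [ c ≔ u ]) + det n (M [ c ≔ v ])
det-≔-add M c u v = trans (det-≔-cong M c (λ i → sym (lem (u i) (v i))))
  (trans (det-≔-lin M c (+ 1) (+ 1) u v) (lem (det _ (M [ c ≔ u ])) (det _ (M [ c ≔ v ]))))
  where
  lem : ∀ x y → + 1 * x + + 1 * y ≡ x + y
  lem = solve-∀

det-≔-zero : (M : Mat n) (c : Fin n) → det n (M [ c ≔ (λ _ → + 0) ]) ≡ + 0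
det-≔-zero M c = trans (det-≔-scale M c (+ 0) (λ _ → + 0)) refl

det-≔-∑ : ∀ {k} (M : Mat n) (c : Fin n) (α : Fin k → ℤ) (U : Fin k → Fin n → ℤ) →
          det n (M [ c ≔ (λ i → ∑ (λ s → α s * U s i)) ]) ≡ ∑ (λ s → α s * det n (M [ c ≔ U s ]))
det-≔-∑ {k = zero}  M c α U =
  trans (det-≔-cong M c (λ i → ∑-empty (λ s → α s * U s i)))
        (trans (det-≔-zero M c) (sym (∑-empty (λ s → α s * det _ (M [ c ≔ U s ])))))
det-≔-∑ {k = suc k} M c α U =
  trans (det-≔-cong M c (λ i → ∑-suc (λ s → α s * U s i)))
    (trans (det-≔-add M c (λ i → α zero * U zero i) (λ i → ∑ (λ s → α (suc s) * U (suc s) i)))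
      (trans (cong₂ _+_ (det-≔-scale M c (α zero) (U zero)) (det-≔-∑ M c (α ∘ suc) (U ∘ suc)))
        (sym (∑-suc (λ s → α s * det _ (M [ c ≔ U s ]))))))

private
  punchIn-adjacent : (j : Fin (suc (suc n))) (k : Fin (suc n)) → j ≢ inject₁ k → j ≢ suc k →
    Σ (Fin n) λ k′ → punchIn j (inject₁ k′) ≡ inject₁ k × punchIn j (suc k′) ≡ suc k
  punchIn-adjacent zero zero p q = ⊥-elim (p refl)
  punchIn-adjacent zero (suc k) p q = k , refl , refl
  punchIn-adjacent (suc zero) zero p q = ⊥-elim (q refl)
  punchIn-adjacent {suc n} (suc (suc j)) zero p q = zero , refl , refl
  punchIn-adjacent {suc n} (suc j) (suc k) p q
    with punchIn-adjacent j k (λ e → p (cong suc e)) (λ e → q (cong suc e))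
  ... | k′ , e , f = suc k′ , cong suc e , cong suc f

  punchIn-exchange : (k : Fin (suc n)) (b : Fin (suc n)) →
    punchIn (inject₁ k) b ≡ punchIn (suc k) b
    ⊎ (punchIn (inject₁ k) b ≡ suc k × punchIn (suc k) b ≡ inject₁ k)
  punchIn-exchange zero zero = inj₂ (refl , refl)
  punchIn-exchange zero (suc b) = inj₁ refl
  punchIn-exchange {suc n} (suc k) zero = inj₁ refl
  punchIn-exchange {suc n} (suc k) (suc b) with punchIn-exchange k b
  ... | inj₁ e = inj₁ (cong suc e)
  ... | inj₂ (e , f) = inj₂ (cong suc e , cong suc f)

  inject₁≢suc : (k : Fin n) → inject₁ k ≢ suc k
  inject₁≢suc (suc k) e = inject₁≢suc k (FinP.suc-injective e)

  -- In the first-row expansion the two equal columns have equal minors and opposite signs, while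
  -- every other minor still has two adjacent equal columns.
  det-adjacent : (M : Mat (suc n)) (k : Fin n) → (∀ i → M i (inject₁ k) ≡ M i (suc k)) → det (suc n) M ≡ + 0
  det-adjacent {suc n} M k h =
    trans (det-expand M) (trans (∑-pair (inject₁ k) (suc k) (inject₁≢suc k) others) cancel)
    where
    minors : det (suc n) (minor (inject₁ k) M) ≡ det (suc n) (minor (suc k) M)
    minors = det-cong λ a b → go a b (punchIn-exchange k b)
      where
      go : ∀ a b → _ → minor (inject₁ k) M a b ≡ minor (suc k) M a b
      go a b (inj₁ e) = cong (M (suc a)) e
      go a b (inj₂ (e , f)) = trans (cong (M (suc a)) e) (trans (sym (h (suc a))) (cong (M (suc a)) (sym f)))
    alg : ∀ s x d → s * (x * d) + - s * (x * d) ≡ + 0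
    alg = solve-∀
    cancel : cofactorTerm M (inject₁ k) + cofactorTerm M (suc k) ≡ + 0
    cancel = trans
      (cong₂ _+_
        (cong₂ (λ s t → s * (M zero (inject₁ k) * t)) (cong sgn (FinP.toℕ-inject₁ k)) minors)
        (cong₂ (λ s x → s * (x * det (suc n) (minor (suc k) M))) (sgn-suc (toℕ k)) (sym (h zero))))
      (alg (sgn (toℕ k)) (M zero (inject₁ k)) (det (suc n) (minor (suc k) M)))
    alg₀ : ∀ s x → s * (x * + 0) ≡ + 0
    alg₀ = solve-∀
    others : ∀ j → j ≢ inject₁ k → j ≢ suc k → cofactorTerm M j ≡ + 0
    others j p q with punchIn-adjacent j k p q
    ... | k′ , e , f =
      trans (cong (λ t → sgn (toℕ j) * (M zero j * t))
              (det-adjacent (minor j M) k′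
                (λ a → trans (cong (M (suc a)) e) (trans (h (suc a)) (cong (M (suc a)) (sym f))))))
            (alg₀ (sgn (toℕ j)) (M zero j))

Alternates : (c d : Fin n) → Set
Alternates {n} c d = (M : Mat n) → (∀ i → M i c ≡ M i d) → det n M ≡ + 0

≔-comm : (M : Mat n) {c d : Fin n} → c ≢ d → (u v : Fin n → ℤ) →
         ∀ i j → ((M [ c ≔ u ]) [ d ≔ v ]) i j ≡ ((M [ d ≔ v ]) [ c ≔ u ]) i j
≔-comm M {c} {d} c≢d u v i j with j ≟ c | j ≟ d
... | yes refl | yes refl = ⊥-elim (c≢d refl)
... | yes _ | no _  = refl
... | no _  | yes _ = refl
... | no _  | no _  = refl

private
  -- Polarisation: the determinant with `u + v` in both columns vanishes, and so do two of the four
  -- terms of its expansion; the two mixed terms remain.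
  swap-from : {c d : Fin n} → c ≢ d → Alternates c d → (M : Mat n) (u v : Fin n → ℤ) →
              det n ((M [ c ≔ u ]) [ d ≔ v ]) ≡ - det n ((M [ c ≔ v ]) [ d ≔ u ])
  swap-from {n} {c} {d} c≢d alt M u v = solveFor (F u v) (F v u)
    (trans (sym (trans (expandˡ u v s) (cong₂ _+_ (expandʳ u) (expandʳ v)))) (vanish s))
    where
    F : (u v : Fin n → ℤ) → ℤ
    F u v = det n ((M [ c ≔ u ]) [ d ≔ v ])
    s : Fin n → ℤ
    s i = u i + v i
    vanish : ∀ u → F u u ≡ + 0
    vanish u = alt _ λ i →
      trans (≔-off (M [ c ≔ u ]) d u i c≢d) (trans (≔-at M c u i) (sym (≔-at (M [ c ≔ u ]) d u i)))
    G : (u v : Fin n → ℤ) → F u v ≡ det n ((M [ d ≔ v ]) [ c ≔ u ])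
    G u v = det-cong (≔-comm M c≢d u v)
    expandˡ : ∀ u v t → F (λ i → u i + v i) t ≡ F u t + F v t
    expandˡ u v t = trans (G _ t) (trans (det-≔-add (M [ d ≔ t ]) c u v) (sym (cong₂ _+_ (G u t) (G v t))))
    expandʳ : ∀ t → F t s ≡ F t u + F t v
    expandʳ t = det-≔-add (M [ c ≔ t ]) d u v
    solveFor : ∀ x y → F u u + x + (y + F v v) ≡ + 0 → x ≡ - y
    solveFor x y e = trans (sym (lem x y)) (trans (cong (λ t → t + - y) (trans (sym (cong₂ (λ p q → p + x + (y + q)) (vanish u) (vanish v))) e)) (ℤP.+-identityˡ (- y)))
      where
      lem : ∀ x y → (+ 0 + x + (y + + 0)) + - y ≡ x
      lem = solve-∀

  -- Induction on the position of the right column: an adjacent swap moves it one place to the left,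
  -- at the cost of a sign, until it stands next to `c`.
  alternates-< : (k : ℕ) (c d : Fin n) → toℕ d ≡ suc k → toℕ c ℕ.≤ k → Alternates c d
  alternates-< {suc n} k c (suc d) eq c≤k M h with toℕ c ℕP.≟ k
  ... | yes c≡k = det-adjacent M d λ i → trans (cong (M i) (sym c≡d)) (h i)
    where
    c≡d : c ≡ inject₁ d
    c≡d = FinP.toℕ-injective (trans c≡k (trans (ℕP.suc-injective (sym eq)) (sym (FinP.toℕ-inject₁ d))))
  alternates-< {suc n} zero c (suc d) eq c≤k M h | no c≢k = ⊥-elim (c≢k (ℕP.n≤0⇒n≡0 c≤k))
  alternates-< {suc n} (suc k) c (suc d) eq c≤k M h | no c≢k =
    trans (sym (≔-self M (suc d)))
      (trans (det-cong (≔-ext M (M″) (suc d) M″-off (λ i → ≔-at M′ (suc d) (λ i → M i (suc d)) i)))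
        (trans (swap-from (inject₁≢suc d) (λ N → det-adjacent N d) M (λ i → M i (inject₁ d)) (λ i → M i (suc d)))
          (cong -_ (alternates-< k c (inject₁ d) (trans (FinP.toℕ-inject₁ d) (ℕP.suc-injective eq)) c≤k′ N N-eq))))
    where
    M′ = M [ inject₁ d ≔ (λ i → M i (inject₁ d)) ]
    M″ = M′ [ suc d ≔ (λ i → M i (suc d)) ]
    N₁ = M [ inject₁ d ≔ (λ i → M i (suc d)) ]
    N = N₁ [ suc d ≔ (λ i → M i (inject₁ d)) ]
    c≤k′ : toℕ c ℕ.≤ k
    c≤k′ = ℕ.s≤s⁻¹ (ℕP.≤∧≢⇒< c≤k c≢k)
    M″-off : ∀ i j → j ≢ suc d → M″ i j ≡ M i j
    M″-off i j j≢ = trans (≔-off M′ (suc d) (λ i → M i (suc d)) i j≢) (≔-ext M M (inject₁ d) (λ _ _ _ → refl) (λ _ → refl) i j)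
    toℕd : toℕ (inject₁ d) ≡ suc k
    toℕd = trans (FinP.toℕ-inject₁ d) (ℕP.suc-injective eq)
    c≢sd : c ≢ suc d
    c≢sd e = ℕP.<⇒≢ (s≤s (ℕP.m≤n⇒m≤1+n c≤k′)) (trans (cong toℕ e) eq)
    c≢d : c ≢ inject₁ d
    c≢d e = ℕP.<⇒≢ (s≤s c≤k′) (trans (cong toℕ e) toℕd)
    N-eq : ∀ i → N i c ≡ N i (inject₁ d)
    N-eq i = trans (≔-off N₁ (suc d) colˡ i c≢sd) (trans (≔-off M (inject₁ d) colʳ i c≢d)
      (trans (h i) (sym (trans (≔-off N₁ (suc d) colˡ i (inject₁≢suc d)) (≔-at M (inject₁ d) colʳ i)))))
      where
      colˡ colʳ : Fin (suc n) → ℤ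
      colˡ i = M i (inject₁ d)
      colʳ i = M i (suc d)

  alternates-lt : (c d : Fin n) → toℕ c ℕ.< toℕ d → Alternates c d
  alternates-lt c (suc d) (s≤s c≤d) = alternates-< (toℕ d) c (suc d) refl c≤d

det-alternating : {c d : Fin n} → c ≢ d → Alternates c d
det-alternating {c = c} {d} c≢d M h with toℕ c ℕP.<? toℕ d
... | yes c<d = alternates-lt c d c<d M h
... | no c≮d  = alternates-lt d c (ℕP.≤∧≢⇒< (ℕP.≮⇒≥ c≮d) (λ e → c≢d (FinP.toℕ-injective (sym e)))) M (λ i → sym (h i))

det-swap : {c d : Fin n} → c ≢ d → (M : Mat n) (u v : Fin n → ℤ) →
           det n ((M [ c ≔ u ]) [ d ≔ v ]) ≡ - det n ((M [ c ≔ v ]) [ d ≔ u ])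
det-swap c≢d = swap-from c≢d (det-alternating c≢d)

det-≔-column : (M : Mat n) (r j : Fin n) → det n (M [ r ≔ (λ i → M i j) ]) ≡ δ r j * det n M
det-≔-column {n} M r j with r ≟ j
... | yes refl = trans (≔-self M r) (sym (ℤP.*-identityˡ (det n M)))
... | no r≢j = det-alternating r≢j (M [ r ≔ (λ i → M i j) ])
                 (λ i → trans (≔-at M r (λ i → M i j) i) (sym (≔-off M r (λ i → M i j) i (≢-sym r≢j))))

-- By linearity only the summand `j = k` survives, as the others repeat a column. This is Cramer's
-- rule without division.
det-≔-combination : (M : Mat n) (k : Fin n) (w : Fin n → ℤ) →
                    det n (M [ k ≔ (λ i → ∑ (λ j → w j * M i j)) ]) ≡ w k * det n M
det-≔-combination {n} M k w =
  trans (det-≔-∑ M k w (λ j i → M i j))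
    (trans (∑-cong (λ j → trans (cong (w j *_) (det-≔-column M k j)) (lem (w j) (δ k j) (det n M))))
           (∑-δˡ k (λ j → w j * det n M)))
  where
  lem : ∀ a b c → a * (b * c) ≡ b * (a * c)
  lem = solve-∀

det-kernel : (M : Mat n) (w : Fin n → ℤ) → (∀ i → ∑ (λ j → w j * M i j) ≡ + 0) → ∀ k → w k * det n M ≡ + 0
det-kernel M w h k = trans (sym (det-≔-combination M k w)) (trans (det-≔-cong M k h) (det-≔-zero M k))

basis : Fin n → Fin n → ℤ
basis i k = δ k i

-- Cofactors in Cramer form. No sign or deleted index is needed, and `adjugate-law` becomes a
-- statement about replaced columns.
adjugate : Mat n → Mat n
adjugate {n} M r i = det n (M [ r ≔ basis i ])

det-≔-basis : (M : Mat n) (r : Fin n) (v : Fin n → ℤ) → det n (M [ r ≔ v ]) ≡ ∑ (λ i → v i * adjugate M r i)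
det-≔-basis M r v =
  trans (det-≔-cong M r (λ k → sym (trans (∑-cong (λ i → ℤP.*-comm (v i) (δ k i))) (∑-δˡ k v))))
        (det-≔-∑ M r v basis)

adjugate-law : (M : Mat n) (r j : Fin n) → ∑ (λ i → adjugate M r i * M i j) ≡ δ r j * det n M
adjugate-law M r j =
  trans (∑-cong (λ i → ℤP.*-comm (adjugate M r i) (M i j)))
        (trans (sym (det-≔-basis M r (λ i → M i j))) (det-≔-column M r j))

det-δ : ∀ n → det n δ ≡ + 1
det-δ zero = refl
det-δ (suc n) = trans (det-expand {n} δ)
  (trans (∑-single zero {f = cofactorTerm {n} δ} off) (trans (cong (λ t → + 1 * (+ 1 * t)) (det-δ n)) refl))
  where
  off : ∀ j → j ≢ zero → cofactorTerm {n} δ j ≡ + 0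
  off zero j≢ = ⊥-elim (j≢ refl)
  off (suc j) _ = ℤP.*-zeroʳ (sgn (toℕ (suc j)))

-- Column `w` is split into its entry in row `u` and the rest; with the rest in place, row `u` is
-- zero.
det-rowSingle : (M : Mat n) (u w : Fin n) → (∀ j → j ≢ w → M u j ≡ + 0) →
                det n M ≡ M u w * det n (M [ w ≔ basis u ])
det-rowSingle {n} M u w h =
  trans (sym (≔-self M w))
    (trans (det-≔-cong M w split)
      (trans (det-≔-lin M w (M u w) (+ 1) (basis u) rest)
        (trans (cong (λ t → M u w * det n (M [ w ≔ basis u ]) + + 1 * t) vanish) (lem _))))
  where
  rest : Fin n → ℤ
  rest i = M i w - M u w * δ i u
  lem : ∀ x → x + + 1 * + 0 ≡ x
  lem = solve-∀
  split-alg : ∀ x y d → x ≡ y * d + + 1 * (x - y * d)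
  split-alg = solve-∀
  split : ∀ i → M i w ≡ M u w * basis u i + + 1 * rest i
  split i = split-alg (M i w) (M u w) (δ i u)
  zero-alg : ∀ x → x - x * + 1 ≡ + 0
  zero-alg = solve-∀
  vanish : det n (M [ w ≔ rest ]) ≡ + 0
  vanish = det-zeroRow (M [ w ≔ rest ]) u row
    where
    row : ∀ j → (M [ w ≔ rest ]) u j ≡ + 0
    row j with j ≟ w
    ... | yes _ = trans (cong (λ t → M u w - M u w * t) (δ-refl u)) (zero-alg (M u w))
    ... | no j≢w = h j j≢w

-- Principal minors and their expansion at isolated vertices and path ends

ins : Fin n → (Fin n → Bool) → Fin n → Bool
ins u S j = does (j ≟ u) ∨ S j

-- The columns in S are replaced by unit vectors, so det (M ∖ S) is the principal minor of M with S deleted.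
_∖_ : Mat n → (Fin n → Bool) → Mat n
(M ∖ S) i j = if S j then δ i j else M i j

∖-ins : (M : Mat n) (S : Fin n → Bool) (u : Fin n) → ∀ i j → ((M ∖ S) [ u ≔ basis u ]) i j ≡ (M ∖ ins u S) i j
∖-ins M S u i j with j ≟ u
... | yes refl = refl
... | no _ = refl

∖-false : (M : Mat n) (S : Fin n → Bool) (i : Fin n) {j : Fin n} → S j ≡ false → (M ∖ S) i j ≡ M i j
∖-false M S i e rewrite e = refl

∖-true : (M : Mat n) (S : Fin n → Bool) (i : Fin n) {j : Fin n} → S j ≡ true → (M ∖ S) i j ≡ δ i j
∖-true M S i e rewrite e = refl

≔-cong : {M N : Mat n} (c : Fin n) (v : Fin n → ℤ) → (∀ i j → M i j ≡ N i j) → ∀ i j → (M [ c ≔ v ]) i j ≡ (N [ c ≔ v ]) i j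
≔-cong c v h i j with j ≟ c
... | yes _ = refl
... | no _ = h i j

private
  false≢true : ∀ {b} → b ≡ false → b ≡ true → ⊥
  false≢true refl ()

  row-zero : (M : Mat n) (S : Fin n → Bool) (u : Fin n) → S u ≡ false → ∀ j → (S j ≡ false → M u j ≡ + 0) → (M ∖ S) u j ≡ + 0
  row-zero M S u Su j h with S j in Sj
  ... | false = h refl
  ... | true  = δ-≢ {i = u} {j} λ { refl → false≢true Su Sj }

minor-isolated : (M : Mat n) (S : Fin n → Bool) (u : Fin n) → S u ≡ false →
                 (∀ j → S j ≡ false → j ≢ u → M u j ≡ + 0) →
                 det n (M ∖ S) ≡ M u u * det n (M ∖ ins u S)
minor-isolated {n} M S u Su h =
  trans (det-rowSingle (M ∖ S) u u (λ j j≢u → row-zero M S u Su j (λ Sj → h j Sj j≢u)))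
        (cong₂ _*_ (∖-false M S u Su) (det-cong (∖-ins M S u)))

-- The three-term recurrence of continuants, at a vertex `u` whose only remaining neighbour is `w`.
-- Column `u` is split into its diagonal entry and the rest; in the second part row `u` survives
-- only at `w`, and after a column swap the moved column contributes only through row `w`.
minor-pathEnd : (M : Mat n) (S : Fin n → Bool) (u w : Fin n) → S u ≡ false → S w ≡ false → u ≢ w →
                (∀ j → S j ≡ false → j ≢ u → j ≢ w → M u j ≡ + 0) →
                (∀ j → S j ≡ false → j ≢ u → j ≢ w → M j u ≡ + 0) →
                det n (M ∖ S) ≡ M u u * det n (M ∖ ins u S) + - (M u w * M w u) * det n (M ∖ ins w (ins u S))
minor-pathEnd {n} M S u w Su Sw u≢w hrow hcol =
  trans (sym (≔-self N u))
    (trans (det-≔-cong N u split)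
      (trans (det-≔-lin N u (M u u) (+ 1) (basis u) rest)
        (trans (cong₂ (λ s t → M u u * s + + 1 * t) (det-cong (∖-ins M S u)) second)
               (final (M u u * det n (M ∖ ins u S)) (M u w) (M w u) (det n (M ∖ ins w (ins u S)))))))
  where
  N = M ∖ S
  rest : Fin n → ℤ
  rest i = N i u - M u u * δ i u
  split-alg : ∀ x y d → x ≡ y * d + + 1 * (x - y * d)
  split-alg = solve-∀
  split : ∀ i → N i u ≡ M u u * basis u i + + 1 * rest i
  split i = split-alg (N i u) (M u u) (δ i u)
  final : ∀ x a b d → x + + 1 * (a * - (b * d)) ≡ x + - (a * b) * d
  final = solve-∀
  zero-alg : ∀ x → x - x * + 1 ≡ + 0
  zero-alg = solve-∀
  rest-u : rest u ≡ + 0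
  rest-u = trans (cong₂ (λ s t → s - M u u * t) (∖-false M S u Su) (δ-refl u)) (zero-alg (M u u))
  rest-off : ∀ i → i ≢ u → rest i ≡ M i u
  rest-off i i≢u = trans (cong₂ (λ s t → s - M u u * t) (∖-false M S i Su) (δ-≢ i≢u)) (alg (M i u) (M u u))
    where
    alg : ∀ x y → x - y * + 0 ≡ x
    alg = solve-∀
  row : ∀ j → j ≢ w → (N [ u ≔ rest ]) u j ≡ + 0
  row j j≢w with j ≟ u
  ... | yes _ = rest-u
  ... | no j≢u = row-zero M S u Su j (λ Sj → hrow j Sj j≢u j≢w)
  Nw = (N [ u ≔ basis u ])
  -- Outside `S` the entry itself vanishes. Inside `S`, column `i` is already the unit vector at
  -- `i`, so that two columns coincide.
  collapse : ∀ i → i ≢ w → rest i * det n (Nw [ w ≔ basis i ]) ≡ + 0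
  collapse i i≢w = by-column (i ≟ u)
    where
    restZero : rest i ≡ + 0 → rest i * det n (Nw [ w ≔ basis i ]) ≡ + 0
    restZero e = cong (_* det n (Nw [ w ≔ basis i ])) e
    by-set : i ≢ u → (b : Bool) → S i ≡ b → rest i * det n (Nw [ w ≔ basis i ]) ≡ + 0
    by-set i≢u false Si = restZero (trans (rest-off i i≢u) (hcol i Si i≢u i≢w))
    by-set i≢u true Si = trans (cong (rest i *_) (det-alternating (≢-sym i≢w) (Nw [ w ≔ basis i ]) same)) (ℤP.*-zeroʳ (rest i))
      where
      same : ∀ k → (Nw [ w ≔ basis i ]) k w ≡ (Nw [ w ≔ basis i ]) k i
      same k = trans (≔-at Nw w (basis i) k)
        (sym (trans (≔-off Nw w (basis i) k i≢w) (trans (≔-off N u (basis u) k i≢u) (∖-true M S k Si))))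
    by-column : Dec (i ≡ u) → rest i * det n (Nw [ w ≔ basis i ]) ≡ + 0
    by-column (yes refl) = restZero rest-u
    by-column (no i≢u) = by-set i≢u (S i) refl
  last-step : det n (Nw [ w ≔ rest ]) ≡ M w u * det n (M ∖ ins w (ins u S))
  last-step = trans (det-≔-basis Nw w rest)
    (trans (∑-single w collapse)
      (cong₂ _*_ (rest-off w (≢-sym u≢w))
        (trans (det-cong (≔-cong w (basis w) (∖-ins M S u))) (det-cong (∖-ins M (ins u S) w)))))
  second : det n (N [ u ≔ rest ]) ≡ M u w * - (M w u * det n (M ∖ ins w (ins u S)))
  second = trans (det-rowSingle (N [ u ≔ rest ]) u w row)
    (cong₂ _*_ (trans (≔-off N u rest u (≢-sym u≢w)) (∖-false M S u Sw))
      (trans (det-swap u≢w N rest (basis u)) (cong -_ last-step)))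

det-∖-all : (M : Mat n) (S : Fin n → Bool) → (∀ j → S j ≡ true) → det n (M ∖ S) ≡ + 1
det-∖-all {n} M S h = trans (det-cong (λ i j → ∖-true M S i (h j))) (det-δ n)

-- Characteristic polynomials

+-cancelˡ : ∀ x a b → x + a ≡ x + b → a ≡ b
+-cancelˡ x a b e = trans (sym (lem x a)) (trans (cong (λ t → - x + t) e) (lem x b))
  where
  lem : ∀ x a → - x + (x + a) ≡ a
  lem = solve-∀

-- Congruence modulo `h` with its quotient. Congruences for all `h` replace the comparison of
-- coefficients of polynomials.
Cong : ℤ → ℤ → ℤ → Set
Cong h a b = Σ ℤ λ r → a ≡ b + h * r

∑-mod : (h : ℤ) {f g : Fin n → ℤ} → (∀ i → Cong h (f i) (g i)) → Cong h (∑ f) (∑ g)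
∑-mod h {f} {g} c = ∑ (λ i → proj₁ (c i)) ,
  trans (∑-cong (λ i → proj₂ (c i)))
    (trans (∑-add g (λ i → h * proj₁ (c i))) (cong (λ t → ∑ g + t) (∑-scale h (λ i → proj₁ (c i)))))

det-mod : (h : ℤ) {M N : Mat n} → (∀ i j → Cong h (M i j) (N i j)) → Cong h (det n M) (det n N)
det-mod {zero}  h c = + 0 , zz h
  where
  zz : ∀ h → + 1 ≡ + 1 + h * + 0
  zz = solve-∀
det-mod {suc n} h {M} {N} c = proj₁ total ,
  trans (det-expand M) (trans (proj₂ total) (cong (λ t → t + h * proj₁ total) (sym (det-expand N))))
  where
  alg : ∀ h s x d p q → s * ((x + h * p) * (d + h * q)) ≡ s * (x * d) + h * (s * (p * d + x * q + h * (p * q)))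
  alg = solve-∀
  combine : ∀ s {x x′ d d′} → Cong h x′ x → Cong h d′ d → Cong h (s * (x′ * d′)) (s * (x * d))
  combine s {x} {x′} {d} {d′} (p , e) (q , f) = s * (p * d + x * q + h * (p * q)) , trans (cong₂ (λ y z → s * (y * z)) e f) (alg h s x d p q)
  term : ∀ j → Cong h (cofactorTerm M j) (cofactorTerm N j)
  term j = combine (sgn (toℕ j)) {N zero j} {M zero j} {det n (minor j N)} {det n (minor j M)}
    (c zero j) (det-mod h (λ a b → c (suc a) (punchIn j b)))
  total : Cong h (∑ (cofactorTerm M)) (∑ (cofactorTerm N))
  total = ∑-mod h term

-- The modulus `∣ a - b ∣ + 1` exceeds the difference that it divides.
cong-all⇒≡ : (a b : ℤ) → (∀ k → Cong (+ suc k) a b) → a ≡ b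
cong-all⇒≡ a b c with c ∣ a - b ∣
... | r , e = ℤP.i-j≡0⇒i≡j a b (ℤP.∣i∣≡0⇒i≡0 (small ∣ a - b ∣ ∣ r ∣ abs-eq))
  where
  alg : ∀ b t → b + t - b ≡ t
  alg = solve-∀
  abs-eq : ∣ a - b ∣ ≡ suc ∣ a - b ∣ ℕ.* ∣ r ∣
  abs-eq = trans (cong ∣_∣ (trans (cong (_- b) e) (alg b (+ suc ∣ a - b ∣ * r)))) (ℤP.abs-* (+ suc ∣ a - b ∣) r)
  small : ∀ x y → x ≡ suc x ℕ.* y → x ≡ 0
  small x zero    e = trans e (ℕP.*-zeroʳ (suc x))
  small x (suc y) e = ⊥-elim (ℕP.<-irrefl e (ℕP.≤-trans (ℕP.≤-reflexive (sym (ℕP.*-identityʳ (suc x)))) (ℕP.*-monoʳ-≤ (suc x) (s≤s z≤n))))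

setOf : List (Fin n) → Fin n → Bool
setOf []       = λ _ → false
setOf (c ∷ cs) = ins c (setOf cs)

setOf-∉ : {j : Fin n} (cs : List (Fin n)) → All (j ≢_) cs → setOf cs j ≡ false
setOf-∉ [] [] = refl
setOf-∉ {j = j} (c ∷ cs) (j≢c ∷ rest) rewrite dec-false (j ≟ c) j≢c = setOf-∉ cs rest

setOf-∈ : {j : Fin n} {cs : List (Fin n)} → j ∈ cs → setOf cs j ≡ true
setOf-∈ {j = j} (here refl) rewrite dec-true (j ≟ j) refl = refl
setOf-∈ {j = j} {c ∷ cs} (there p) with does (j ≟ c)
... | true  = refl
... | false = setOf-∈ p

sumℤ-allFin : (f : Fin n → ℤ) → sumℤ (map f (allFin n)) ≡ ∑ f
sumℤ-allFin f = sumℤ-tabulate f id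

private
  perturb : Mat n → ℤ → (Fin n → Bool) → Mat n
  perturb M h S i j = M i j + (if S j then h else + 0) * δ i j

  -- Diagonal entries are perturbed one at a time. Linearity in column `c` adds `h` times a cofactor
  -- of the matrix perturbed so far, which agrees with the cofactor of `M` modulo `h`; the error is
  -- a multiple of `h * h`.
  perturb-det : (M : Mat n) (h : ℤ) (cs : List (Fin n)) → Unique cs →
    Cong (h * h) (det n (perturb M h (setOf cs))) (det n M + h * sumℤ (map (λ c → adjugate M c c) cs))
  perturb-det {n} M h [] _ = + 0 , trans (det-cong (λ i j → alg₁ (M i j) (δ i j))) (alg₂ (det n M) h)
    where
    alg₁ : ∀ x y → x + + 0 * y ≡ x
    alg₁ = solve-∀
    alg₂ : ∀ x h → x ≡ x + h * + 0 + h * h * + 0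
    alg₂ = solve-∀
  perturb-det {n} M h (c ∷ cs) (c∉ ∷ uniq)
    with perturb-det M h cs uniq
       | det-mod h {perturb M h (setOf cs) [ c ≔ basis c ]} {M [ c ≔ basis c ]} close
    where
    alg₀ : ∀ x h → x ≡ x + h * + 0
    alg₀ = solve-∀
    pcong : ∀ b x d → Cong h (x + (if b then h else + 0) * d) x
    pcong true  x d = d , refl
    pcong false x d = + 0 , trans (trans (cong (λ t → x + t) (ℤP.*-zeroˡ d)) (ℤP.+-identityʳ x)) (alg₀ x h)
    close : ∀ i j → Cong h ((perturb M h (setOf cs) [ c ≔ basis c ]) i j) ((M [ c ≔ basis c ]) i j)
    close i j with does (j ≟ c)
    ... | true  = + 0 , alg₀ (basis c i) h
    ... | false = pcong (setOf cs j) (M i j) (δ i j)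
  ... | r , e | s , f = r + s ,
      trans (sym (trans (det-≔-cong P c (λ i → sym (at i))) (det-cong (≔-ext P P′ c off (λ _ → refl)))))
        (trans (det-≔-lin P c (+ 1) h (λ i → P i c) (basis c))
          (trans (cong₂ (λ x y → + 1 * x + h * y) (trans (≔-self P c) e) f)
            (alg (det n M) h (sumℤ (map (λ c → adjugate M c c) cs)) (adjugate M c c) r s)))
    where
    P = perturb M h (setOf cs)
    P′ = perturb M h (setOf (c ∷ cs))
    alg : ∀ d h t a r s → + 1 * (d + h * t + h * h * r) + h * (a + h * s) ≡ d + h * (a + t) + h * h * (r + s)
    alg = solve-∀
    alg₁ : ∀ x h d → x + h * d ≡ + 1 * (x + + 0 * d) + h * d
    alg₁ = solve-∀
    at : ∀ i → P′ i c ≡ + 1 * P i c + h * basis c i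
    at i rewrite dec-true (c ≟ c) refl | setOf-∉ cs c∉ = alg₁ (M i c) h (δ i c)
    off : ∀ i j → j ≢ c → P′ i j ≡ P i j
    off i j j≢c rewrite dec-false (j ≟ c) j≢c = refl

det-derivative : (M : Mat n) (h : ℤ) →
  Cong (h * h) (det n (λ i j → M i j + h * δ i j)) (det n M + h * ∑ (λ c → adjugate M c c))
det-derivative {n} M h with perturb-det M h (allFin n) (allFin⁺ n)
... | r , e = r , trans (det-cong (λ i j → cong (λ b → M i j + (if b then h else + 0) * δ i j) (sym (setOf-∈ (∈-allFin j)))))
                    (trans e (cong (λ t → det n M + h * t + h * h * r) (sumℤ-allFin (λ c → adjugate M c c))))

charMat : Mat n → ℤ → Mat n
charMat Q z i j = z * δ i j - Q i j

charPoly : Mat n → ℤ → ℤ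
charPoly {n} Q z = det n (charMat Q z)

-- Polynomial growth, in the variable z + 1 so that it never vanishes.
record IsO (d : ℕ) (f : ℕ → ℤ) : Set where
  constructor _,O_
  field
    factor : ℕ
    bounded : ∀ z → ∣ f z ∣ ℕ.≤ factor ℕ.* suc z ℕ.^ d

O-cong : {d : ℕ} {f g : ℕ → ℤ} → (∀ z → f z ≡ g z) → IsO d f → IsO d g
O-cong e (C ,O b) = C ,O λ z → subst (λ t → ∣ t ∣ ℕ.≤ _) (e z) (b z)

O-add : {d : ℕ} {f g : ℕ → ℤ} → IsO d f → IsO d g → IsO d (λ z → f z + g z)
O-add {d} {f} {g} (C ,O b) (D ,O c) = (C ℕ.+ D) ,O λ z →
  ℕP.≤-trans (ℤP.∣i+j∣≤∣i∣+∣j∣ (f z) (g z))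
    (ℕP.≤-trans (ℕP.+-mono-≤ (b z) (c z)) (ℕP.≤-reflexive (sym (ℕP.*-distribʳ-+ (suc z ℕ.^ d) C D))))

O-mul : {d e : ℕ} {f g : ℕ → ℤ} → IsO d f → IsO e g → IsO (d ℕ.+ e) (λ z → f z * g z)
O-mul {d} {e} {f} {g} (C ,O b) (D ,O c) = (C ℕ.* D) ,O λ z →
  ℕP.≤-trans (ℕP.≤-reflexive (ℤP.abs-* (f z) (g z)))
    (ℕP.≤-trans (ℕP.*-mono-≤ (b z) (c z)) (ℕP.≤-reflexive (eq z)))
  where
  eq : ∀ z → C ℕ.* suc z ℕ.^ d ℕ.* (D ℕ.* suc z ℕ.^ e) ≡ C ℕ.* D ℕ.* suc z ℕ.^ (d ℕ.+ e)
  eq z = trans (ℕP.[m*n]*[o*p]≡[m*o]*[n*p] C (suc z ℕ.^ d) D (suc z ℕ.^ e))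
               (cong (C ℕ.* D ℕ.*_) (sym (ℕP.^-distribˡ-+-* (suc z) d e)))

O-const : (a : ℤ) → IsO 0 (λ _ → a)
O-const a = ∣ a ∣ ,O λ z → ℕP.≤-reflexive (sym (ℕP.*-identityʳ ∣ a ∣))

O-weaken : {d e : ℕ} {f : ℕ → ℤ} → d ℕ.≤ e → IsO d f → IsO e f
O-weaken d≤e (C ,O b) = C ,O λ z → ℕP.≤-trans (b z) (ℕP.*-monoʳ-≤ C (ℕP.^-monoʳ-≤ (suc z) d≤e))

O-var : IsO 1 (λ z → + suc z)
O-var = 1 ,O λ z → ℕP.≤-reflexive (sym (trans (ℕP.*-identityˡ _) (ℕP.*-identityʳ (suc z))))

O-neg : {d : ℕ} {f : ℕ → ℤ} → IsO d f → IsO d (λ z → - f z)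
O-neg {f = f} (C ,O b) = C ,O λ z → subst (ℕ._≤ _) (sym (ℤP.∣-i∣≡∣i∣ (f z))) (b z)

O-scale : {d : ℕ} {f : ℕ → ℤ} (a : ℤ) → IsO d f → IsO d (λ z → a * f z)
O-scale a o = O-mul (O-const a) o

O-∑ : {d : ℕ} (f : ℕ → Fin n → ℤ) → (∀ i → IsO d (λ z → f z i)) → IsO d (λ z → ∑ (f z))
O-∑ {n = zero} f h = O-cong (λ z → sym (∑-empty (f z))) (O-weaken z≤n (O-const (+ 0)))
O-∑ {n = suc n} f h = O-cong (λ z → sym (∑-suc (f z))) (O-add (h zero) (O-∑ (λ z → f z ∘ suc) (h ∘ suc)))

-- Each product in the expansion takes one entry from every column, so the bounds are given per
-- column and add up. `O-adj` relies on this: one of its columns is constant.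
O-det : (M : ℕ → Mat n) (e : Fin n → ℕ) → (∀ i j → IsO (e j) (λ z → M z i j)) → IsO (SumN.sum e) (λ z → det n (M z))
O-det {zero} M e h = O-const (+ 1)
O-det {suc n} M e h = O-cong (λ z → sym (det-expand (M z)))
  (O-∑ (λ z → cofactorTerm (M z)) λ j → O-scale (sgn (toℕ j))
    (subst (λ d → IsO d (λ z → M z zero j * det n (minor j (M z)))) (sym (SumN.sum-remove {i = j} e))
      (O-mul (h zero j) (O-det (λ z → minor j (M z)) (λ b → e (punchIn j b)) (λ a b → h (suc a) (punchIn j b))))))

sum-ones : ∀ n → SumN.sum {n} (λ _ → 1) ≡ n
sum-ones zero = refl
sum-ones (suc n) = cong suc (sum-ones n)

O-charMat : (Q : Mat n) (i j : Fin n) → IsO 1 (λ z → charMat Q (+ suc z) i j)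
O-charMat Q i j = O-add (O-mul O-var (O-const (δ i j))) (O-weaken z≤n (O-const (- Q i j)))

O-charPoly : (Q : Mat n) → IsO n (λ z → charPoly Q (+ suc z))
O-charPoly {n} Q = subst (λ d → IsO d (λ z → charPoly Q (+ suc z))) (sum-ones n)
  (O-det (λ z → charMat Q (+ suc z)) (λ _ → 1) (O-charMat Q))

O-adj : (Q : Mat (suc n)) (r i : Fin (suc n)) → IsO n (λ z → adjugate (charMat Q (+ suc z)) r i)
O-adj {n} Q r i = subst (λ d → IsO d (λ z → adjugate (charMat Q (+ suc z)) r i)) total
  (O-det (λ z → charMat Q (+ suc z) [ r ≔ basis i ]) e entry)
  where
  e : Fin (suc n) → ℕ
  e j = if does (j ≟ r) then 0 else 1
  total : SumN.sum e ≡ n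
  total = trans (SumN.sum-remove {i = r} e)
    (cong₂ ℕ._+_ (cong (λ b → if b then 0 else 1) (dec-true (r ≟ r) refl))
      (trans (SumN.sum-cong-≗ {n} (λ k → cong (λ b → if b then 0 else 1) (dec-false (punchIn r k ≟ r) (FinP.punchInᵢ≢i r k)))) (sum-ones n)))
  entry : ∀ a j → IsO (e j) (λ z → (charMat Q (+ suc z) [ r ≔ basis i ]) a j)
  entry a j with does (j ≟ r)
  ... | true  = O-const (basis i a)
  ... | false = O-charMat Q a j

-- Off the diagonal the first row contributes no power of z, so only the diagonal term carries the
-- leading one. The extra factor z stands for an exponent n - 1 on the right, which would be wrong
-- for n = 0.
charPoly-monic : (Q : Mat n) → IsO n (λ z → + suc z * (charPoly Q (+ suc z) - + (suc z ℕ.^ n)))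
charPoly-monic {zero} Q = O-cong (λ z → sym (alg (+ suc z))) (O-const (+ 0))
  where
  alg : ∀ z → z * (+ 1 - + 1) ≡ + 0
  alg = solve-∀
charPoly-monic {suc n} Q = O-cong eq
  (O-add (O-mul O-var (charPoly-monic Q′))
    (O-add (O-neg (O-mul O-var (O-scale (Q zero zero) (O-charPoly Q′))))
           (O-mul O-var (O-∑ tailTerm tail-O))))
  where
  Q′ : Mat n
  Q′ a b = Q (suc a) (suc b)
  tailTerm : ℕ → Fin n → ℤ
  tailTerm z j = cofactorTerm (charMat Q (+ suc z)) (suc j)
  tail-O : ∀ j → IsO n (λ z → tailTerm z j)
  tail-O j = O-scale (sgn (toℕ (suc j)))
    (O-mul (O-cong (λ z → sym (ez (+ suc z) (Q zero (suc j)))) (O-const (- Q zero (suc j))))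
      (subst (λ d → IsO d (λ z → det n (minor (suc j) (charMat Q (+ suc z))))) (sum-ones n)
        (O-det (λ z → minor (suc j) (charMat Q (+ suc z))) (λ _ → 1) (λ a b → O-charMat Q (suc a) (punchIn (suc j) b)))))
    where
    ez : ∀ z q → z * + 0 - q ≡ - q
    ez = solve-∀
  alg : ∀ z p w q t → z * (z * (p - w)) + (- (z * (q * p)) + z * t) ≡ z * (+ 1 * ((z * + 1 - q) * p) + t - z * w)
  alg = solve-∀
  eq : ∀ z → + suc z * (+ suc z * (charPoly Q′ (+ suc z) - + (suc z ℕ.^ n))) + (- (+ suc z * (Q zero zero * charPoly Q′ (+ suc z))) + + suc z * ∑ (tailTerm z))
             ≡ + suc z * (charPoly Q (+ suc z) - + (suc z ℕ.^ suc n))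
  eq z = trans (alg (+ suc z) (charPoly Q′ (+ suc z)) (+ (suc z ℕ.^ n)) (Q zero zero) (∑ (tailTerm z)))
    (cong₂ (λ p w → + suc z * (p - w))
      (sym (trans (det-expand (charMat Q (+ suc z))) (∑-suc (cofactorTerm (charMat Q (+ suc z))))))
      (sym (ℤP.pos-* (suc z) (suc z ℕ.^ n))))

-- The bound fails at z = C, the bounding constant itself, unless `a` vanishes.
O-leading : (d : ℕ) (a : ℤ) → IsO d (λ z → a * + (suc z ℕ.^ suc d)) → a ≡ + 0
O-leading d a (C ,O b) = ℤP.∣i∣≡0⇒i≡0 (small ∣ a ∣ bound)
  where
  bound : ∣ a ∣ ℕ.* suc C ℕ.≤ C
  bound = ℕP.*-cancelʳ-≤ (∣ a ∣ ℕ.* suc C) C (suc C ℕ.^ d) {{ℕP.m^n≢0 (suc C) d}}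
    (subst (ℕ._≤ C ℕ.* suc C ℕ.^ d)
      (trans (ℤP.abs-* a (+ (suc C ℕ.^ suc d))) (sym (ℕP.*-assoc ∣ a ∣ (suc C) (suc C ℕ.^ d)))) (b C))
  small : ∀ x → x ℕ.* suc C ℕ.≤ C → x ≡ 0
  small zero    _ = refl
  small (suc x) p = ⊥-elim (ℕP.<-irrefl refl (ℕP.≤-trans (ℕP.m≤m+n (suc C) (x ℕ.* suc C)) p))

private
  leading-split : ∀ a z p w → a * (z * w) ≡ a * (z * p) + - (a * (z * (p - w)))
  leading-split = solve-∀

  -- If n < m, then z times the common polynomial is O(zᵐ) by its degree as `charPoly Q`, while
  -- monicity of `charPoly R` makes it zᵐ⁺¹ up to O(zᵐ).
  size-≮ : (Q : Mat n) (R : Mat m) → (∀ z → charPoly Q z ≡ charPoly R z) → ¬ (n ℕ.< m)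
  size-≮ {n} {m} Q R h n<m = 1≢0 (O-leading m (+ 1) (O-cong eq
      (O-add (O-scale (+ 1) (O-weaken n<m (O-mul O-var (O-charPoly Q))))
             (O-neg (O-scale (+ 1) (charPoly-monic R))))))
    where
    1≢0 : + 1 ≡ + 0 → ⊥
    1≢0 ()
    eq : ∀ z → + 1 * (+ suc z * charPoly Q (+ suc z)) + - (+ 1 * (+ suc z * (charPoly R (+ suc z) - + (suc z ℕ.^ m)))) ≡ + 1 * + (suc z ℕ.^ suc m)
    eq z = trans (cong (λ p → + 1 * (+ suc z * p) + - (+ 1 * (+ suc z * (charPoly R (+ suc z) - + (suc z ℕ.^ m))))) (h (+ suc z)))
      (trans (sym (leading-split (+ 1) (+ suc z) (charPoly R (+ suc z)) (+ (suc z ℕ.^ m)))) (cong (+ 1 *_) (sym (ℤP.pos-* (suc z) (suc z ℕ.^ m)))))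

charPoly-size : (Q : Mat n) (R : Mat m) → (∀ z → charPoly Q z ≡ charPoly R z) → n ≡ m
charPoly-size {n} {m} Q R h =
  ℕP.≤-antisym (ℕP.≮⇒≥ (size-≮ R Q (λ z → sym (h z)))) (ℕP.≮⇒≥ (size-≮ Q R h))

-- Resolvents and the traces of powers

_·_ : Mat n → Mat n → Mat n
(X · Y) i j = ∑ (λ k → X i k * Y k j)

tr : Mat n → ℤ
tr X = ∑ (λ i → X i i)

pairing : Mat n → Mat n → ℤ
pairing B X = ∑ (λ i → ∑ (λ j → B i j * X j i))

resolvent : Mat n → ℤ → Mat n
resolvent Q z = adjugate (charMat Q z)

resolvent-step : (Q X : Mat n) (z : ℤ) →
  z * pairing (resolvent Q z) X ≡ charPoly Q z * tr X + pairing (resolvent Q z) (Q · X)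
resolvent-step Q X z =
  trans (sym (∑-scale z _))
    (trans (∑-cong row)
      (trans (∑-add (λ r → P * X r r) (λ r → ∑ (λ i → B r i * (Q · X) i r)))
        (cong (λ t → t + pairing B (Q · X)) (∑-scale P (λ r → X r r)))))
  where
  B = resolvent Q z
  P = charPoly Q z
  entry : ∀ r j → z * B r j ≡ δ r j * P + ∑ (λ i → B r i * Q i j)
  entry r j = trans (sym (∑-δʳ j (λ i → z * B r i)))
    (trans (∑-cong (λ i → alg z (δ i j) (B r i) (Q i j)))
      (trans (∑-add (λ i → B r i * charMat Q z i j) (λ i → B r i * Q i j))
        (cong (λ t → t + ∑ (λ i → B r i * Q i j)) (adjugate-law (charMat Q z) r j))))
    where
    alg : ∀ z d b q → d * (z * b) ≡ b * (z * d - q) + b * q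
    alg = solve-∀
  row : ∀ r → z * ∑ (λ j → B r j * X j r) ≡ P * X r r + ∑ (λ i → B r i * (Q · X) i r)
  row r = trans (sym (∑-scale z _))
    (trans (∑-cong (λ j → trans (alg₁ z (B r j) (X j r)) (trans (cong (_* X j r) (entry r j)) (alg₂ (δ r j) P (X j r) (∑ (λ i → B r i * Q i j))))))
      (trans (∑-add (λ j → δ r j * (P * X j r)) (λ j → ∑ (λ i → B r i * Q i j) * X j r))
        (cong₂ _+_ (∑-δˡ r (λ j → P * X j r)) reorder)))
    where
    alg₁ : ∀ z b x → z * (b * x) ≡ z * b * x
    alg₁ = solve-∀
    alg₂ : ∀ d p x s → (d * p + s) * x ≡ d * (p * x) + s * x
    alg₂ = solve-∀
    reorder : ∑ (λ j → ∑ (λ i → B r i * Q i j) * X j r) ≡ ∑ (λ i → B r i * (Q · X) i r)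
    reorder = trans (∑-cong (λ j → sym (∑-scaleʳ (X j r) (λ i → B r i * Q i j))))
      (trans (∑-comm (λ j i → B r i * Q i j * X j r))
        (∑-cong (λ i → trans (∑-cong (λ j → ℤP.*-assoc (B r i) (Q i j) (X j r))) (∑-scale (B r i) (λ j → Q i j * X j r)))))

pairing-δ : (B : Mat n) → pairing B δ ≡ tr B
pairing-δ B = ∑-cong (λ i → trans (∑-cong (λ j → ℤP.*-comm (B i j) (δ j i))) (∑-δʳ i (B i)))

O-pairing : (Q X : Mat (suc n)) → IsO n (λ z → pairing (resolvent Q (+ suc z)) X)
O-pairing {n} Q X = O-∑ _ λ i → O-∑ _ λ j →
  O-cong (λ z → ℤP.*-comm (X j i) (resolvent Q (+ suc z) i j)) (O-scale (X j i) (O-adj Q i j))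

module SamePoly (Q R : Mat (suc n)) (same : ∀ z → charPoly Q z ≡ charPoly R z) where

  -- The induction invariant for X = Qᵏ and Y = Rᵏ. Unlike the equality of the two traces, it passes
  -- from k to k + 1.
  Linked : Mat (suc n) → Mat (suc n) → Set
  Linked X Y = ∀ z → pairing (resolvent Q (+ suc z)) X ≡ pairing (resolvent R (+ suc z)) Y

  -- Both traces are derivatives of the same polynomial at z. Comparing its value at z + h modulo
  -- `h * h` and cancelling one `h` makes them congruent modulo every positive `h`.
  linked-δ : Linked δ δ
  linked-δ k = trans (pairing-δ (resolvent Q z)) (trans (cong-all⇒≡ _ _ close) (sym (pairing-δ (resolvent R z))))
    where
    z = + suc k
    alg : ∀ z h d q → z * d - q + h * d ≡ (z + h) * d - q
    alg = solve-∀
    shift : (S : Mat (suc n)) (h : ℤ) → Cong (h * h) (charPoly S (z + h)) (charPoly S z + h * tr (resolvent S z))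
    shift S h = proj₁ d , trans (det-cong (λ i j → sym (alg z h (δ i j) (S i j)))) (proj₂ d)
      where d = det-derivative (charMat S z) h
    isolate : ∀ p h t r → h * t ≡ p + h * t + h * h * r - p - h * h * r
    isolate = solve-∀
    finish : ∀ p h t r s → p + h * t + h * h * s - p - h * h * r ≡ h * (t + h * (s - r))
    finish = solve-∀
    combine : ∀ k p p′ tQ tR →
      Cong (+ suc k * + suc k) p′ (p + + suc k * tQ) → Cong (+ suc k * + suc k) p′ (p + + suc k * tR) → Cong (+ suc k) tQ tR
    combine k p p′ tQ tR (r , e) (s , f) = s - r , ℤP.*-cancelˡ-≡ (+ suc k) tQ (tR + + suc k * (s - r))
      (trans (isolate p (+ suc k) tQ r)
        (trans (cong (λ t → t - p - + suc k * + suc k * r) (trans (sym e) f)) (finish p (+ suc k) tR r s)))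
    close : ∀ k → Cong (+ suc k) (tr (resolvent Q z)) (tr (resolvent R z))
    close k = combine k (charPoly Q z) (charPoly Q (z + + suc k)) (tr (resolvent Q z)) (tr (resolvent R z)) (shift Q (+ suc k))
      (subst₂ (λ p p′ → Cong (+ suc k * + suc k) p′ (p + + suc k * tr (resolvent R z))) (sym (same z)) (sym (same (z + + suc k))) (shift R (+ suc k)))

  -- Subtracting the two instances of `resolvent-step` leaves (tr X - tr Y) times the characteristic
  -- polynomial, of degree n + 1, equal to a difference of pairings, which are only O(zⁿ).
  trace-equal : (X Y : Mat (suc n)) → Linked X Y → tr X ≡ tr Y
  trace-equal X Y link = ℤP.i-j≡0⇒i≡j (tr X) (tr Y) (O-leading (suc n) (tr X - tr Y)
      (O-cong eq (O-add (O-mul O-var (O-add (O-pairing R (R · Y)) (O-neg (O-pairing Q (Q · X)))))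
                        (O-neg (O-scale (tr X - tr Y) (charPoly-monic Q))))))
    where
    Δ = tr X - tr Y
    alg : ∀ p x y u v zl → zl ≡ p * x + u → zl ≡ p * y + v → v + - u ≡ (x - y) * p
    alg p x y u v zl e f = trans (alg₁ (p * x) u v) (trans (cong (λ t → v + p * x - t) (trans (sym e) f)) (alg₂ p x y v))
      where
      alg₁ : ∀ a u v → v + - u ≡ v + a - (a + u)
      alg₁ = solve-∀
      alg₂ : ∀ p x y v → v + p * x - (p * y + v) ≡ (x - y) * p
      alg₂ = solve-∀
    difference : ∀ k → pairing (resolvent R (+ suc k)) (R · Y) + - pairing (resolvent Q (+ suc k)) (Q · X) ≡ Δ * charPoly Q (+ suc k)
    difference k = alg (charPoly Q z) (tr X) (tr Y) (pairing (resolvent Q z) (Q · X)) (pairing (resolvent R z) (R · Y)) (z * pairing (resolvent Q z) X)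
      (resolvent-step Q X z)
      (trans (cong (z *_) (link k)) (trans (resolvent-step R Y z) (cong (λ p → p * tr Y + pairing (resolvent R z) (R · Y)) (sym (same z)))))
      where z = + suc k
    eq : ∀ k → + suc k * (pairing (resolvent R (+ suc k)) (R · Y) + - pairing (resolvent Q (+ suc k)) (Q · X))
               + - (Δ * (+ suc k * (charPoly Q (+ suc k) - + (suc k ℕ.^ suc n)))) ≡ Δ * + (suc k ℕ.^ suc (suc n))
    eq k = trans (cong (λ t → z * t + - (Δ * (z * (charPoly Q z - w)))) (difference k))
      (trans (cong (λ t → t + - (Δ * (z * (charPoly Q z - w)))) (swap z Δ (charPoly Q z)))
        (trans (sym (leading-split Δ z (charPoly Q z) w)) (cong (Δ *_) (sym (ℤP.pos-* (suc k) (suc k ℕ.^ suc n))))))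
      where
      z = + suc k
      w = + (suc k ℕ.^ suc n)
      swap : ∀ z d p → z * (d * p) ≡ d * (z * p)
      swap = solve-∀

  linked-step : (X Y : Mat (suc n)) → Linked X Y → Linked (Q · X) (R · Y)
  linked-step X Y link k = +-cancelˡ (charPoly Q z * tr X) (pairing (resolvent Q z) (Q · X)) (pairing (resolvent R z) (R · Y))
    (trans (sym (resolvent-step Q X z))
      (trans (cong (z *_) (link k))
        (trans (resolvent-step R Y z)
          (cong (λ t → t + pairing (resolvent R z) (R · Y)) (sym (cong₂ _*_ (same z) (trace-equal X Y link)))))))
    where z = + suc k

-- Traces of powers

∑∑ : ∀ {n} → Mat n → ℤ
∑∑ f = ∑ (λ i → ∑ (λ k → f i k))

∑∑-cong : ∀ {n} {f g : Mat n} → (∀ i k → f i k ≡ g i k) → ∑∑ f ≡ ∑∑ g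
∑∑-cong h = ∑-cong (λ i → ∑-cong (h i))

∑∑-add : ∀ {n} (f g : Mat n) → ∑∑ (λ i k → f i k + g i k) ≡ ∑∑ f + ∑∑ g
∑∑-add f g = trans (∑-cong (λ i → ∑-add (f i) (g i))) (∑-add (λ i → ∑ (f i)) (λ i → ∑ (g i)))

∑∑-neg : ∀ {n} (f : Mat n) → ∑∑ (λ i k → - f i k) ≡ - ∑∑ f
∑∑-neg f = trans (∑-cong (λ i → ∑-neg (f i))) (∑-neg (λ i → ∑ (f i)))

∑∑-δ : ∀ {n} (g : Mat n) → ∑∑ (λ i k → δ i k * g i k) ≡ ∑ (λ i → g i i)
∑∑-δ g = ∑-cong (λ i → ∑-δˡ i (g i))

∑∑-symmetrise : ∀ {n} (f : Mat n) → ∑∑ (λ i k → f i k + f k i) ≡ + 2 * ∑∑ f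
∑∑-symmetrise f = trans (∑∑-add f (λ i k → f k i))
  (trans (cong (λ t → ∑∑ f + t) (sym (∑-comm f))) (alg (∑∑ f)))
  where
  alg : ∀ x → x + x ≡ + 2 * x
  alg = solve-∀

δ-sym : ∀ {n} (i j : Fin n) → δ i j ≡ δ j i
δ-sym i j with i ≟ j | j ≟ i
... | yes _ | yes _ = refl
... | no _  | no _  = refl
... | yes p | no q  = ⊥-elim (q (sym p))
... | no p  | yes q = ⊥-elim (p (sym q))

δ-idem : ∀ {n} (i j : Fin n) → δ i j * δ i j ≡ δ i j
δ-idem i j with does (i ≟ j)
... | true  = refl
... | false = refl

-- Here Q = W - A, S = Q² and U = Q³ in terms of A² = c and A³.
module Traces {n : ℕ} (a : Mat n) (w : Fin n → ℤ)
  (a-sym : ∀ i j → a i j ≡ a j i) (a-diag : ∀ i → a i i ≡ + 0) (a-idem : ∀ i j → a i j * a i j ≡ a i j) where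

  Q : Mat n
  Q i j = δ i j * w i - a i j

  -- With `w` = deg - 2: `aw i` is the total weight of the neighbours of `i`, `t i` the number of
  -- closed 3-walks at `i`, `r i` that of closed 4-walks, and `acw i` counts closed 3-walks weighted
  -- at one neighbour of `i`.
  d aw t acw r : Fin n → ℤ
  c A³ cw : Mat n
  d i = ∑ (λ k → a i k)
  aw i = ∑ (λ k → a i k * w k)
  c i j = ∑ (λ k → a i k * a k j)
  t i = ∑ (λ k → a i k * c i k)
  acw i = ∑ (λ k → a i k * w k * c i k)
  r i = ∑ (λ k → c i k * c i k)
  A³ i j = ∑ (λ k → a i k * c k j)
  cw i j = ∑ (λ k → a i k * (w k * a k j))

  trA³ trA⁵ : ℤ
  trA³ = ∑ t
  trA⁵ = ∑∑ (λ i k → A³ i k * c i k)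

  c-sym : ∀ i j → c i j ≡ c j i
  c-sym i j = ∑-cong (λ k → trans (cong₂ _*_ (a-sym i k) (a-sym k j)) (ℤP.*-comm (a k i) (a j k)))

  c-diag : ∀ i → c i i ≡ d i
  c-diag i = ∑-cong (λ k → trans (cong (a i k *_) (a-sym k i)) (a-idem i k))

  δa≡0 : ∀ i j → δ i j * a i j ≡ + 0
  δa≡0 i j = go (i ≟ j)
    where
    go : Dec (i ≡ j) → δ i j * a i j ≡ + 0
    go (yes refl) = trans (cong (δ i i *_) (a-diag i)) (ℤP.*-zeroʳ (δ i i))
    go (no i≢j) = cong (_* a i j) (δ-≢ i≢j)

  S U : Mat n
  S i j = δ i j * (w i * w i) - (w i + w j) * a i j + c i j
  U i j = δ i j * (w i * w i * w i) - a i j * (w i * w i + w i * w j + w j * w j) + (w i + w j) * c i j + cw i j - A³ i j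

  Q· : (X : Mat n) → ∀ i j → (Q · X) i j ≡ w i * X i j - ∑ (λ k → a i k * X k j)
  Q· X i j = trans (∑-cong (λ k → alg (δ i k) (w i) (a i k) (X k j)))
    (trans (∑-sub (λ k → δ i k * (w i * X k j)) (λ k → a i k * X k j))
      (cong (_- ∑ (λ k → a i k * X k j)) (∑-δˡ i (λ k → w i * X k j))))
    where
    alg : ∀ e w a x → (e * w - a) * x ≡ e * (w * x) - a * x
    alg = solve-∀

  ∑-δ-row : (f g : Fin n → ℤ) (j : Fin n) → ∑ (λ k → f k * (δ k j * g k)) ≡ f j * g j
  ∑-δ-row f g j = trans (∑-cong (λ k → alg (f k) (δ k j) (g k))) (∑-δʳ j (λ k → f k * g k))
    where
    alg : ∀ x e y → x * (e * y) ≡ e * (x * y)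
    alg = solve-∀

  Q²≡ : ∀ i j → (Q · Q) i j ≡ S i j
  Q²≡ i j = trans (Q· Q i j)
    (trans (cong (λ z → w i * Q i j - z)
             (trans (∑-cong (λ k → alg₁ (a i k) (δ k j * w k) (a k j)))
               (trans (∑-sub (λ k → a i k * (δ k j * w k)) (λ k → a i k * a k j))
                 (cong (_- c i j) (∑-δ-row (a i) w j)))))
      (alg₂ (δ i j) (w i) (w j) (a i j) (c i j)))
    where
    alg₁ : ∀ x y z → x * (y - z) ≡ x * y - x * z
    alg₁ = solve-∀
    alg₂ : ∀ e u v a c → u * (e * u - a) - (a * v - c) ≡ e * (u * u) - (u + v) * a + c
    alg₂ = solve-∀

  QS≡ : ∀ i j → (Q · S) i j ≡ U i j
  QS≡ i j = trans (Q· S i j)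
    (trans (cong (λ z → w i * S i j - z) inner)
      (alg₂ (δ i j) (w i) (w j) (a i j) (c i j) (cw i j) (A³ i j)))
    where
    alg₁ : ∀ x e u v y z → x * (e * (u * u) - (u + v) * y + z) ≡ x * (e * (u * u)) + - (x * (u * y)) + - (v * (x * y)) + x * z
    alg₁ = solve-∀
    inner : ∑ (λ k → a i k * S k j) ≡ a i j * (w j * w j) + - cw i j + - (w j * c i j) + A³ i j
    inner = trans (∑-cong (λ k → alg₁ (a i k) (δ k j) (w k) (w j) (a k j) (c k j)))
      (trans (∑-add (λ k → a i k * (δ k j * (w k * w k)) + - (a i k * (w k * a k j)) + - (w j * (a i k * a k j))) (λ k → a i k * c k j))
        (cong (_+ A³ i j)
          (trans (∑-add (λ k → a i k * (δ k j * (w k * w k)) + - (a i k * (w k * a k j))) (λ k → - (w j * (a i k * a k j))))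
            (cong₂ _+_
              (trans (∑-add (λ k → a i k * (δ k j * (w k * w k))) (λ k → - (a i k * (w k * a k j))))
                (cong₂ _+_ (∑-δ-row (a i) (λ k → w k * w k) j) (∑-neg (λ k → a i k * (w k * a k j)))))
              (trans (∑-neg (λ k → w j * (a i k * a k j))) (cong -_ (∑-scale (w j) (λ k → a i k * a k j))))))))
    alg₂ : ∀ e u v a c q x → u * (e * (u * u) - (u + v) * a + c) - (a * (v * v) + - q + - (v * c) + x)
           ≡ e * (u * u * u) - a * (u * u + u * v + v * v) + (u + v) * c + q - x
    alg₂ = solve-∀

  A³-sym : ∀ i j → A³ i j ≡ A³ j i
  A³-sym i j =
    trans (∑-cong (λ k → sym (∑-scale (a i k) (λ m → a k m * a m j))))
      (trans (∑-comm (λ k m → a i k * (a k m * a m j)))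
        (∑-cong (λ m → trans (∑-cong (λ k → trans (alg (a i k) (a k m) (a m j)) (cong₂ (λ x y → x * y) (a-sym m j) (cong₂ _*_ (a-sym k m) (a-sym i k)))))
                             (∑-scale (a j m) (λ k → a m k * a k i)))))
    where
    alg : ∀ x y z → x * (y * z) ≡ z * (y * x)
    alg = solve-∀

  ∑aA³ : ∀ i → ∑ (λ k → a i k * A³ i k) ≡ r i
  ∑aA³ i =
    trans (∑-cong (λ k → cong (a i k *_) (A³-sym i k)))
      (trans (∑-cong (λ k → sym (∑-scale (a i k) (λ m → a k m * c m i))))
        (trans (∑-comm (λ k m → a i k * (a k m * c m i)))
          (∑-cong (λ m → trans (∑-cong (λ k → sym (ℤP.*-assoc (a i k) (a k m) (c m i))))
            (trans (∑-scaleʳ (c m i) (λ k → a i k * a k m)) (cong (c i m *_) (c-sym m i)))))))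

  ∑a·cw : ∀ i → ∑ (λ k → a i k * cw i k) ≡ acw i
  ∑a·cw i =
    trans (∑-cong (λ k → sym (∑-scale (a i k) (λ m → a i m * (w m * a m k)))))
      (trans (∑-comm (λ k m → a i k * (a i m * (w m * a m k))))
        (∑-cong (λ m → trans (∑-cong (λ k → trans (alg (a i k) (a i m) (w m) (a m k)) (cong (λ z → a i m * w m * (a i k * z)) (a-sym m k))))
          (∑-scale (a i m * w m) (λ k → a i k * a k m)))))
    where
    alg : ∀ x y w z → x * (y * (w * z)) ≡ y * w * (x * z)
    alg = solve-∀

  -- Cyclicity of the trace: tr (A W A A²) = tr (W A⁴). The weight in the middle of the walk becomes
  -- the weight of its base point.
  ∑∑cw·c : ∑∑ (λ i k → cw i k * c i k) ≡ ∑ (λ i → w i * r i)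
  ∑∑cw·c =
    trans (∑∑-cong (λ i k → sym (∑-scaleʳ (c i k) (λ j → a i j * (w j * a j k)))))
      (trans (∑-cong (λ i → ∑-comm (λ k j → a i j * (w j * a j k) * c i k)))
        (trans (∑-comm (λ i j → ∑ (λ k → a i j * (w j * a j k) * c i k)))
          (∑-cong λ j →
            trans (∑-cong λ i →
              trans (∑-cong λ k → trans (alg (a i j) (w j) (a j k) (c i k)) (cong₂ (λ x y → w j * x * (a j k * y)) (a-sym i j) (c-sym i k)))
                (trans (∑-scale (w j * a j i) (λ k → a j k * c k i)) (ℤP.*-assoc (w j) (a j i) (A³ j i))))
              (trans (∑-scale (w j) (λ i → a j i * A³ j i)) (cong (w j *_) (∑aA³ j))))))
    where
    alg : ∀ x w y z → x * (w * y) * z ≡ w * x * (y * z)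
    alg = solve-∀

  tr-Q : tr Q ≡ ∑ w
  tr-Q = ∑-cong (λ i → trans (cong₂ (λ x y → x * w i - y) (δ-refl i) (a-diag i)) (alg (w i)))
    where
    alg : ∀ x → + 1 * x - + 0 ≡ x
    alg = solve-∀

  tr-Q² : tr S ≡ ∑ (λ i → w i * w i + d i)
  tr-Q² = ∑-cong (λ i → trans (cong₂ (λ x y → x * (w i * w i) - (w i + w i) * y + c i i) (δ-refl i) (a-diag i)) (trans (alg (w i) (c i i)) (cong (λ z → w i * w i + z) (c-diag i))))
    where
    alg : ∀ x c → + 1 * (x * x) - (x + x) * + 0 + c ≡ x * x + c
    alg = solve-∀

  S-sym : ∀ i j → S i j ≡ S j i
  S-sym i j = trans (cong₂ (λ x y → x - (w i + w j) * y + c i j) δ-part (a-sym i j))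
    (trans (cong (λ z → δ j i * (w j * w j) - (w i + w j) * a j i + z) (c-sym i j)) (alg (δ j i * (w j * w j)) (w i) (w j) (a j i) (c j i)))
    where
    alg : ∀ e u v a c → e - (u + v) * a + c ≡ e - (v + u) * a + c
    alg = solve-∀
    δ-part : δ i j * (w i * w i) ≡ δ j i * (w j * w j)
    δ-part = go (i ≟ j)
      where
      go : Dec (i ≡ j) → δ i j * (w i * w i) ≡ δ j i * (w j * w j)
      go (yes refl) = refl
      go (no i≢j) = trans (cong (_* (w i * w i)) (δ-≢ i≢j)) (sym (cong (_* (w j * w j)) (δ-≢ (≢-sym i≢j))))

  tr-Q³ : tr (Q · S) ≡ ∑ (λ i → w i * (w i * w i + + 3 * d i)) - trA³
  tr-Q³ = trans (∑∑-cong (λ i k → trans (cong (Q i k *_) (S-sym k i)) (pointwise i k)))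
    (trans (∑∑-add (λ i k → δ i k * (w i * (w i * w i + c i k))) (λ i k → a i k * w i + a k i * w k + - (a i k * c i k)))
      (trans (cong₂ _+_ (∑∑-δ (λ i k → w i * (w i * w i + c i k)))
               (trans (∑∑-add (λ i k → a i k * w i + a k i * w k) (λ i k → - (a i k * c i k)))
                 (cong₂ _+_ (trans (∑∑-symmetrise (λ i k → a i k * w i)) (sym (∑-scale (+ 2) (λ i → ∑ (λ k → a i k * w i)))))
                            (∑∑-neg (λ i k → a i k * c i k)))))
        (trans (sym (ℤP.+-assoc (∑ (λ i → w i * (w i * w i + c i i))) (∑ (λ i → + 2 * ∑ (λ k → a i k * w i))) (- trA³)))
          (cong (λ z → z + - trA³)
            (trans (sym (∑-add (λ i → w i * (w i * w i + c i i)) (λ i → + 2 * ∑ (λ k → a i k * w i))))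
              (∑-cong (λ i → trans (cong₂ (λ x y → w i * (w i * w i + x) + + 2 * y) (c-diag i) (∑-scaleʳ (w i) (a i))) (alg₂ (w i) (d i)))))))))
    where
    alg₂ : ∀ w d → w * (w * w + d) + + 2 * (d * w) ≡ w * (w * w + + 3 * d)
    alg₂ = solve-∀
    alg : ∀ e u v a c → (e * u - a) * (e * (u * u) - (u + v) * a + c) ≡
      (e * e) * (u * (u * u)) + e * (u * c) + - ((e * a) * (u * (u + v) + u * u)) + (a * a) * (u + v) + - (a * c)
    alg = solve-∀
    alg₁ : ∀ e u v a c → e * (u * (u * u)) + e * (u * c) + - (+ 0 * (u * (u + v) + u * u)) + a * (u + v) + - (a * c) ≡
      e * (u * (u * u + c)) + (a * u + a * v + - (a * c))
    alg₁ = solve-∀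
    pointwise : ∀ i k → Q i k * S i k ≡ δ i k * (w i * (w i * w i + c i k)) + (a i k * w i + a k i * w k + - (a i k * c i k))
    pointwise i k = trans (alg (δ i k) (w i) (w k) (a i k) (c i k))
      (trans (cong₂ (λ x y → x * (w i * (w i * w i)) + δ i k * (w i * c i k) + - (y * (w i * (w i + w k) + w i * w i)) + (a i k * a i k) * (w i + w k) + - (a i k * c i k)) (δ-idem i k) (δa≡0 i k))
        (trans (cong (λ x → δ i k * (w i * (w i * w i)) + δ i k * (w i * c i k) + - (+ 0 * (w i * (w i + w k) + w i * w i)) + x * (w i + w k) + - (a i k * c i k)) (a-idem i k))
          (trans (alg₁ (δ i k) (w i) (w k) (a i k) (c i k))
            (cong (λ x → δ i k * (w i * (w i * w i + c i k)) + (a i k * w i + x * w k + - (a i k * c i k))) (a-sym i k)))))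

  private
    -- On the diagonal δ is 1 and `a` is 0, off it δ is 0. Treating the two cases apart keeps the
    -- ring identities of `tr-Q⁴` and `tr-Q⁵` within reach of the solver.
    split : (F g f : Mat n) →
      (∀ i → F i i ≡ g i i + f i i) → (∀ i k → i ≢ k → F i k ≡ f i k) → ∀ i k → F i k ≡ δ i k * g i k + f i k
    split F g f same diff i k = go (i ≟ k)
      where
      go : Dec (i ≡ k) → F i k ≡ δ i k * g i k + f i k
      go (yes refl) = trans (same i) (cong (_+ f i i) (sym (trans (cong (_* g i i) (δ-refl i)) (ℤP.*-identityˡ (g i i)))))
      go (no i≢k) = trans (diff i k i≢k) (sym (trans (cong (λ z → z * g i k + f i k) (δ-≢ i≢k)) (ℤP.+-identityˡ (f i k))))

  -- Since Q² is symmetric, the trace is the sum of the squares of its entries. Idempotence of `a`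
  -- reduces each off-diagonal square to a symmetrised `f` plus `h`, and the row sums of `f` are the
  -- local quantities on the right.
  tr-Q⁴ : tr (S · S) ≡ ∑ (λ i → w i * (w i * w i * w i + + 4 * (w i * d i) + + 2 * aw i - + 4 * t i) + r i)
  tr-Q⁴ = trans (∑∑-cong (λ i k → trans (cong (S i k *_) (S-sym k i)) (split (λ i k → S i k * S i k) g (λ i k → f i k + f k i + h i k) on off i k)))
    (trans (∑∑-add (λ i k → δ i k * g i k) (λ i k → f i k + f k i + h i k))
      (trans (cong₂ _+_ (∑∑-δ g) (trans (∑∑-add (λ i k → f i k + f k i) h) (cong (_+ ∑∑ h) (trans (∑∑-symmetrise f) (sym (∑-scale (+ 2) (λ i → ∑ (f i))))))))
        (trans (cong (λ z → ∑ (λ i → g i i) + z) (sym (∑-add (λ i → + 2 * ∑ (f i)) (λ i → ∑ (h i)))))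
          (trans (sym (∑-add (λ i → g i i) (λ i → + 2 * ∑ (f i) + ∑ (h i))))
            (∑-cong (λ i → trans (cong₂ (λ x y → x + (+ 2 * y + r i)) (cong (λ z → w i * w i * w i * w i + + 2 * (w i * w i * z)) (c-diag i)) (row i))
                                 (alg (w i) (d i) (aw i) (t i) (r i))))))))
    where
    g f h : Mat n
    g i k = w i * w i * w i * w i + + 2 * (w i * w i * c i k)
    f i k = w i * w i * a i k + (w i * (a i k * w k) + - (+ 2 * w i) * (a i k * c i k))
    h i k = c i k * c i k
    row : ∀ i → ∑ (f i) ≡ w i * w i * d i + (w i * aw i + - (+ 2 * w i) * t i)
    row i = trans (∑-add (λ k → w i * w i * a i k) (λ k → w i * (a i k * w k) + - (+ 2 * w i) * (a i k * c i k)))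
      (cong₂ _+_ (∑-scale (w i * w i) (a i)) (∑-lin (w i) (- (+ 2 * w i)) (λ k → a i k * w k) (λ k → a i k * c i k)))
    alg : ∀ w d q t r → w * w * w * w + + 2 * (w * w * d) + (+ 2 * (w * w * d + (w * q + - (+ 2 * w) * t)) + r)
      ≡ w * (w * w * w + + 4 * (w * d) + + 2 * q - + 4 * t) + r
    alg = solve-∀
    on : ∀ i → S i i * S i i ≡ g i i + (f i i + f i i + h i i)
    on i = go (δ i i) (a i i) (δ-refl i) (a-diag i)
      where
      alg₁ : ∀ u c → (+ 1 * (u * u) - (u + u) * + 0 + c) * (+ 1 * (u * u) - (u + u) * + 0 + c) ≡
        u * u * u * u + + 2 * (u * u * c) + ((u * u * + 0 + (u * (+ 0 * u) + - (+ 2 * u) * (+ 0 * c))) + (u * u * + 0 + (u * (+ 0 * u) + - (+ 2 * u) * (+ 0 * c))) + c * c)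
      alg₁ = solve-∀
      go : ∀ e x → e ≡ + 1 → x ≡ + 0 →
        (e * (w i * w i) - (w i + w i) * x + c i i) * (e * (w i * w i) - (w i + w i) * x + c i i) ≡
        g i i + ((w i * w i * x + (w i * (x * w i) + - (+ 2 * w i) * (x * c i i))) + (w i * w i * x + (w i * (x * w i) + - (+ 2 * w i) * (x * c i i))) + h i i)
      go _ _ refl refl = alg₁ (w i) (c i i)
    off : ∀ i k → i ≢ k → S i k * S i k ≡ f i k + f k i + h i k
    off i k i≢k = go (δ i k) (a k i) (c k i) (δ-≢ i≢k) (a-sym k i) (c-sym k i) (a-idem i k)
      where
      alg₁ : ∀ u v x c → (+ 0 * (u * u) - (u + v) * x + c) * (+ 0 * (u * u) - (u + v) * x + c) ≡
        (u * u + u * v + (v * v + v * u)) * (x * x) + (- (+ 2 * u) * (x * c) + - (+ 2 * v) * (x * c)) + c * c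
      alg₁ = solve-∀
      alg₂ : ∀ u v x c → (u * u + u * v + (v * v + v * u)) * x + (- (+ 2 * u) * (x * c) + - (+ 2 * v) * (x * c)) + c * c ≡
        (u * u * x + (u * (x * v) + - (+ 2 * u) * (x * c))) + (v * v * x + (v * (x * u) + - (+ 2 * v) * (x * c))) + c * c
      alg₂ = solve-∀
      go : ∀ e x y → e ≡ + 0 → x ≡ a i k → y ≡ c i k → a i k * a i k ≡ a i k →
        (e * (w i * w i) - (w i + w k) * a i k + c i k) * (e * (w i * w i) - (w i + w k) * a i k + c i k) ≡
        f i k + (w k * w k * x + (w k * (x * w i) + - (+ 2 * w k) * (x * y))) + h i k
      go _ _ _ refl refl refl q = trans (alg₁ (w i) (w k) (a i k) (c i k))
        (trans (cong (λ z → (w i * w i + w i * w k + (w k * w k + w k * w i)) * z + (- (+ 2 * w i) * (a i k * c i k) + - (+ 2 * w k) * (a i k * c i k)) + c i k * c i k) q)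
          (alg₂ (w i) (w k) (a i k) (c i k)))

  cw-diag : ∀ i → cw i i ≡ aw i
  cw-diag i = ∑-cong (λ k → trans (cong (λ z → a i k * (w k * z)) (a-sym k i)) (trans (alg (a i k) (w k)) (cong (_* w k) (a-idem i k))))
    where
    alg : ∀ x w → x * (w * x) ≡ x * x * w
    alg = solve-∀

  A³-diag : ∀ i → A³ i i ≡ t i
  A³-diag i = ∑-cong (λ k → cong (a i k *_) (c-sym k i))

  cw-sym : ∀ i k → cw i k ≡ cw k i
  cw-sym i k = ∑-cong (λ j → trans (cong₂ (λ x y → x * (w j * y)) (a-sym i j) (a-sym j k)) (alg (a j i) (w j) (a k j)))
    where
    alg : ∀ x w y → x * (w * y) ≡ y * (w * x)
    alg = solve-∀

  -- Factoring Q⁵ as Q³ Q² needs only walks of length at most three in each factor. Every term but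
  -- `trA⁵` ends up with a weight `w i` in front, hence is local to the few vertices whose degree is
  -- not two.
  tr-Q⁵ : tr (U · S) ≡ ∑ (λ i → w i * (w i * w i * w i * w i + + 5 * (w i * w i * d i) + + 5 * (w i * aw i) - + 5 * (w i * t i) - + 5 * acw i + + 5 * r i)) - trA⁵
  tr-Q⁵ = trans (∑∑-cong (λ i k → trans (cong (U i k *_) (S-sym k i)) (split (λ i k → U i k * S i k) g (λ i k → f i k + f k i + h i k) on off i k)))
    (trans (∑∑-add (λ i k → δ i k * g i k) (λ i k → f i k + f k i + h i k))
      (trans (cong₂ _+_ (∑∑-δ g) (trans (∑∑-add (λ i k → f i k + f k i) h)
               (cong₂ _+_ (trans (∑∑-symmetrise f) (sym (∑-scale (+ 2) (λ i → ∑ (f i))))) h-sum)))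
        (trans (cong (λ z → ∑ (λ i → g i i) + z) (sym (ℤP.+-assoc (∑ (λ i → + 2 * ∑ (f i))) (∑ (λ i → - (+ 3 * w i) * acw i + w i * r i)) (- trA⁵))))
          (trans (sym (ℤP.+-assoc (∑ (λ i → g i i)) (∑ (λ i → + 2 * ∑ (f i)) + ∑ (λ i → - (+ 3 * w i) * acw i + w i * r i)) (- trA⁵)))
            (cong (_+ - trA⁵)
              (trans (cong (λ z → ∑ (λ i → g i i) + z) (sym (∑-add (λ i → + 2 * ∑ (f i)) (λ i → - (+ 3 * w i) * acw i + w i * r i))))
                (trans (sym (∑-add (λ i → g i i) (λ i → + 2 * ∑ (f i) + (- (+ 3 * w i) * acw i + w i * r i))))
                  (∑-cong (λ i → trans (cong₂ (λ x y → x + (+ 2 * y + (- (+ 3 * w i) * acw i + w i * r i))) (diag i) (row i))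
                                       (alg (w i) (d i) (aw i) (t i) (acw i) (r i)))))))))))
    where
    g f h : Mat n
    g i k = w i * w i * w i * (w i * w i) + w i * w i * w i * c i k + w i * w i * ((w i + w i) * c i k + cw i k - A³ i k)
    f i k = w i * w i * w i * a i k + (+ 2 * (w i * w i) * (a i k * w k) + (- (+ 2 * (w i * w i)) * (a i k * c i k) + (- w i * (a i k * cw i k) + (w i * (a i k * A³ i k) + w i * (c i k * c i k)))))
    h i k = - (+ 3 * w i) * (a i k * w k * c i k) + (cw i k * c i k + - (A³ i k * c i k))
    diag : ∀ i → g i i ≡ w i * w i * w i * (w i * w i) + w i * w i * w i * d i + w i * w i * ((w i + w i) * d i + aw i - t i)
    diag i = trans (cong (λ z → w i * w i * w i * (w i * w i) + w i * w i * w i * z + w i * w i * ((w i + w i) * z + cw i i - A³ i i)) (c-diag i))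
      (cong₂ (λ y z → w i * w i * w i * (w i * w i) + w i * w i * w i * d i + w i * w i * ((w i + w i) * d i + y - z)) (cw-diag i) (A³-diag i))
    row : ∀ i → ∑ (f i) ≡ w i * w i * w i * d i + (+ 2 * (w i * w i) * aw i + (- (+ 2 * (w i * w i)) * t i + (- w i * acw i + (w i * r i + w i * r i))))
    row i = trans (∑-add _ _) (cong₂ _+_ (∑-scale (w i * w i * w i) (a i))
      (trans (∑-add _ _) (cong₂ _+_ (∑-scale (+ 2 * (w i * w i)) (λ k → a i k * w k))
        (trans (∑-add _ _) (cong₂ _+_ (∑-scale (- (+ 2 * (w i * w i))) (λ k → a i k * c i k))
          (trans (∑-add _ _) (cong₂ _+_ (trans (∑-scale (- w i) (λ k → a i k * cw i k)) (cong (- w i *_) (∑a·cw i)))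
            (trans (∑-add _ _) (cong₂ _+_ (trans (∑-scale (w i) (λ k → a i k * A³ i k)) (cong (w i *_) (∑aA³ i))) (∑-scale (w i) (λ k → c i k * c i k)))))))))))
    h-sum : ∑∑ h ≡ ∑ (λ i → - (+ 3 * w i) * acw i + w i * r i) + - trA⁵
    h-sum = trans (∑∑-add (λ i k → - (+ 3 * w i) * (a i k * w k * c i k)) (λ i k → cw i k * c i k + - (A³ i k * c i k)))
      (trans (cong₂ _+_ (∑-cong (λ i → ∑-scale (- (+ 3 * w i)) (λ k → a i k * w k * c i k)))
               (trans (∑∑-add (λ i k → cw i k * c i k) (λ i k → - (A³ i k * c i k))) (cong₂ _+_ ∑∑cw·c (∑∑-neg (λ i k → A³ i k * c i k)))))
        (trans (sym (ℤP.+-assoc (∑ (λ i → - (+ 3 * w i) * acw i)) (∑ (λ i → w i * r i)) (- trA⁵)))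
          (cong (_+ - trA⁵) (sym (∑-add (λ i → - (+ 3 * w i) * acw i) (λ i → w i * r i))))))
    alg : ∀ w d q t p r →
      w * w * w * (w * w) + w * w * w * d + w * w * ((w + w) * d + q - t)
      + (+ 2 * (w * w * w * d + (+ 2 * (w * w) * q + (- (+ 2 * (w * w)) * t + (- w * p + (w * r + w * r))))) + (- (+ 3 * w) * p + w * r))
      ≡ w * (w * w * w * w + + 5 * (w * w * d) + + 5 * (w * q) - + 5 * (w * t) - + 5 * p + + 5 * r)
    alg = solve-∀
    on : ∀ i → U i i * S i i ≡ g i i + (f i i + f i i + h i i)
    on i = go (δ i i) (a i i) (δ-refl i) (a-diag i)
      where
      alg₁ : ∀ u c q x →
        (+ 1 * (u * u * u) - + 0 * (u * u + u * u + u * u) + (u + u) * c + q - x) * (+ 1 * (u * u) - (u + u) * + 0 + c) ≡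
        (u * u * u * (u * u) + u * u * u * c + u * u * ((u + u) * c + q - x))
        + ((u * u * u * + 0 + (+ 2 * (u * u) * (+ 0 * u) + (- (+ 2 * (u * u)) * (+ 0 * c) + (- u * (+ 0 * q) + (u * (+ 0 * x) + u * (c * c))))))
          + (u * u * u * + 0 + (+ 2 * (u * u) * (+ 0 * u) + (- (+ 2 * (u * u)) * (+ 0 * c) + (- u * (+ 0 * q) + (u * (+ 0 * x) + u * (c * c))))))
          + (- (+ 3 * u) * (+ 0 * u * c) + (q * c + - (x * c))))
      alg₁ = solve-∀
      go : ∀ e y → e ≡ + 1 → y ≡ + 0 →
        (e * (w i * w i * w i) - y * (w i * w i + w i * w i + w i * w i) + (w i + w i) * c i i + cw i i - A³ i i) * (e * (w i * w i) - (w i + w i) * y + c i i) ≡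
        g i i
        + ((w i * w i * w i * y + (+ 2 * (w i * w i) * (y * w i) + (- (+ 2 * (w i * w i)) * (y * c i i) + (- w i * (y * cw i i) + (w i * (y * A³ i i) + w i * (c i i * c i i))))))
          + (w i * w i * w i * y + (+ 2 * (w i * w i) * (y * w i) + (- (+ 2 * (w i * w i)) * (y * c i i) + (- w i * (y * cw i i) + (w i * (y * A³ i i) + w i * (c i i * c i i))))))
          + (- (+ 3 * w i) * (y * w i * c i i) + (cw i i * c i i + - (A³ i i * c i i))))
      go _ _ refl refl = alg₁ (w i) (c i i) (cw i i) (A³ i i)
    off : ∀ i k → i ≢ k → U i k * S i k ≡ f i k + f k i + h i k
    off i k i≢k = go (δ i k) (a k i) (c k i) (cw k i) (A³ k i) (δ-≢ i≢k) (a-sym k i) (c-sym k i) (cw-sym k i) (A³-sym k i)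
      where
      alg₁ : ∀ u v y c q x →
        (+ 0 * (u * u * u) - y * (u * u + u * v + v * v) + (u + v) * c + q - x) * (+ 0 * (u * u) - (u + v) * y + c) ≡
        (y * y) * ((u + v) * (u * u + u * v + v * v)) + (- (+ 2 * (u * u)) * (y * c) + - (+ 2 * (v * v)) * (y * c) + - (+ 3 * u) * (y * v * c))
          + (- u * (y * q) + - v * (y * q)) + (u * (y * x) + v * (y * x)) + (u * (c * c) + v * (c * c)) + (q * c + - (x * c))
      alg₁ = solve-∀
      alg₂ : ∀ u v y c q x →
        y * ((u + v) * (u * u + u * v + v * v)) + (- (+ 2 * (u * u)) * (y * c) + - (+ 2 * (v * v)) * (y * c) + - (+ 3 * u) * (y * v * c))
          + (- u * (y * q) + - v * (y * q)) + (u * (y * x) + v * (y * x)) + (u * (c * c) + v * (c * c)) + (q * c + - (x * c)) ≡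
        (u * u * u * y + (+ 2 * (u * u) * (y * v) + (- (+ 2 * (u * u)) * (y * c) + (- u * (y * q) + (u * (y * x) + u * (c * c))))))
        + (v * v * v * y + (+ 2 * (v * v) * (y * u) + (- (+ 2 * (v * v)) * (y * c) + (- v * (y * q) + (v * (y * x) + v * (c * c))))))
        + (- (+ 3 * u) * (y * v * c) + (q * c + - (x * c)))
      alg₂ = solve-∀
      go : ∀ e y z q x → e ≡ + 0 → y ≡ a i k → z ≡ c i k → q ≡ cw i k → x ≡ A³ i k →
        (e * (w i * w i * w i) - a i k * (w i * w i + w i * w k + w k * w k) + (w i + w k) * c i k + cw i k - A³ i k) * (e * (w i * w i) - (w i + w k) * a i k + c i k) ≡
        f i k + (w k * w k * w k * y + (+ 2 * (w k * w k) * (y * w i) + (- (+ 2 * (w k * w k)) * (y * z) + (- w k * (y * q) + (w k * (y * x) + w k * (z * z)))))) + h i k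
      go _ _ _ _ _ refl refl refl refl refl = trans (alg₁ (w i) (w k) (a i k) (c i k) (cw i k) (A³ i k))
        (trans (cong (λ z → z * ((w i + w k) * (w i * w i + w i * w k + w k * w k)) + (- (+ 2 * (w i * w i)) * (a i k * c i k) + - (+ 2 * (w k * w k)) * (a i k * c i k) + - (+ 3 * w i) * (a i k * w k * c i k))
          + (- w i * (a i k * cw i k) + - w k * (a i k * cw i k)) + (w i * (a i k * A³ i k) + w k * (a i k * A³ i k)) + (w i * (c i k * c i k) + w k * (c i k * c i k)) + (cw i k * c i k + - (A³ i k * c i k))) (a-idem i k))
          (alg₂ (w i) (w k) (a i k) (c i k) (cw i k) (A³ i k)))

  -- Twice the number of 4-cycles through `i`: `k` is the vertex opposite to `i`, and the product
  -- counts ordered pairs of distinct common neighbours.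
  κ : Fin n → ℤ
  κ i = ∑ (λ k → (+ 1 - δ i k) * (c i k * (c i k - + 1)))

  -- Closed 4-walks i j k l by type: those on a 4-cycle give `κ`, those with k = i give d², and
  -- those with j = l and k ≠ i give the sum of deg - 1 over the neighbours, which is d + aw.
  r≡κ : (∀ i → d i ≡ w i + + 2) → ∀ i → r i ≡ κ i + d i * d i + d i + aw i
  r≡κ d≡ i = trans (sym (alg₀ (r i) (∑ (c i)) (d i))) (trans (cong (λ z → z + (∑ (c i) + (d i * d i - d i))) (sym κ≡))
               (trans (cong (λ z → κ i + (z + (d i * d i - d i))) ∑c) (alg₁ (κ i) (aw i) (d i))))
    where
    alg₀ : ∀ r s d → r - s - (d * d - d) + (s + (d * d - d)) ≡ r
    alg₀ = solve-∀
    alg₁ : ∀ k q d → k + (q + d * + 2 + (d * d - d)) ≡ k + d * d + d + q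
    alg₁ = solve-∀
    alg₂ : ∀ e c → (+ 1 - e) * (c * (c - + 1)) ≡ c * c - c - e * (c * c - c)
    alg₂ = solve-∀
    κ≡ : κ i ≡ r i - ∑ (c i) - (d i * d i - d i)
    κ≡ = trans (∑-cong (λ k → alg₂ (δ i k) (c i k)))
      (trans (∑-sub (λ k → c i k * c i k - c i k) (λ k → δ i k * (c i k * c i k - c i k)))
        (cong₂ _-_ (∑-sub (λ k → c i k * c i k) (c i))
          (trans (∑-δˡ i (λ k → c i k * c i k - c i k)) (cong (λ z → z * z - z) (c-diag i)))))
    ∑c : ∑ (c i) ≡ aw i + d i * + 2
    ∑c = trans (∑-comm (λ j k → a i k * a k j))
      (trans (∑-cong (λ k → trans (∑-scale (a i k) (a k)) (trans (cong (a i k *_) (d≡ k)) (ℤP.*-distribˡ-+ (a i k) (w k) (+ 2)))))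
        (trans (∑-add (λ k → a i k * w k) (λ k → a i k * + 2)) (cong (λ z → aw i + z) (∑-scaleʳ (+ 2) (a i)))))

-- Laplacians

𝟙 : Bool → ℤ
𝟙 b = if b then + 1 else + 0

𝟙-idem : ∀ b → 𝟙 b * 𝟙 b ≡ 𝟙 b
𝟙-idem true  = refl
𝟙-idem false = refl

A : Graph n → Mat n
A G i j = 𝟙 (adj G i j)

excess : Graph n → Fin n → ℤ
excess G i = + deg G i - + 2

A-sym : (G : Graph n) → ∀ i j → A G i j ≡ A G j i
A-sym G i j = cong 𝟙 (adj-sym G i j)

A-diag : (G : Graph n) → ∀ i → A G i i ≡ + 0
A-diag G i = cong 𝟙 (irrefl G i)

A-idem : (G : Graph n) → ∀ i j → A G i j * A G i j ≡ A G i j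
A-idem G i j = 𝟙-idem (adj G i j)

module T {n} (G : Graph n) = Traces (A G) (excess G) (A-sym G) (A-diag G) (A-idem G)

private
  deg-tabulate : ∀ {k} (b : Fin m → Bool) (f : Fin k → Fin m) →
    + foldr ℕ._+_ 0 (map (λ j → if b j then 1 else 0) (tabulate f)) ≡ ∑ (λ j → 𝟙 (b (f j)))
  deg-tabulate {k = zero} b f = sym (∑-empty (λ j → 𝟙 (b (f j))))
  deg-tabulate {k = suc k} b f = trans (ℤP.pos-+ (if b (f zero) then 1 else 0) _)
    (trans (cong₂ _+_ (if-+ (b (f zero))) (deg-tabulate b (f ∘ suc))) (sym (∑-suc (λ j → 𝟙 (b (f j))))))
    where
    if-+ : ∀ b → + (if b then 1 else 0) ≡ 𝟙 b
    if-+ true  = refl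
    if-+ false = refl

deg≡∑ : (G : Graph n) (i : Fin n) → + deg G i ≡ ∑ (A G i)
deg≡∑ G i = deg-tabulate (adj G i) id

d≡ : (G : Graph n) (i : Fin n) → T.d G i ≡ excess G i + + 2
d≡ G i = trans (sym (deg≡∑ G i)) (alg (+ deg G i))
  where
  alg : ∀ x → x ≡ x - + 2 + + 2
  alg = solve-∀

lapCharPoly≡ : (G : Graph n) (x : ℤ) → lapCharPoly G x ≡ charPoly (T.Q G) (x - + 2)
lapCharPoly≡ G x = det-cong entry
  where
  alg₁ : ∀ x d → x - d ≡ (x - + 2) * + 1 - (+ 1 * (d - + 2) - + 0)
  alg₁ = solve-∀
  alg₂ : ∀ x w → + 0 - - + 1 ≡ (x - + 2) * + 0 - (+ 0 * w - + 1)
  alg₂ = solve-∀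
  alg₃ : ∀ x w → + 0 - + 0 ≡ (x - + 2) * + 0 - (+ 0 * w - + 0)
  alg₃ = solve-∀
  entry : ∀ i j → (if does (i ≟ j) then x else + 0) - laplacian G i j ≡ charMat (T.Q G) (x - + 2) i j
  entry i j with i ≟ j
  ... | yes refl = trans (alg₁ x (+ deg G i)) (cong (λ z → (x - + 2) * + 1 - (+ 1 * (+ deg G i - + 2) - z)) (sym (A-diag G i)))
  ... | no _ with adj G i j
  ...   | true  = alg₂ x (excess G i)
  ...   | false = alg₃ x (excess G i)

SamePolys : Graph n → Graph m → Set
SamePolys G H = ∀ z → charPoly (T.Q G) z ≡ charPoly (T.Q H) z

cospectral⇒samePolys : (G : Graph n) (H : Graph m) → LapCospectral G H → SamePolys G H
cospectral⇒samePolys G H co z = trans (sym (at G)) (trans (co (z + + 2)) (at H))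
  where
  alg : ∀ z → z + + 2 - + 2 ≡ z
  alg = solve-∀
  at : ∀ {k} (K : Graph k) → lapCharPoly K (z + + 2) ≡ charPoly (T.Q K) z
  at K = trans (lapCharPoly≡ K (z + + 2)) (cong (charPoly (T.Q K)) (alg z))

tr-cong : {X Y : Mat n} → (∀ i j → X i j ≡ Y i j) → tr X ≡ tr Y
tr-cong h = ∑-cong (λ i → h i i)

·-congʳ : (X : Mat n) {Y Z : Mat n} → (∀ i j → Y i j ≡ Z i j) → ∀ i j → (X · Y) i j ≡ (X · Z) i j
·-congʳ X h i j = ∑-cong (λ k → cong (X i k *_) (h k j))

·-congˡ : (X : Mat n) {Y Z : Mat n} → (∀ i j → Y i j ≡ Z i j) → ∀ i j → (Y · X) i j ≡ (Z · X) i j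
·-congˡ X h i j = ∑-cong (λ k → cong (_* X k j) (h i k))

·-assoc : (X Y Z : Mat n) → ∀ i j → (X · (Y · Z)) i j ≡ ((X · Y) · Z) i j
·-assoc X Y Z i j =
  trans (∑-cong (λ k → sym (∑-scale (X i k) (λ m → Y k m * Z m j))))
    (trans (∑-comm (λ k m → X i k * (Y k m * Z m j)))
      (∑-cong (λ m → trans (∑-cong (λ k → sym (ℤP.*-assoc (X i k) (Y k m) (Z m j)))) (∑-scaleʳ (Z m j) (λ k → X i k * Y k m)))))

·-identityʳ : (X : Mat n) → ∀ i j → (X · δ) i j ≡ X i j
·-identityʳ X i j = trans (∑-cong (λ k → ℤP.*-comm (X i k) (δ k j))) (∑-δʳ j (X i))

module Invariants (G H : Graph (suc n)) (same : SamePolys G H) where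
  private
    module G = T G
    module H = T H
    open SamePoly G.Q H.Q same

    -- Powers are nested to the right and start at `δ`, the shape that `linked-step` produces; they
    -- are rewritten in terms of `S` and `U` afterwards.
    Q¹ Q² Q³ Q⁴ Q⁵ : Graph (suc n) → Mat (suc n)
    Q¹ K = T.Q K · δ
    Q² K = T.Q K · Q¹ K
    Q³ K = T.Q K · Q² K
    Q⁴ K = T.Q K · Q³ K
    Q⁵ K = T.Q K · Q⁴ K

    Q²≈S : ∀ K i j → Q² K i j ≡ T.S K i j
    Q²≈S K i j = trans (·-congʳ (T.Q K) (·-identityʳ (T.Q K)) i j) (T.Q²≡ K i j)

    Q³≈ : ∀ K i j → Q³ K i j ≡ (T.Q K · T.S K) i j
    Q³≈ K = ·-congʳ (T.Q K) (Q²≈S K)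

    Q⁴≈ : ∀ K i j → Q⁴ K i j ≡ (T.S K · T.S K) i j
    Q⁴≈ K i j = trans (·-congʳ (T.Q K) (Q³≈ K) i j)
      (trans (·-assoc (T.Q K) (T.Q K) (T.S K) i j) (·-congˡ (T.S K) (T.Q²≡ K) i j))

    Q⁵≈ : ∀ K i j → Q⁵ K i j ≡ (T.U K · T.S K) i j
    Q⁵≈ K i j = trans (·-congʳ (T.Q K) (Q⁴≈ K) i j)
      (trans (·-assoc (T.Q K) (T.S K) (T.S K) i j) (·-congˡ (T.S K) (T.QS≡ K) i j))

    L¹ = linked-step δ δ linked-δ
    L² = linked-step (Q¹ G) (Q¹ H) L¹
    L³ = linked-step (Q² G) (Q² H) L²
    L⁴ = linked-step (Q³ G) (Q³ H) L³
    L⁵ = linked-step (Q⁴ G) (Q⁴ H) L⁴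

    transfer : (X : Graph (suc n) → Mat (suc n)) (Y : Graph (suc n) → Mat (suc n)) →
      (∀ K i j → X K i j ≡ Y K i j) → tr (X G) ≡ tr (X H) → tr (Y G) ≡ tr (Y H)
    transfer X Y X≈Y e = trans (sym (tr-cong (X≈Y G))) (trans e (tr-cong (X≈Y H)))

  tr¹ : tr (T.Q G) ≡ tr (T.Q H)
  tr¹ = transfer Q¹ (λ K → T.Q K) (λ K → ·-identityʳ (T.Q K)) (trace-equal (Q¹ G) (Q¹ H) L¹)

  tr² : tr (T.S G) ≡ tr (T.S H)
  tr² = transfer Q² (λ K → T.S K) Q²≈S (trace-equal (Q² G) (Q² H) L²)

  tr³ : tr (T.Q G · T.S G) ≡ tr (T.Q H · T.S H)
  tr³ = transfer Q³ (λ K → T.Q K · T.S K) Q³≈ (trace-equal (Q³ G) (Q³ H) L³)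

  tr⁴ : tr (T.S G · T.S G) ≡ tr (T.S H · T.S H)
  tr⁴ = transfer Q⁴ (λ K → T.S K · T.S K) Q⁴≈ (trace-equal (Q⁴ G) (Q⁴ H) L⁴)

  tr⁵ : tr (T.U G · T.S G) ≡ tr (T.U H · T.S H)
  tr⁵ = transfer Q⁵ (λ K → T.U K · T.S K) Q⁵≈ (trace-equal (Q⁵ G) (Q⁵ H) L⁵)

-- The matrix x - L at x = 0.
N : Graph n → Mat n
N G = charMat (T.Q G) (- + 2)

-- The matrix-tree theorem and connectedness

ones : Fin n → ℤ
ones _ = + 1

-- Up to sign, n times the number of spanning trees.
treeNum : (G : Graph n) → Fin n → ℤ
treeNum {n} G v = det n (N G [ v ≔ ones ])

∑-charMat : (G : Graph n) (f : Fin n → ℤ) (z : ℤ) (i : Fin n) →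
  ∑ (λ j → f j * charMat (T.Q G) z i j) ≡ (z - excess G i) * f i + ∑ (λ j → A G i j * f j)
∑-charMat G f z i =
  trans (∑-cong (λ j → alg (f j) z (δ i j) (excess G i) (A G i j)))
    (trans (∑-add (λ j → δ i j * ((z - excess G i) * f j)) (λ j → A G i j * f j))
      (cong (_+ ∑ (λ j → A G i j * f j)) (∑-δˡ i (λ j → (z - excess G i) * f j))))
  where
  alg : ∀ f z e w a → f * (z * e - (e * w - a)) ≡ e * ((z - w) * f) + a * f
  alg = solve-∀

∑-N : (G : Graph n) (f : Fin n → ℤ) (i : Fin n) →
  ∑ (λ j → f j * N G i j) ≡ - (T.d G i * f i) + ∑ (λ j → A G i j * f j)
∑-N G f i = trans (∑-charMat G f (- + 2) i)
  (cong (_+ ∑ (λ j → A G i j * f j)) (trans (alg (excess G i) (f i)) (cong (λ z → - (z * f i)) (sym (d≡ G i)))))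
  where
  alg : ∀ w f → (- + 2 - w) * f ≡ - ((w + + 2) * f)
  alg = solve-∀

-- The rows of x - L sum to x, so adding all columns to column `v` turns it into x times the
-- all-ones column. At x = 0 the cofactor of x is `treeNum`.
charPoly-factor : (G : Graph n) (v : Fin n) (x : ℤ) →
  charPoly (T.Q G) (x - + 2) ≡ x * det n (charMat (T.Q G) (x - + 2) [ v ≔ ones ])
charPoly-factor {n} G v x =
  trans (sym (ℤP.*-identityˡ (charPoly (T.Q G) (x - + 2))))
    (trans (sym (det-≔-combination M v ones))
      (trans (det-≔-cong M v rowSum) (det-≔-scale M v x ones)))
  where
  M = charMat (T.Q G) (x - + 2)
  alg : ∀ x w → (x - + 2 - w) * + 1 + (w + + 2) ≡ x * + 1
  alg = solve-∀
  rowSum : ∀ i → ∑ (λ j → ones j * M i j) ≡ x * ones i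
  rowSum i = trans (∑-charMat G ones (x - + 2) i)
    (trans (cong (λ z → (x - + 2 - excess G i) * + 1 + z) (trans (∑-cong (λ j → ℤP.*-identityʳ (A G i j))) (d≡ G i)))
           (alg x (excess G i)))

-- After cancelling x, the two remaining factors agree at every positive integer x, and each is
-- congruent modulo x to its constant term. Hence the constant terms agree modulo every x.
treeNum-invariant : (G : Graph n) (H : Graph m) → SamePolys G H → (u : Fin n) (v : Fin m) → treeNum G u ≡ treeNum H v
treeNum-invariant {n} {m} G H same u v = cong-all⇒≡ (treeNum G u) (treeNum H v) close
  where
  alg : ∀ x e q → (x - + 2) * e - q ≡ - + 2 * e - q + x * e
  alg = solve-∀
  alg₀ : ∀ x h → x ≡ x + h * + 0
  alg₀ = solve-∀
  reduced : ∀ {k} (K : Graph k) (w : Fin k) (x : ℤ) → ℤ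
  reduced {k} K w x = det k (charMat (T.Q K) (x - + 2) [ w ≔ ones ])
  reduce : ∀ {k} (K : Graph k) (w : Fin k) (x : ℤ) → Cong x (reduced K w x) (treeNum K w)
  reduce {k} K w x = det-mod x entry
    where
    entry : ∀ i j → Cong x ((charMat (T.Q K) (x - + 2) [ w ≔ ones ]) i j) ((N K [ w ≔ ones ]) i j)
    entry i j with does (j ≟ w)
    ... | true  = + 0 , alg₀ (+ 1) x
    ... | false = δ i j , alg x (δ i j) (T.Q K i j)
  combine : ∀ h {p q s t} → p ≡ q → Cong h p s → Cong h q t → Cong h s t
  combine h {p} {q} {s} {t} refl (e , f) (e′ , f′) = e′ - e , trans (alg₁ s h e) (trans (cong (λ z → z - h * e) (trans (sym f) f′)) (alg₂ t h e e′))
    where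
    alg₁ : ∀ s h e → s ≡ s + h * e - h * e
    alg₁ = solve-∀
    alg₂ : ∀ t h e e′ → t + h * e′ - h * e ≡ t + h * (e′ - e)
    alg₂ = solve-∀
  close : ∀ k → Cong (+ suc k) (treeNum G u) (treeNum H v)
  close k = combine (+ suc k) {reduced G u (+ suc k)} {reduced H v (+ suc k)} {treeNum G u} {treeNum H v}
    (ℤP.*-cancelˡ-≡ (+ suc k) (reduced G u (+ suc k)) (reduced H v (+ suc k))
      (trans (sym (charPoly-factor G u (+ suc k))) (trans (same (+ suc k - + 2)) (charPoly-factor H v (+ suc k)))))
    (reduce G u (+ suc k)) (reduce H v (+ suc k))

-- The indicator of `S` is constant along edges, so L kills it; as it vanishes at `v`, the replaced
-- column does not disturb this. It is a kernel vector with value 1 at `u`.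
treeNum-separated : (G : Graph n) (S : Fin n → Bool) → (∀ i j → adj G i j ≡ true → S i ≡ S j) →
  (u v : Fin n) → S u ≡ true → S v ≡ false → treeNum G v ≡ + 0
treeNum-separated {n} G S closed u v Su Sv =
  trans (sym (trans (cong (λ b → 𝟙 b * treeNum G v) Su) (ℤP.*-identityˡ (treeNum G v))))
        (det-kernel (N G [ v ≔ ones ]) f kernel u)
  where
  f : Fin n → ℤ
  f j = 𝟙 (S j)
  same : ∀ i j → f j * (N G [ v ≔ ones ]) i j ≡ f j * N G i j
  same i j = go (j ≟ v)
    where
    go : Dec (j ≡ v) → f j * (N G [ v ≔ ones ]) i j ≡ f j * N G i j
    go (yes refl) = trans (cong (λ b → 𝟙 b * (N G [ v ≔ ones ]) i j) Sv) (sym (cong (λ b → 𝟙 b * N G i j) Sv))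
    go (no j≢v) = cong (f j *_) (≔-off (N G) v ones i j≢v)
  alg : ∀ d f → - (d * f) + d * f ≡ + 0
  alg = solve-∀
  edge : ∀ i j → A G i j * f j ≡ A G i j * f i
  edge i j with adj G i j in e
  ... | true  = cong (λ b → + 1 * 𝟙 b) (sym (closed i j e))
  ... | false = refl
  kernel : ∀ i → ∑ (λ j → f j * (N G [ v ≔ ones ]) i j) ≡ + 0
  kernel i = trans (∑-cong (same i)) (trans (∑-N G f i)
    (trans (cong (λ z → - (T.d G i * f i) + z) (trans (∑-cong (edge i)) (∑-scaleʳ (f i) (A G i)))) (alg (T.d G i) (f i))))

abstract
  ∑-nonneg : (f : Fin n → ℤ) → (∀ i → + 0 ≤ f i) → + 0 ≤ ∑ f
  ∑-nonneg {zero} f h = ℤP.≤-reflexive (sym (∑-empty f))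
  ∑-nonneg {suc n} f h = subst (+ 0 ≤_) (sym (∑-suc f)) (ℤP.+-mono-≤ (h zero) (∑-nonneg (f ∘ suc) (h ∘ suc)))

  ∑-mono : (f g : Fin n → ℤ) → (∀ i → f i ≤ g i) → ∑ f ≤ ∑ g
  ∑-mono {zero} f g h = ℤP.≤-reflexive (trans (∑-empty f) (sym (∑-empty g)))
  ∑-mono {suc n} f g h = subst₂ _≤_ (sym (∑-suc f)) (sym (∑-suc g)) (ℤP.+-mono-≤ (h zero) (∑-mono (f ∘ suc) (g ∘ suc) (h ∘ suc)))

∑-≥ : (f : Fin n → ℤ) → (∀ i → + 0 ≤ f i) → ∀ i → f i ≤ ∑ f
∑-≥ {suc n} f h i = subst (f i ≤_) (sym (∑-remove i f))
  (subst (_≤ f i + ∑ (λ j → f (punchIn i j))) (ℤP.+-identityʳ (f i)) (ℤP.+-monoʳ-≤ (f i) (∑-nonneg _ (λ j → h (punchIn i j)))))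

∑-≡0 : (f : Fin n → ℤ) → (∀ i → + 0 ≤ f i) → ∑ f ≡ + 0 → ∀ i → f i ≡ + 0
∑-≡0 f h e i = ℤP.≤-antisym (subst (f i ≤_) e (∑-≥ f h i)) (h i)

0≤-square : ∀ x → + 0 ≤ x * x
0≤-square (+ x) = subst (+ 0 ≤_) (ℤP.pos-* x x) (ℤ.+≤+ z≤n)
0≤-square -[1+ x ] = ℤ.+≤+ z≤n

0≤𝟙* : ∀ b {x} → + 0 ≤ x → + 0 ≤ 𝟙 b * x
0≤𝟙* true  {x} h = subst (+ 0 ≤_) (sym (ℤP.*-identityˡ x)) h
0≤𝟙* false h = ℤP.≤-refl

-- The Dirichlet energy, the sum of (f i - f j)² over adjacent pairs, is twice the pairing of f with
-- L f, hence zero; so each of its nonnegative terms is zero.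
harmonic-edge : (G : Graph n) (f : Fin n → ℤ) → (∀ i → T.d G i * f i ≡ ∑ (λ j → A G i j * f j)) →
  ∀ i j → adj G i j ≡ true → f i ≡ f j
harmonic-edge {n} G f harmonic i j e =
  ℤP.i-j≡0⇒i≡j (f i) (f j) (square≡0 (f i - f j)
    (trans (sym (trans (cong (λ b → 𝟙 b * ((f i - f j) * (f i - f j))) e) (ℤP.*-identityˡ _)))
      (∑-≡0 (F i) (F≥0 i) (∑-≡0 (λ i → ∑ (F i)) (λ i → ∑-nonneg (F i) (F≥0 i)) energy i) j)))
  where
  F : Mat n
  F i j = A G i j * ((f i - f j) * (f i - f j))
  F≥0 : ∀ i j → + 0 ≤ F i j
  F≥0 i j = 0≤𝟙* (adj G i j) (0≤-square (f i - f j))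
  square≡0 : ∀ x → x * x ≡ + 0 → x ≡ + 0
  square≡0 x e with ℤP.i*j≡0⇒i≡0∨j≡0 x e
  ... | inj₁ p = p
  ... | inj₂ p = p
  half : Mat n
  half i j = A G i j * (f i * f i) - f i * (A G i j * f j)
  alg : ∀ a x y → a * ((x - y) * (x - y)) ≡ a * (x * x) - x * (a * y) + (a * (y * y) - y * (a * x))
  alg = solve-∀
  pointwise : ∀ i j → F i j ≡ half i j + half j i
  pointwise i j = trans (alg (A G i j) (f i) (f j)) (cong (λ z → half i j + (z * (f j * f j) - f j * (z * f i))) (A-sym G i j))
  alg₂ : ∀ d x → d * (x * x) - x * (d * x) ≡ + 0
  alg₂ = solve-∀
  energy : ∑∑ F ≡ + 0
  energy = trans (∑∑-cong pointwise) (trans (∑∑-symmetrise half) (cong (+ 2 *_) (∑-zero λ i →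
    trans (∑-sub (λ j → A G i j * (f i * f i)) (λ j → f i * (A G i j * f j)))
      (trans (cong₂ _-_ (∑-scaleʳ (f i * f i) (A G i)) (trans (∑-scale (f i) (λ j → A G i j * f j)) (cong (f i *_) (sym (harmonic i)))))
        (alg₂ (T.d G i) (f i))))))

harmonic-reach : (G : Graph n) (f : Fin n → ℤ) → (∀ i → T.d G i * f i ≡ ∑ (λ j → A G i j * f j)) →
  ∀ {i j} → Reach G i j → f i ≡ f j
harmonic-reach G f h reach-refl = refl
harmonic-reach G f h (reach-step e p) = trans (harmonic-edge G f h _ _ e) (harmonic-reach G f h p)

∑-const : ∀ n (x : ℤ) → ∑ {n} (λ _ → x) ≡ + n * x
∑-const zero x = ∑-empty (λ _ → x)
∑-const (suc n) x = trans (∑-suc (λ _ → x)) (trans (cong (λ z → x + z) (∑-const n x)) (sym (ℤP.suc-* (+ n) x)))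

-- `treeNum` is the sum of the cofactors in row `v` of the adjugate. As L is singular these form a
-- harmonic function, which is constant on a connected graph, so all equal the principal minor at
-- `v`.
treeNum-connected : (G : Graph n) → Connected G → (v : Fin n) →
  treeNum G v ≡ + n * det n (N G ∖ setOf (v ∷ []))
treeNum-connected {n} G conn v =
  trans (det-≔-basis (N G) v ones)
    (trans (∑-cong (λ i → trans (ℤP.*-identityˡ (f i)) (sym (harmonic-reach G f harmonic (conn v i)))))
      (trans (∑-const n (f v)) (cong (+ n *_) (det-cong (∖-ins (N G) (setOf []) v)))))
  where
  f : Fin n → ℤ
  f = adjugate (N G) v
  singular : det n (N G) ≡ + 0
  singular = charPoly-factor G v (+ 0)
  alg : ∀ x y → - x + y ≡ + 0 → x ≡ y
  alg x y e = trans (sym (alg₁ x y)) (trans (cong (λ z → y - z) e) (ℤP.+-identityʳ y))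
    where
    alg₁ : ∀ x y → y - (- x + y) ≡ x
    alg₁ = solve-∀
  N-sym : ∀ i j → N G i j ≡ N G j i
  N-sym i j = trans (cong₂ (λ x y → - + 2 * x - (y - A G i j)) (δ-sym i j) δw) (cong (λ z → - + 2 * δ j i - (δ j i * excess G j - z)) (A-sym G i j))
    where
    δw : δ i j * excess G i ≡ δ j i * excess G j
    δw = go (i ≟ j)
      where
      go : Dec (i ≡ j) → δ i j * excess G i ≡ δ j i * excess G j
      go (yes refl) = refl
      go (no i≢j) = trans (cong (_* excess G i) (δ-≢ i≢j)) (sym (cong (_* excess G j) (δ-≢ (≢-sym i≢j))))
  harmonic : ∀ j → T.d G j * f j ≡ ∑ (λ i → A G j i * f i)
  harmonic j = alg (T.d G j * f j) _ (trans (sym (∑-N G f j))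
    (trans (∑-cong (λ i → cong (f i *_) (N-sym j i)))
      (trans (adjugate-law (N G) v j) (trans (cong (δ v j *_) singular) (ℤP.*-zeroʳ (δ v j))))))

-- Lists of neighbours

_∈?_ : (v : Fin n) (xs : List (Fin n)) → Dec (v ∈ xs)
_∈?_ = DecMem._∈?_ _≟_

All≢⇒∉ : {v : Fin n} {xs : List (Fin n)} → All (v ≢_) xs → v ∉ xs
All≢⇒∉ (p ∷ ps) (here e)  = p e
All≢⇒∉ (p ∷ ps) (there q) = All≢⇒∉ ps q

∉⇒All≢ : {v : Fin n} (xs : List (Fin n)) → v ∉ xs → All (v ≢_) xs
∉⇒All≢ [] _ = []
∉⇒All≢ (x ∷ xs) h = (λ e → h (here e)) ∷ ∉⇒All≢ xs (λ p → h (there p))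

_∷ᵁ_ : {v : Fin n} {xs : List (Fin n)} → v ∉ xs → Unique xs → Unique (v ∷ xs)
h ∷ᵁ u = ∉⇒All≢ _ h ∷ u

≢₁₂ : {a b : Fin n} {xs : List (Fin n)} → Unique (a ∷ b ∷ xs) → a ≢ b
≢₁₂ ((e ∷ _) ∷ _) = e

≢₁₃ : {a b c : Fin n} {xs : List (Fin n)} → Unique (a ∷ b ∷ c ∷ xs) → a ≢ c
≢₁₃ ((_ ∷ e ∷ _) ∷ _) = e

≢₂₃ : {a b c : Fin n} {xs : List (Fin n)} → Unique (a ∷ b ∷ c ∷ xs) → b ≢ c
≢₂₃ (_ ∷ (e ∷ _) ∷ _) = e

setOf-true : {v : Fin n} (xs : List (Fin n)) → setOf xs v ≡ true → v ∈ xs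
setOf-true {v = v} xs e with v ∈? xs
... | yes p = p
... | no ¬p with trans (sym e) (setOf-∉ xs (∉⇒All≢ xs ¬p))
...   | ()

sumOver : (Fin n → ℤ) → List (Fin n) → ℤ
sumOver f xs = sumℤ (map f xs)

∑-setOf : (f : Fin n → ℤ) (xs : List (Fin n)) → Unique xs → ∑ (λ v → 𝟙 (setOf xs v) * f v) ≡ sumOver f xs
∑-setOf f [] _ = ∑-zero (λ _ → refl)
∑-setOf f (x ∷ xs) (x∉ ∷ u) =
  trans (∑-cong split)
    (trans (∑-add (λ v → δ v x * f v) (λ v → 𝟙 (setOf xs v) * f v)) (cong₂ _+_ (∑-δʳ x f) (∑-setOf f xs u)))
  where
  split : ∀ v → 𝟙 (setOf (x ∷ xs) v) * f v ≡ δ v x * f v + 𝟙 (setOf xs v) * f v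
  split v with v ≟ x
  ... | yes refl = sym (trans (cong (λ b → + 1 * f v + 𝟙 b * f v) (setOf-∉ xs x∉)) (ℤP.+-identityʳ (+ 1 * f v)))
  ... | no _ = sym (ℤP.+-identityˡ (𝟙 (setOf xs v) * f v))

sumOver-1 : (xs : List (Fin n)) → sumOver (λ _ → + 1) xs ≡ + length xs
sumOver-1 [] = refl
sumOver-1 (x ∷ xs) = cong (λ z → + 1 + z) (sumOver-1 xs)

∑-𝟙-setOf : (xs : List (Fin n)) → Unique xs → ∑ (λ v → 𝟙 (setOf xs v)) ≡ + length xs
∑-𝟙-setOf xs u = trans (∑-cong (λ v → sym (ℤP.*-identityʳ (𝟙 (setOf xs v))))) (trans (∑-setOf (λ _ → + 1) xs u) (sumOver-1 xs))

𝟙-mono : ∀ b b′ → (b ≡ true → b′ ≡ true) → 𝟙 b ≤ 𝟙 b′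
𝟙-mono false false _ = ℤP.≤-refl
𝟙-mono false true  _ = ℤ.+≤+ z≤n
𝟙-mono true  true  _ = ℤP.≤-refl
𝟙-mono true  false h with h refl
... | ()

length-⊆ : (xs : List (Fin n)) (b : Fin n → Bool) → Unique xs → (∀ {v} → v ∈ xs → b v ≡ true) → + length xs ≤ ∑ (λ v → 𝟙 (b v))
length-⊆ xs b u h = subst (_≤ _) (∑-𝟙-setOf xs u)
  (∑-mono _ _ (λ v → 𝟙-mono (setOf xs v) (b v) (λ e → h (setOf-true xs e))))

unique-length≤ : (xs : List (Fin n)) → Unique xs → length xs ℕ.≤ n
unique-length≤ {n} xs u = ℤP.drop‿+≤+ (subst (+ length xs ≤_) (trans (∑-const n (+ 1)) (ℤP.*-identityʳ (+ n)))
  (length-⊆ xs (λ _ → true) u (λ _ → refl)))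

complete-length : (xs : List (Fin n)) → Unique xs → (∀ v → v ∈ xs) → length xs ≡ n
complete-length {n} xs u all = ℤP.+-injective
  (trans (sym (∑-𝟙-setOf xs u)) (trans (∑-cong (λ v → cong 𝟙 (setOf-∈ (all v)))) (trans (∑-const n (+ 1)) (ℤP.*-identityʳ (+ n)))))

full-complete : (xs : List (Fin n)) → Unique xs → length xs ≡ n → ∀ v → v ∈ xs
full-complete xs u e v with v ∈? xs
... | yes p = p
... | no ¬p = ⊥-elim (ℕP.<-irrefl e (unique-length≤ (v ∷ xs) (¬p ∷ᵁ u)))

escape : (xs ys : List (Fin n)) → Unique xs → Unique ys → length ys ℕ.< length xs → Σ (Fin n) λ v → v ∈ xs × v ∉ ys
escape xs ys u u′ lt with All.all? (_∈? ys) xs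
... | yes all = ⊥-elim (ℕP.<⇒≱ lt (ℤP.drop‿+≤+ (subst (+ length xs ≤_) (∑-𝟙-setOf ys u′)
        (length-⊆ xs (setOf ys) u (λ p → setOf-∈ (All.lookup all p))))))
... | no ¬all = go xs ¬all
  where
  go : (xs : List (Fin _)) → ¬ All (_∈ ys) xs → Σ (Fin _) λ v → v ∈ xs × v ∉ ys
  go [] h = ⊥-elim (h [])
  go (x ∷ xs) h with x ∈? ys
  ... | no x∉ = x , here refl , x∉
  ... | yes x∈ with go xs (λ a → h (x∈ ∷ a))
  ...   | v , v∈ , v∉ = v , there v∈ , v∉

record Nbrs (G : Graph n) (v : Fin n) (xs : List (Fin n)) : Set where
  constructor nbrs
  field
    uniq   : Unique xs
    adj-of : ∀ {u} → u ∈ xs → adj G v u ≡ true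
    of-adj : ∀ {u} → adj G v u ≡ true → u ∈ xs
open Nbrs public

A-setOf : (G : Graph n) {v : Fin n} {xs : List (Fin n)} → Nbrs G v xs → ∀ u → A G v u ≡ 𝟙 (setOf xs u)
A-setOf G {v} {xs} N u = go (u ∈? xs)
  where
  false-of : ∀ {b} → (b ≡ true → ⊥) → b ≡ false
  false-of {true}  h = ⊥-elim (h refl)
  false-of {false} h = refl
  go : Dec (u ∈ xs) → A G v u ≡ 𝟙 (setOf xs u)
  go (yes p) = cong 𝟙 (trans (adj-of N p) (sym (setOf-∈ p)))
  go (no ¬p) = cong 𝟙 (trans (false-of (λ e → ¬p (of-adj N e))) (sym (setOf-∉ xs (∉⇒All≢ xs ¬p))))

∑-nbrs : (G : Graph n) {v : Fin n} {xs : List (Fin n)} → Nbrs G v xs → (f : Fin n → ℤ) → ∑ (λ u → A G v u * f u) ≡ sumOver f xs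
∑-nbrs G {v} {xs} N f = trans (∑-cong (λ u → cong (_* f u) (A-setOf G N u))) (∑-setOf f xs (uniq N))

nbrs-deg : (G : Graph n) {v : Fin n} {xs : List (Fin n)} → Nbrs G v xs → length xs ≡ deg G v
nbrs-deg G {v} {xs} N = ℤP.+-injective (sym (trans (deg≡∑ G v) (trans (∑-cong (A-setOf G N)) (∑-𝟙-setOf xs (uniq N)))))

neighbours : (G : Graph n) (v : Fin n) → Σ (List (Fin n)) (Nbrs G v)
neighbours {n} G v = filter P? (allFin n) , nbrs (unique-filter⁺ P? (allFin⁺ n)) (λ p → proj₂ (∈-filter⁻ P? {xs = allFin n} p)) (λ {u} e → ∈-filter⁺ P? (∈-allFin u) e)
  where
  P? : (u : Fin n) → Dec (adj G v u ≡ true)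
  P? u = adj G v u BoolP.≟ true

nbrs-from : (G : Graph n) (v : Fin n) (xs : List (Fin n)) → Unique xs → (∀ {u} → u ∈ xs → adj G v u ≡ true) → deg G v ℕ.≤ length xs → Nbrs G v xs
nbrs-from G v xs u h le = nbrs u h complete
  where
  complete : ∀ {y} → adj G v y ≡ true → y ∈ xs
  complete {y} e with y ∈? xs
  ... | yes p = p
  ... | no ¬p = ⊥-elim (ℕP.<⇒≱ (s≤s le) (ℤP.drop‿+≤+ (subst (+ suc (length xs) ≤_) (sym (deg≡∑ G v))
      (length-⊆ (y ∷ xs) (adj G v) (¬p ∷ᵁ u) (λ { (here refl) → e ; (there q) → h q })))))

edge-sym : (G : Graph n) {u v : Fin n} → adj G u v ≡ true → adj G v u ≡ true
edge-sym G {u} {v} e = trans (adj-sym G v u) e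

edge-≢ : (G : Graph n) {u v : Fin n} → adj G u v ≡ true → u ≢ v
edge-≢ G {u} e refl with trans (sym e) (irrefl G u)
... | ()

connected-spread : (G : Graph n) → Connected G → (xs : List (Fin n)) {u : Fin n} → u ∈ xs →
  (∀ {x y} → x ∈ xs → adj G x y ≡ true → y ∈ xs) → ∀ v → v ∈ xs
connected-spread G conn xs {u} u∈ closed v = go u∈ (conn u v)
  where
  go : ∀ {x y} → x ∈ xs → Reach G x y → y ∈ xs
  go p reach-refl = p
  go p (reach-step e q) = go (closed p e) q

Fenced : Graph n → List (Fin n) → Fin n → Set
Fenced G V u = Σ (List (Fin _)) λ xs → Nbrs G u xs × All (_∈ V) xs

fenced-spread : (G : Graph n) → Connected G → (V : List (Fin n)) {u : Fin n} → u ∈ V → All (Fenced G V) V → ∀ v → v ∈ V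
fenced-spread G conn V u∈ fences = connected-spread G conn V u∈ closed
  where
  closed : ∀ {x y} → x ∈ V → adj G x y ≡ true → y ∈ V
  closed p e with All.lookup fences p
  ... | xs , N , inside = All.lookup inside (of-adj N e)

reach-snoc : (G : Graph n) {u v w : Fin n} → Reach G u v → adj G v w ≡ true → Reach G u w
reach-snoc G reach-refl e = reach-step e reach-refl
reach-snoc G (reach-step f p) e = reach-step f (reach-snoc G p e)

record Component (G : Graph n) (i : Fin n) : Set where
  field
    members   : List (Fin n)
    start     : i ∈ members
    reachable : ∀ {u} → u ∈ members → Reach G i u
    closed    : ∀ {u v} → u ∈ members → adj G u v ≡ true → v ∈ members

-- Vertices reached by a leaking edge are added one by one; fuel `n` suffices because the list stays
-- free of repetitions. As a computation it also decides, later, the connectedness of concrete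
-- graphs.
component : (G : Graph n) (i : Fin n) → Component G i
component {n} G i = grow n (i ∷ []) ([] ∷ []) (here refl) (λ { (here refl) → reach-refl }) (ℕP.≤-reflexive (ℕP.+-comm 1 n))
  where
  Leak : List (Fin n) → Set
  Leak xs = Σ (Fin n) λ u → Σ (Fin n) λ v → u ∈ xs × adj G u v ≡ true × v ∉ xs
  leak? : (xs : List (Fin n)) → Dec (Leak xs)
  leak? xs = FinP.any? λ u → FinP.any? λ v → (u ∈? xs) ×-dec ((adj G u v BoolP.≟ true) ×-dec ¬? (v ∈? xs))
  grow : (fuel : ℕ) (xs : List (Fin n)) → Unique xs → i ∈ xs → (∀ {u} → u ∈ xs → Reach G i u) →
         n ℕ.< fuel ℕ.+ length xs → Component G i
  grow fuel xs uq i∈ re lt with leak? xs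
  ... | no ¬leak = record { members = xs ; start = i∈ ; reachable = re ; closed = cl }
    where
    cl : ∀ {u v} → u ∈ xs → adj G u v ≡ true → v ∈ xs
    cl {u} {v} p e with v ∈? xs
    ... | yes q = q
    ... | no ¬q = ⊥-elim (¬leak (u , v , p , e , ¬q))
  grow zero xs uq i∈ re lt | yes _ = ⊥-elim (ℕP.<⇒≱ lt (unique-length≤ xs uq))
  grow (suc fuel) xs uq i∈ re lt | yes (u , v , p , e , v∉) =
    grow fuel (v ∷ xs) (v∉ ∷ᵁ uq) (there i∈) (λ { (here refl) → reach-snoc G (re p) e ; (there q) → re q })
      (subst (n ℕ.<_) (sym (ℕP.+-suc fuel (length xs))) lt)

connected-if : (G : Graph n) → (∀ v → treeNum G v ≢ + 0) → Connected G
connected-if G h i j with j ∈? Component.members (component G i)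
... | yes p = Component.reachable (component G i) p
... | no ¬p = ⊥-elim (h j (treeNum-separated G (setOf xs) respects i j (setOf-∈ (Component.start C)) (setOf-∉ xs (∉⇒All≢ xs ¬p))))
  where
  C = component G i
  xs = Component.members C
  respects : ∀ u v → adj G u v ≡ true → setOf xs u ≡ setOf xs v
  respects u v e with setOf xs u in eu | setOf xs v in ev
  ... | true  | true  = refl
  ... | false | false = refl
  ... | true  | false = trans (sym (setOf-∈ (Component.closed C (setOf-true xs eu) e))) ev
  ... | false | true  = sym (trans (sym (setOf-∈ (Component.closed C (setOf-true xs ev) (edge-sym G e)))) eu)

-- Isomorphisms from relations that match neighbourhoods

record Correspondence (G : Graph n) (H : Graph m) (R : Fin n → Fin m → Set) : Set where
  field
    to         : ∀ u → Σ (Fin m) (R u)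
    from       : ∀ v → Σ (Fin n) λ u → R u v
    functional : ∀ {u v v′} → R u v → R u v′ → v ≡ v′
    injective  : ∀ {u u′ v} → R u v → R u′ v → u ≡ u′
    matches    : ∀ {u v} → R u v → Σ (List (Fin n × Fin m)) λ ps →
                   Nbrs G u (map proj₁ ps) × Nbrs H v (map proj₂ ps) × All (λ p → R (proj₁ p) (proj₂ p)) ps

-- The neighbour lists of related vertices are complete on both sides, so matching them entry by
-- entry carries adjacency in both directions. An isomorphism can thus be checked vertex by vertex.
correspondence⇒≅ : (G : Graph n) (H : Graph m) {R : Fin n → Fin m → Set} → Correspondence G H R → G ≅ H
correspondence⇒≅ {n} {m} G H {R} C =
  mk↔ₛ′ f g (λ v → functional (proj₂ (to (g v))) (proj₂ (from v))) (λ u → injective (proj₂ (from (f u))) (proj₂ (to u)))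
  , λ i j → bool-ext (forward i j) (backward i j)
  where
  open Correspondence C
  f : Fin n → Fin m
  f u = proj₁ (to u)
  g : Fin m → Fin n
  g v = proj₁ (from v)
  bool-ext : ∀ {b b′} → (b ≡ true → b′ ≡ true) → (b′ ≡ true → b ≡ true) → b ≡ b′
  bool-ext {true}  {true}  _ _ = refl
  bool-ext {false} {false} _ _ = refl
  bool-ext {true}  {false} h _ = sym (h refl)
  bool-ext {false} {true}  _ h = h refl
  forward : ∀ i j → adj G i j ≡ true → adj H (f i) (f j) ≡ true
  forward i j e with matches (proj₂ (to i))
  ... | ps , NG , NH , rel with ∈-map⁻ proj₁ (of-adj NG e)
  ...   | p , p∈ , refl = subst (λ v → adj H (f i) v ≡ true) (functional (All.lookup rel p∈) (proj₂ (to j))) (adj-of NH (∈-map⁺ proj₂ p∈))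
  backward : ∀ i j → adj H (f i) (f j) ≡ true → adj G i j ≡ true
  backward i j e with matches (proj₂ (to i))
  ... | ps , NG , NH , rel with ∈-map⁻ proj₂ (of-adj NH e)
  ...   | p , p∈ , eq = subst (λ v → adj G i v ≡ true) (injective (subst (R (proj₁ p)) (sym eq) (All.lookup rel p∈)) (proj₂ (to j))) (adj-of NG (∈-map⁺ proj₁ p∈))

-- Roses

-- A list of visited vertices grows at its head as a walk proceeds. With this order `rev (u ∷ zs) V`
-- and `rev zs (u ∷ V)` agree definitionally, which is what recursion along chains needs.
rev : List (Fin n) → List (Fin n) → List (Fin n)
rev []       V = V
rev (x ∷ xs) V = rev xs (x ∷ V)

rev-⊇ : (xs : List (Fin n)) {V : List (Fin n)} {v : Fin n} → v ∈ V → v ∈ rev xs V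
rev-⊇ [] p = p
rev-⊇ (x ∷ xs) p = rev-⊇ xs (there p)

rev-∈ : (xs : List (Fin n)) {V : List (Fin n)} {v : Fin n} → v ∈ xs → v ∈ rev xs V
rev-∈ (x ∷ xs) (here refl) = rev-⊇ xs (here refl)
rev-∈ (x ∷ xs) (there p) = rev-∈ xs p

rev-⁻ : (xs : List (Fin n)) {V : List (Fin n)} {v : Fin n} → v ∈ rev xs V → v ∈ xs ⊎ v ∈ V
rev-⁻ [] p = inj₂ p
rev-⁻ (x ∷ xs) p with rev-⁻ xs p
... | inj₁ q = inj₁ (there q)
... | inj₂ (here refl) = inj₁ (here refl)
... | inj₂ (there q) = inj₂ q

rev-unique : (xs : List (Fin n)) {V : List (Fin n)} → Unique (rev xs V) → Unique V
rev-unique [] u = u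
rev-unique (x ∷ xs) u with rev-unique xs u
... | _ ∷ u′ = u′

rev-disjoint : (xs : List (Fin n)) {V : List (Fin n)} → Unique (rev xs V) → ∀ {v} → v ∈ xs → v ∉ V
rev-disjoint (x ∷ xs) u (here refl) q with rev-unique xs u
... | x∉ ∷ _ = All≢⇒∉ x∉ q
rev-disjoint (x ∷ xs) u (there p) q = rev-disjoint xs u p (there q)

rev-uniqueˡ : (xs : List (Fin n)) {V : List (Fin n)} → Unique (rev xs V) → Unique xs
rev-uniqueˡ [] u = []
rev-uniqueˡ (x ∷ xs) u = (λ p → rev-disjoint xs u p (here refl)) ∷ᵁ rev-uniqueˡ xs u

rev-length : (xs V : List (Fin n)) → length (rev xs V) ≡ length xs ℕ.+ length V
rev-length [] V = refl
rev-length (x ∷ xs) V = trans (rev-length xs (x ∷ V)) (ℕP.+-suc (length xs) (length V))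

-- Chain G c p u zs: starting at u, coming from p, the walk u, zs runs through vertices of degree two and then returns to c.
data Chain (G : Graph n) (c : Fin n) : Fin n → Fin n → List (Fin n) → Set where
  end  : ∀ {p u} → Nbrs G u (p ∷ c ∷ []) → Chain G c p u []
  link : ∀ {p u z zs} → Nbrs G u (p ∷ z ∷ []) → Chain G c u z zs → Chain G c p u (z ∷ zs)

lastOf : Fin n → List (Fin n) → Fin n
lastOf u [] = u
lastOf u (z ∷ zs) = lastOf z zs

lastOf-∈ : (u : Fin n) (zs : List (Fin n)) → lastOf u zs ∈ u ∷ zs
lastOf-∈ u [] = here refl
lastOf-∈ u (z ∷ zs) = there (lastOf-∈ z zs)

chain-last : {G : Graph n} {c p u : Fin n} {zs : List (Fin n)} → Chain G c p u zs →
  Σ (Fin n) λ q → Nbrs G (lastOf u zs) (q ∷ c ∷ [])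
chain-last (end N) = _ , N
chain-last (link N ch) = chain-last ch

other : (G : Graph n) (u p : Fin n) → deg G u ≡ 2 → adj G u p ≡ true → Σ (Fin n) λ z → Nbrs G u (p ∷ z ∷ [])
other G u p du e with neighbours G u
... | xs , N with escape xs (p ∷ []) (uniq N) ([] ∷ []) (ℕP.≤-reflexive (sym (trans (nbrs-deg G N) du)))
... | z , z∈ , z∉ = z , nbrs-from G u (p ∷ z ∷ []) (((λ { (here refl) → z∉ (here refl) }) ∷ᵁ ([] ∷ [])))
        (λ { (here refl) → e ; (there (here refl)) → adj-of N z∈ }) (ℕP.≤-reflexive du)

ClosedOff : (G : Graph n) → Fin n → List (Fin n) → List (Fin n) → Set
ClosedOff G c V W = ∀ {x y} → x ∈ V → x ≢ c → adj G x y ≡ true → y ∈ W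

record Loop (G : Graph n) (c p u : Fin n) (V : List (Fin n)) : Set where
  field
    rest   : List (Fin n)
    chain  : Chain G c p u rest
    unique : Unique (rev (u ∷ rest) V)
    closed : ClosedOff G c (rev (u ∷ rest) V) (rev (u ∷ rest) V)

-- The walk continues to the other neighbour `z` of `u` and can close up only at `c`: if `z` were
-- visited before and were neither `c` nor `p`, the first closure hypothesis would make `u` visited
-- as well. The second one restores the first after the step. Fuel runs out only after more than `n`
-- distinct vertices.
loop : (G : Graph n) (c : Fin n) → (∀ v → v ≢ c → deg G v ≡ 2) →
  (fuel : ℕ) (p u : Fin n) (V : List (Fin n)) → c ∈ V → p ∈ V → u ∉ V → adj G u p ≡ true → Unique V →
  (∀ {x y} → x ∈ V → x ≢ c → x ≢ p → adj G x y ≡ true → y ∈ V) → ClosedOff G c V (u ∷ V) →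
  n ℕ.< fuel ℕ.+ length (u ∷ V) → Loop G c p u V
loop G c two zero p u V c∈ p∈ u∉ e uq I₁ I₂ lt = ⊥-elim (ℕP.<⇒≱ lt (unique-length≤ (u ∷ V) (u∉ ∷ᵁ uq)))
loop {n} G c two (suc fuel) p u V c∈ p∈ u∉ e uq I₁ I₂ lt with other G u p (two u (λ { refl → u∉ c∈ })) e
... | z , N with z ≟ c
...   | yes refl = record { rest = [] ; chain = end N ; unique = u∉ ∷ᵁ uq ; closed = cl }
  where
  cl : ClosedOff G c (u ∷ V) (u ∷ V)
  cl (here refl) x≢c f with of-adj N f
  ... | here refl = there p∈
  ... | there (here refl) = there c∈
  cl (there q) x≢c f = I₂ q x≢c f
...   | no z≢c = record { rest = z ∷ Loop.rest L ; chain = link N (Loop.chain L) ; unique = Loop.unique L ; closed = Loop.closed L }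
  where
  u~z : adj G u z ≡ true
  u~z = adj-of N (there (here refl))
  z≢p : z ≢ p
  z≢p e with uniq N
  ... | (p≢z ∷ []) ∷ _ = p≢z (sym e)
  z∉ : z ∉ u ∷ V
  z∉ (here e) = edge-≢ G u~z (sym e)
  z∉ (there q) = u∉ (I₁ q z≢c z≢p (edge-sym G u~z))
  I₁′ : ∀ {x y} → x ∈ u ∷ V → x ≢ c → x ≢ u → adj G x y ≡ true → y ∈ u ∷ V
  I₁′ (here e) _ x≢u _ = ⊥-elim (x≢u e)
  I₁′ (there q) x≢c _ f = I₂ q x≢c f
  I₂′ : ClosedOff G c (u ∷ V) (z ∷ u ∷ V)
  I₂′ (here refl) x≢c f with of-adj N f
  ... | here refl = there (there p∈)
  ... | there (here refl) = here refl
  I₂′ (there q) x≢c f = there (I₂ q x≢c f)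
  L : Loop G c u z (u ∷ V)
  L = loop G c two fuel u z (u ∷ V) (there c∈) (here refl) z∉ (edge-sym G u~z) (u∉ ∷ᵁ uq) I₁′ I₂′
        (subst (n ℕ.<_) (sym (ℕP.+-suc fuel (length (u ∷ V)))) lt)

chain-c : {G : Graph n} {c p u : Fin n} {zs : List (Fin n)} → Chain G c p u zs → c ∉ u ∷ zs →
  ∀ {v} → v ∈ u ∷ zs → adj G v c ≡ true → v ≡ lastOf u zs ⊎ (v ≡ u × c ≡ p)
chain-c (end N) c∉ (here refl) e = inj₁ refl
chain-c (link N ch) c∉ (here refl) e with of-adj N e
... | here c≡p = inj₂ (refl , c≡p)
... | there (here refl) = ⊥-elim (c∉ (there (here refl)))
chain-c (link N ch) c∉ (there q) e with chain-c ch (λ r → c∉ (there r)) q e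
... | inj₁ eq = inj₁ eq
... | inj₂ (_ , refl) = ⊥-elim (c∉ (here refl))

colour : List (Fin n) → Fin n → Bool
colour []       v = true
colour (x ∷ xs) v = if does (v ≟ x) then true else not (colour xs v)

colour-head : (x : Fin n) (xs : List (Fin n)) → colour (x ∷ xs) x ≡ true
colour-head x xs rewrite dec-true (x ≟ x) refl = refl

colour-tail : (x : Fin n) (xs : List (Fin n)) {v : Fin n} → v ≢ x → colour (x ∷ xs) v ≡ not (colour xs v)
colour-tail x xs {v} v≢x rewrite dec-false (v ≟ x) v≢x = refl

-- Edges of a chain that avoid `c` join consecutive entries, which receive opposite colours. The one
-- exception leads from the first vertex back to the entry point `p`.
chain-colour : {G : Graph n} {c p u : Fin n} {zs : List (Fin n)} → Chain G c p u zs → Unique (u ∷ zs) →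
  ∀ {x y} → x ∈ u ∷ zs → y ≢ c → adj G x y ≡ true →
  (y ≡ p × x ≡ u) ⊎ (y ∈ u ∷ zs × colour (u ∷ zs) x ≡ not (colour (u ∷ zs) y))
chain-colour (end N) uq (here refl) y≢c e with of-adj N e
... | here y≡p = inj₁ (y≡p , refl)
... | there (here y≡c) = ⊥-elim (y≢c y≡c)
chain-colour {u = u} (link {z = z} {zs} N ch) ((u≢z ∷ u∉) ∷ uq) (here refl) y≢c e with of-adj N e
... | here y≡p = inj₁ (y≡p , refl)
... | there (here refl) = inj₂ (there (here refl) ,
        trans (colour-head u (z ∷ zs)) (sym (cong not (trans (colour-tail u (z ∷ zs) (≢-sym u≢z)) (cong not (colour-head z zs))))))
chain-colour {u = u} (link {z = z} {zs} N ch) (u∉ ∷ uq) {x} {y} (there q) y≢c e with chain-colour ch uq q y≢c e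
... | inj₁ (refl , refl) = inj₂ (here refl ,
        trans (colour-tail u (z ∷ zs) x≢u) (trans (cong not (colour-head z zs)) (sym (cong not (colour-head u (z ∷ zs))))))
  where
  x≢u : x ≢ u
  x≢u refl = All≢⇒∉ u∉ q
... | inj₂ (y∈ , eq) = inj₂ (there y∈ ,
        trans (colour-tail u (z ∷ zs) x≢u) (cong not (trans eq (sym (colour-tail u (z ∷ zs) y≢u)))))
  where
  x≢u : x ≢ u
  x≢u refl = All≢⇒∉ u∉ q
  y≢u : y ≢ u
  y≢u refl = All≢⇒∉ u∉ y∈

-- Determinants of loops, and the structure of roses

D : Graph n → List (Fin n) → ℤ
D {n} G V = det n (N G ∖ setOf V)

N-off : (G : Graph n) {i j : Fin n} → i ≢ j → N G i j ≡ A G i j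
N-off G {i} {j} i≢j = trans (cong (λ e → - + 2 * e - (e * excess G i - A G i j)) (δ-≢ i≢j)) (alg (excess G i) (A G i j))
  where
  alg : ∀ w a → - + 2 * + 0 - (+ 0 * w - a) ≡ a
  alg = solve-∀

N-diag : (G : Graph n) (i : Fin n) → N G i i ≡ - + deg G i
N-diag G i = trans (cong₂ (λ e a → - + 2 * e - (e * excess G i - a)) (δ-refl i) (A-diag G i)) (alg (+ deg G i))
  where
  alg : ∀ d → - + 2 * + 1 - (+ 1 * (d - + 2) - + 0) ≡ - d
  alg = solve-∀

A-adj : (G : Graph n) {i j : Fin n} → adj G i j ≡ true → A G i j ≡ + 1
A-adj G e = cong 𝟙 e

A-nonadj : (G : Graph n) {i j : Fin n} → ¬ (adj G i j ≡ true) → A G i j ≡ + 0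
A-nonadj G {i} {j} h with adj G i j
... | true  = ⊥-elim (h refl)
... | false = refl

setOf-false : {v : Fin n} {V : List (Fin n)} → v ∉ V → setOf V v ≡ false
setOf-false {V = V} h = setOf-∉ V (∉⇒All≢ V h)

setOf-false⁻ : {v : Fin n} {V : List (Fin n)} → setOf V v ≡ false → v ∉ V
setOf-false⁻ e p with trans (sym e) (setOf-∈ p)
... | ()

-- The continuant of a path with diagonal -2: for k vertices between deleted ones the factor is
-- (-1)ᵏ (k + 1). Since the recurrence has order two, the minors with and without `u` are computed
-- together.
chain-det : (G : Graph n) {c p u : Fin n} {zs : List (Fin n)} (V : List (Fin n)) → Chain G c p u zs → p ∈ V → c ∈ V →
  Unique (rev (u ∷ zs) V) →
  D G V ≡ sgn (suc (length zs)) * (+ suc (suc (length zs)) * D G (rev (u ∷ zs) V))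
  × D G (u ∷ V) ≡ sgn (length zs) * (+ suc (length zs) * D G (rev (u ∷ zs) V))
chain-det {n} G {c} {p} {u} V (end Nb) p∈ c∈ uq =
  trans (minor-isolated (N G) (setOf V) u Su row) (trans (cong (_* D G (u ∷ V)) diag) (alg₂ (D G (u ∷ V)))) , alg₁ (D G (u ∷ V))
  where
  alg₁ : ∀ x → x ≡ + 1 * (+ 1 * x)
  alg₁ = solve-∀
  alg₂ : ∀ x → - + 2 * x ≡ - + 1 * (+ 2 * x)
  alg₂ = solve-∀
  Su : setOf V u ≡ false
  Su = setOf-false (rev-disjoint (u ∷ []) uq (here refl))
  diag : N G u u ≡ - + 2
  diag = trans (N-diag G u) (cong (λ d → - + d) (sym (nbrs-deg G Nb)))
  row : ∀ j → setOf V j ≡ false → j ≢ u → N G u j ≡ + 0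
  row j Sj j≢u = trans (N-off G (≢-sym j≢u)) (A-nonadj G λ e → case-nbr (of-adj Nb e))
    where
    case-nbr : j ∉ p ∷ c ∷ []
    case-nbr (here refl) = setOf-false⁻ Sj p∈
    case-nbr (there (here refl)) = setOf-false⁻ Sj c∈
chain-det {n} G {c} {p} {u} {z ∷ zs} V (link Nb ch) p∈ c∈ uq =
  trans (minor-pathEnd (N G) (setOf V) u z Su Sz u≢z row col)
    (trans (cong₂ _+_ (cong₂ _*_ diag (proj₁ ih)) (cong₂ (λ x y → - x * y) (cong₂ _*_ uz zu) (proj₂ ih)))
      (trans (cong (λ s → - + 2 * (s * (+ suc (suc (length zs)) * E)) + - + 1 * (sgn (length zs) * (+ suc (length zs) * E))) (sgn-suc (length zs)))
        (alg (sgn (length zs)) (+ length zs) E)))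
  , proj₁ ih
  where
  E = D G (rev (u ∷ z ∷ zs) V)
  ih = chain-det G (u ∷ V) ch (here refl) (there c∈) uq
  alg : ∀ s k e → - + 2 * (- s * ((+ 2 + k) * e)) + - + 1 * (s * ((+ 1 + k) * e)) ≡ s * ((+ 3 + k) * e)
  alg = solve-∀
  u∉ : u ∉ V
  u∉ = rev-disjoint (u ∷ z ∷ zs) uq (here refl)
  z∉ : z ∉ V
  z∉ = rev-disjoint (u ∷ z ∷ zs) uq (there (here refl))
  Su : setOf V u ≡ false
  Su = setOf-false u∉
  Sz : setOf V z ≡ false
  Sz = setOf-false z∉
  u~z : adj G u z ≡ true
  u~z = adj-of Nb (there (here refl))
  u≢z : u ≢ z
  u≢z = edge-≢ G u~z
  uz : N G u z ≡ + 1
  uz = trans (N-off G u≢z) (A-adj G u~z)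
  zu : N G z u ≡ + 1
  zu = trans (N-off G (≢-sym u≢z)) (A-adj G (edge-sym G u~z))
  diag : N G u u ≡ - + 2
  diag = trans (N-diag G u) (cong (λ d → - + d) (sym (nbrs-deg G Nb)))
  far : ∀ j → setOf V j ≡ false → j ≢ z → ¬ (adj G u j ≡ true)
  far j Sj j≢z e with of-adj Nb e
  ... | here refl = setOf-false⁻ Sj p∈
  ... | there (here refl) = j≢z refl
  row : ∀ j → setOf V j ≡ false → j ≢ u → j ≢ z → N G u j ≡ + 0
  row j Sj j≢u j≢z = trans (N-off G (≢-sym j≢u)) (A-nonadj G (far j Sj j≢z))
  col : ∀ j → setOf V j ≡ false → j ≢ u → j ≢ z → N G j u ≡ + 0
  col j Sj j≢u j≢z = trans (N-off G j≢u) (A-nonadj G (λ e → far j Sj j≢z (edge-sym G e)))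

-- The lists hold the loops without their common vertex, so the cycles have lengths
-- `suc (length (x ∷ xs))` and `suc (length (y ∷ ys))`; `tree-det` is, up to sign, the product of
-- the two.
record Rose (G : Graph n) : Set where
  field
    c x y         : Fin n
    xs ys         : List (Fin n)
    chainˣ        : Chain G c c x xs
    chainʸ        : Chain G c c y ys
    uniqueˣ       : Unique (x ∷ xs)
    uniqueʸ       : Unique (y ∷ ys)
    c∉ˣ           : c ∉ x ∷ xs
    c∉ʸ           : c ∉ y ∷ ys
    disjoint      : ∀ {v} → v ∈ x ∷ xs → v ∉ y ∷ ys
    centre        : Nbrs G c (x ∷ lastOf x xs ∷ y ∷ lastOf y ys ∷ [])
    covers        : ∀ v → v ≡ c ⊎ (v ∈ x ∷ xs ⊎ v ∈ y ∷ ys)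
    size          : suc (length (x ∷ xs) ℕ.+ length (y ∷ ys)) ≡ n
    tree-det      : D G (c ∷ []) ≡ sgn (length (x ∷ xs) ℕ.+ length (y ∷ ys)) * + (suc (length (x ∷ xs)) ℕ.* suc (length (y ∷ ys)))

sgn-+ : ∀ j k → sgn (j ℕ.+ k) ≡ sgn j * sgn k
sgn-+ zero k = sym (ℤP.*-identityˡ (sgn k))
sgn-+ (suc zero) k = trans (sgn-suc k) (alg (sgn k))
  where
  alg : ∀ x → - x ≡ - + 1 * x
  alg = solve-∀
sgn-+ (suc (suc j)) k = sgn-+ j k

chain-nonempty : {G : Graph n} {c u : Fin n} {zs : List (Fin n)} → Chain G c c u zs → zs ≢ []
chain-nonempty (end N) refl with uniq N
... | (c≢c ∷ _) ∷ _ = c≢c refl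
chain-nonempty (link _ _) ()

lastOf-≢ : {u : Fin n} {zs : List (Fin n)} → Unique (u ∷ zs) → zs ≢ [] → lastOf u zs ≢ u
lastOf-≢ {zs = []} uq ne e = ne refl
lastOf-≢ {u = u} {z ∷ zs} (u∉ ∷ _) ne e = All≢⇒∉ u∉ (subst (_∈ z ∷ zs) e (lastOf-∈ z zs))

module Assemble (G : Graph n) (conn : Connected G) (c : Fin n) (d4 : deg G c ≡ 4)
  (x : Fin n) (xs : List (Fin n)) (chˣ : Chain G c c x xs) (c~x : adj G c x ≡ true)
  (y : Fin n) (ys : List (Fin n)) (chʸ : Chain G c c y ys) (c~y : adj G c y ≡ true)
  (uqW : Unique (rev (y ∷ ys) (rev (x ∷ xs) (c ∷ []))))
  (closed : ClosedOff G c (rev (y ∷ ys) (rev (x ∷ xs) (c ∷ []))) (rev (y ∷ ys) (rev (x ∷ xs) (c ∷ [])))) where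
  private
    V W : List (Fin n)
    V = rev (x ∷ xs) (c ∷ [])
    W = rev (y ∷ ys) V
    uqV : Unique V
    uqV = rev-unique (y ∷ ys) uqW
    uqˣ : Unique (x ∷ xs)
    uqˣ = rev-uniqueˡ (x ∷ xs) uqV
    uqʸ : Unique (y ∷ ys)
    uqʸ = rev-uniqueˡ (y ∷ ys) uqW
    c∉x : c ∉ x ∷ xs
    c∉x p = rev-disjoint (x ∷ xs) uqV p (here refl)
    c~ : ∀ {u zs} → Chain G c c u zs → adj G c (lastOf u zs) ≡ true
    c~ ch = edge-sym G (adj-of (proj₂ (chain-last ch)) (there (here refl)))
    c∈V : c ∈ V
    c∈V = rev-⊇ (x ∷ xs) (here refl)
    ∉V : ∀ {v} → v ∈ y ∷ ys → v ∉ V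
    ∉V = rev-disjoint (y ∷ ys) uqW
    dis : ∀ {v} → v ∈ x ∷ xs → v ∉ y ∷ ys
    dis p q = ∉V q (rev-∈ (x ∷ xs) p)
    lx ly : Fin n
    lx = lastOf x xs
    ly = lastOf y ys
    lx∈ : lx ∈ x ∷ xs
    lx∈ = lastOf-∈ x xs
    ly∈ : ly ∈ y ∷ ys
    ly∈ = lastOf-∈ y ys
    apart : ∀ {u v} → u ∈ x ∷ xs → v ∈ y ∷ ys → u ≢ v
    apart p q refl = dis p q
    centreNbrs : Nbrs G c (x ∷ lx ∷ y ∷ ly ∷ [])
    centreNbrs = nbrs-from G c (x ∷ lx ∷ y ∷ ly ∷ [])
      ((≢-sym (lastOf-≢ uqˣ (chain-nonempty chˣ)) ∷ apart (here refl) (here refl) ∷ apart (here refl) ly∈ ∷ [])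
       ∷ (apart lx∈ (here refl) ∷ apart lx∈ ly∈ ∷ [])
       ∷ (≢-sym (lastOf-≢ uqʸ (chain-nonempty chʸ)) ∷ []) ∷ [] ∷ [])
      (λ { (here refl) → c~x ; (there (here refl)) → c~ chˣ
         ; (there (there (here refl))) → c~y ; (there (there (there (here refl)))) → c~ chʸ })
      (ℕP.≤-reflexive d4)
    closedW : ∀ {u v} → u ∈ W → adj G u v ≡ true → v ∈ W
    closedW {u} {v} p e with u ≟ c
    ... | no u≢c = closed p u≢c e
    ... | yes refl with of-adj centreNbrs e
    ...   | here refl = rev-⊇ (y ∷ ys) (rev-∈ (x ∷ xs) (here refl))
    ...   | there (here refl) = rev-⊇ (y ∷ ys) (rev-∈ (x ∷ xs) lx∈)
    ...   | there (there (here refl)) = rev-∈ (y ∷ ys) {V} (here refl)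
    ...   | there (there (there (here refl))) = rev-∈ (y ∷ ys) {V} ly∈
    allW : ∀ v → v ∈ W
    allW = connected-spread G conn W (rev-⊇ (y ∷ ys) c∈V) closedW
    cover : ∀ v → v ≡ c ⊎ (v ∈ x ∷ xs ⊎ v ∈ y ∷ ys)
    cover v with rev-⁻ (y ∷ ys) (allW v)
    ... | inj₁ p = inj₂ (inj₂ p)
    ... | inj₂ p with rev-⁻ (x ∷ xs) p
    ...   | inj₁ q = inj₂ (inj₁ q)
    ...   | inj₂ (here e) = inj₁ e
    j k : ℕ
    j = length (x ∷ xs)
    k = length (y ∷ ys)
    size-eq : suc (j ℕ.+ k) ≡ n
    size-eq = trans (trans (sym (ℕP.+-suc j k)) (trans (ℕP.+-comm j (suc k)) (trans (sym (ℕP.+-suc k j))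
        (cong (k ℕ.+_) (ℕP.+-comm 1 j)))))
      (trans (cong (k ℕ.+_) (sym (rev-length (x ∷ xs) (c ∷ []))))
        (trans (sym (rev-length (y ∷ ys) V)) (complete-length W uqW allW)))
    alg : ∀ s a t b → s * (a * (t * (b * + 1))) ≡ s * t * (a * b)
    alg = solve-∀
    combine : ∀ j k {d e f} → d ≡ sgn j * (+ suc j * e) → e ≡ sgn k * (+ suc k * f) → f ≡ + 1 → d ≡ sgn (j ℕ.+ k) * + (suc j ℕ.* suc k)
    combine j k refl refl refl = trans (alg (sgn j) (+ suc j) (sgn k) (+ suc k)) (cong₂ _*_ (sym (sgn-+ j k)) (sym (ℤP.pos-* (suc j) (suc k))))

  assembled : Rose G
  assembled = record
    { c = c ; x = x ; y = y ; xs = xs ; ys = ys ; chainˣ = chˣ ; chainʸ = chʸ ; uniqueˣ = uqˣ ; uniqueʸ = uqʸ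
    ; c∉ˣ = c∉x ; c∉ʸ = λ p → ∉V p c∈V ; disjoint = dis ; centre = centreNbrs ; covers = cover ; size = size-eq
    ; tree-det = combine j k {D G (c ∷ [])} {D G V} {D G W}
        (proj₁ (chain-det G (c ∷ []) chˣ (here refl) (here refl) uqV)) (proj₁ (chain-det G V chʸ c∈V c∈V uqW))
        (det-∖-all (N G) (setOf W) (λ v → setOf-∈ (allW v))) }

rose : (G : Graph n) → IsRose G → Rose G
rose {n} G (conn , c , d4 , two) = from-first (neighbours G c)
  where
  from-second : ∀ {x} → adj G c x ≡ true → (L : Loop G c c x (c ∷ [])) (y : Fin n) → adj G c y ≡ true →
    Loop G c c y (rev (x ∷ Loop.rest L) (c ∷ [])) → Rose G
  from-second {x} c~x L y c~y L′ = Assemble.assembled G conn c d4 x (Loop.rest L) (Loop.chain L) c~x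
    y (Loop.rest L′) (Loop.chain L′) c~y (Loop.unique L′) (Loop.closed L′)
  first : ∀ {x} → adj G c x ≡ true → Loop G c c x (c ∷ [])
  first {x} e = loop G c two n c x (c ∷ []) (here refl) (here refl)
    (λ { (here e′) → edge-≢ G e (sym e′) }) (edge-sym G e) ([] ∷ [])
    (λ { (here refl) x≢c _ _ → ⊥-elim (x≢c refl) }) (λ { (here refl) x≢c _ → ⊥-elim (x≢c refl) })
    (ℕP.≤-trans (s≤s (ℕP.n≤1+n n)) (ℕP.≤-reflexive (ℕP.+-comm 2 n)))
  step-second : ∀ {x zs} → Nbrs G c zs → adj G c x ≡ true → Loop G c c x (c ∷ []) → Rose G
  step-second {x} {zs} N₀ c~x L = from-second c~x L y c~y
    (loop G c two n c y V c∈V c∈V y∉V (edge-sym G c~y) (Loop.unique L)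
      (λ p x≢c _ e → Loop.closed L p x≢c e) (λ p x≢c e → there (Loop.closed L p x≢c e))
      (subst (n ℕ.<_) (sym (ℕP.+-suc n (length V))) (s≤s (ℕP.m≤m+n n (length V)))))
    where
    xs = Loop.rest L
    V = rev (x ∷ xs) (c ∷ [])
    uqˣ : Unique (x ∷ xs)
    uqˣ = rev-uniqueˡ (x ∷ xs) (Loop.unique L)
    c∉x : c ∉ x ∷ xs
    c∉x p = rev-disjoint (x ∷ xs) (Loop.unique L) p (here refl)
    -- A neighbour of `c` other than the two ends of the first loop. By `chain-c` the ends are the
    -- only vertices of that loop next to `c`, so a second loop starts here.
    esc : Σ (Fin n) λ v → v ∈ zs × v ∉ lastOf x xs ∷ x ∷ []
    esc = escape zs (lastOf x xs ∷ x ∷ []) (uniq N₀) ((lastOf-≢ uqˣ (chain-nonempty (Loop.chain L)) ∷ []) ∷ [] ∷ [])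
            (ℕP.≤-trans (s≤s (s≤s (s≤s z≤n))) (ℕP.≤-reflexive (sym (trans (nbrs-deg G N₀) d4))))
    y = proj₁ esc
    c~y : adj G c y ≡ true
    c~y = adj-of N₀ (proj₁ (proj₂ esc))
    c∈V : c ∈ V
    c∈V = rev-⊇ (x ∷ xs) (here refl)
    y∉V : y ∉ V
    y∉V p with rev-⁻ (x ∷ xs) p
    ... | inj₂ (here e) = edge-≢ G c~y (sym e)
    ... | inj₁ q with chain-c (Loop.chain L) c∉x q (edge-sym G c~y)
    ...   | inj₁ e = proj₂ (proj₂ esc) (here e)
    ...   | inj₂ (e , _) = proj₂ (proj₂ esc) (there (here e))
  no-nbrs : Nbrs G c [] → ⊥
  no-nbrs N₀ with trans (nbrs-deg G N₀) d4
  ... | ()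
  from-first : Σ (List (Fin n)) (Nbrs G c) → Rose G
  from-first ([] , N₀) = ⊥-elim (no-nbrs N₀)
  from-first (x ∷ _ , N₀) = step-second N₀ (adj-of N₀ (here refl)) (first (adj-of N₀ (here refl)))

-- Isomorphism of roses

data At : List (Fin n) → List (Fin m) → Fin n → Fin m → Set where
  at-here  : ∀ {u v} {us : List (Fin n)} {vs : List (Fin m)} → At (u ∷ us) (v ∷ vs) u v
  at-there : ∀ {u v a b} {us : List (Fin n)} {vs : List (Fin m)} → At us vs a b → At (u ∷ us) (v ∷ vs) a b

at-∈ˡ : {us : List (Fin n)} {vs : List (Fin m)} {a : Fin n} {b : Fin m} → At us vs a b → a ∈ us
at-∈ˡ at-here = here refl
at-∈ˡ (at-there p) = there (at-∈ˡ p)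

at-∈ʳ : {us : List (Fin n)} {vs : List (Fin m)} {a : Fin n} {b : Fin m} → At us vs a b → b ∈ vs
at-∈ʳ at-here = here refl
at-∈ʳ (at-there p) = there (at-∈ʳ p)

at-functional : {us : List (Fin n)} {vs : List (Fin m)} {a : Fin n} {b b′ : Fin m} → Unique us → At us vs a b → At us vs a b′ → b ≡ b′
at-functional _ at-here at-here = refl
at-functional (u∉ ∷ _) at-here (at-there q) = ⊥-elim (All≢⇒∉ u∉ (at-∈ˡ q))
at-functional (u∉ ∷ _) (at-there p) at-here = ⊥-elim (All≢⇒∉ u∉ (at-∈ˡ p))
at-functional (_ ∷ u) (at-there p) (at-there q) = at-functional u p q

at-injective : {us : List (Fin n)} {vs : List (Fin m)} {a a′ : Fin n} {b : Fin m} → Unique vs → At us vs a b → At us vs a′ b → a ≡ a′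
at-injective _ at-here at-here = refl
at-injective (v∉ ∷ _) at-here (at-there q) = ⊥-elim (All≢⇒∉ v∉ (at-∈ʳ q))
at-injective (v∉ ∷ _) (at-there p) at-here = ⊥-elim (All≢⇒∉ v∉ (at-∈ʳ p))
at-injective (_ ∷ u) (at-there p) (at-there q) = at-injective u p q

at-to : {us : List (Fin n)} (vs : List (Fin m)) {a : Fin n} → length us ≡ length vs → a ∈ us → Σ (Fin m) (At us vs a)
at-to (v ∷ vs) e (here refl) = v , at-here
at-to (v ∷ vs) e (there p) with at-to vs (ℕP.suc-injective e) p
... | b , q = b , at-there q

at-from : (us : List (Fin n)) {vs : List (Fin m)} {b : Fin m} → length us ≡ length vs → b ∈ vs → Σ (Fin n) λ a → At us vs a b
at-from (u ∷ us) e (here refl) = u , at-here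
at-from (u ∷ us) e (there p) with at-from us (ℕP.suc-injective e) p
... | a , q = a , at-there q

at-last : (u : Fin n) (us : List (Fin n)) (v : Fin m) (vs : List (Fin m)) → length us ≡ length vs → At (u ∷ us) (v ∷ vs) (lastOf u us) (lastOf v vs)
at-last u [] v [] e = at-here
at-last u (u′ ∷ us) v (v′ ∷ vs) e = at-there (at-last u′ us v′ vs (ℕP.suc-injective e))

module _ {G : Graph n} {H : Graph m} (R : Fin n → Fin m → Set) where

  NbrMatch : Fin n → Fin m → Set
  NbrMatch u v = Σ (List (Fin n × Fin m)) λ ps →
    Nbrs G u (map proj₁ ps) × Nbrs H v (map proj₂ ps) × All (λ p → R (proj₁ p) (proj₂ p)) ps

  chain-match : ∀ {c p u us c′ p′ v vs} → Chain G c p u us → Chain H c′ p′ v vs → R c c′ → R p p′ →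
    (∀ {a b} → At (u ∷ us) (v ∷ vs) a b → R a b) → ∀ {a b} → length us ≡ length vs → At (u ∷ us) (v ∷ vs) a b → NbrMatch a b
  chain-match (end N) (end N′) Rc Rp R⊇ e at-here = (_ , _) ∷ (_ , _) ∷ [] , N , N′ , Rp ∷ Rc ∷ []
  chain-match (end N) (end N′) Rc Rp R⊇ e (at-there ())
  chain-match (link N ch) (link N′ ch′) Rc Rp R⊇ e at-here = (_ , _) ∷ (_ , _) ∷ [] , N , N′ , Rp ∷ R⊇ (at-there at-here) ∷ []
  chain-match (link N ch) (link N′ ch′) Rc Rp R⊇ e (at-there q) =
    chain-match ch ch′ Rc (R⊇ at-here) (λ r → R⊇ (at-there r)) (ℕP.suc-injective e) q

rose-≅ : {G : Graph n} {H : Graph m} (P : Rose G) (P′ : Rose H) →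
  length (Rose.xs P) ≡ length (Rose.xs P′) → length (Rose.ys P) ≡ length (Rose.ys P′) → G ≅ H
rose-≅ {n} {m} {G} {H} P P′ ex ey = correspondence⇒≅ G H record
  { to = to ; from = from ; functional = functional ; injective = injective ; matches = matches }
  where
  open Rose P
  open Rose P′ renaming (c to c′; x to x′; y to y′; xs to xs′; ys to ys′; chainˣ to chainˣ′; chainʸ to chainʸ′;
    uniqueˣ to uniqueˣ′; uniqueʸ to uniqueʸ′; c∉ˣ to c∉ˣ′; c∉ʸ to c∉ʸ′; disjoint to disjoint′; centre to centre′; covers to covers′)
    hiding (size; tree-det)
  R : Fin n → Fin m → Set
  R u v = (u ≡ c × v ≡ c′) ⊎ (At (x ∷ xs) (x′ ∷ xs′) u v ⊎ At (y ∷ ys) (y′ ∷ ys′) u v)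
  to : ∀ u → Σ (Fin m) (R u)
  to u with covers u
  ... | inj₁ e = c′ , inj₁ (e , refl)
  ... | inj₂ (inj₁ p) = let v , q = at-to (x′ ∷ xs′) (cong suc ex) p in v , inj₂ (inj₁ q)
  ... | inj₂ (inj₂ p) = let v , q = at-to (y′ ∷ ys′) (cong suc ey) p in v , inj₂ (inj₂ q)
  from : ∀ v → Σ (Fin n) λ u → R u v
  from v with covers′ v
  ... | inj₁ e = c , inj₁ (refl , e)
  ... | inj₂ (inj₁ p) = let u , q = at-from (x ∷ xs) (cong suc ex) p in u , inj₂ (inj₁ q)
  ... | inj₂ (inj₂ p) = let u , q = at-from (y ∷ ys) (cong suc ey) p in u , inj₂ (inj₂ q)
  functional : ∀ {u v v′} → R u v → R u v′ → v ≡ v′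
  functional (inj₁ (_ , e)) (inj₁ (_ , f)) = trans e (sym f)
  functional (inj₁ (refl , _)) (inj₂ (inj₁ q)) = ⊥-elim (c∉ˣ (at-∈ˡ q))
  functional (inj₁ (refl , _)) (inj₂ (inj₂ q)) = ⊥-elim (c∉ʸ (at-∈ˡ q))
  functional (inj₂ (inj₁ q)) (inj₁ (refl , _)) = ⊥-elim (c∉ˣ (at-∈ˡ q))
  functional (inj₂ (inj₂ q)) (inj₁ (refl , _)) = ⊥-elim (c∉ʸ (at-∈ˡ q))
  functional (inj₂ (inj₁ p)) (inj₂ (inj₁ q)) = at-functional uniqueˣ p q
  functional (inj₂ (inj₂ p)) (inj₂ (inj₂ q)) = at-functional uniqueʸ p q
  functional (inj₂ (inj₁ p)) (inj₂ (inj₂ q)) = ⊥-elim (disjoint (at-∈ˡ p) (at-∈ˡ q))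
  functional (inj₂ (inj₂ p)) (inj₂ (inj₁ q)) = ⊥-elim (disjoint (at-∈ˡ q) (at-∈ˡ p))
  injective : ∀ {u u′ v} → R u v → R u′ v → u ≡ u′
  injective (inj₁ (e , _)) (inj₁ (f , _)) = trans e (sym f)
  injective (inj₁ (_ , refl)) (inj₂ (inj₁ q)) = ⊥-elim (c∉ˣ′ (at-∈ʳ q))
  injective (inj₁ (_ , refl)) (inj₂ (inj₂ q)) = ⊥-elim (c∉ʸ′ (at-∈ʳ q))
  injective (inj₂ (inj₁ q)) (inj₁ (_ , refl)) = ⊥-elim (c∉ˣ′ (at-∈ʳ q))
  injective (inj₂ (inj₂ q)) (inj₁ (_ , refl)) = ⊥-elim (c∉ʸ′ (at-∈ʳ q))
  injective (inj₂ (inj₁ p)) (inj₂ (inj₁ q)) = at-injective uniqueˣ′ p q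
  injective (inj₂ (inj₂ p)) (inj₂ (inj₂ q)) = at-injective uniqueʸ′ p q
  injective (inj₂ (inj₁ p)) (inj₂ (inj₂ q)) = ⊥-elim (disjoint′ (at-∈ʳ p) (at-∈ʳ q))
  injective (inj₂ (inj₂ p)) (inj₂ (inj₁ q)) = ⊥-elim (disjoint′ (at-∈ʳ q) (at-∈ʳ p))
  Rc : R c c′
  Rc = inj₁ (refl , refl)
  matches : ∀ {u v} → R u v → NbrMatch {G = G} {H} R u v
  matches (inj₁ (refl , refl)) =
    (x , x′) ∷ (lastOf x xs , lastOf x′ xs′) ∷ (y , y′) ∷ (lastOf y ys , lastOf y′ ys′) ∷ [] , centre , centre′ ,
    inj₂ (inj₁ at-here) ∷ inj₂ (inj₁ (at-last x xs x′ xs′ ex)) ∷ inj₂ (inj₂ at-here) ∷ inj₂ (inj₂ (at-last y ys y′ ys′ ey)) ∷ []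
  matches (inj₂ (inj₁ q)) = chain-match {G = G} {H} R chainˣ chainˣ′ Rc Rc (λ r → inj₂ (inj₁ r)) ex q
  matches (inj₂ (inj₂ q)) = chain-match {G = G} {H} R chainʸ chainʸ′ Rc Rc (λ r → inj₂ (inj₂ r)) ey q

rose-swap : {G : Graph n} → Rose G → Rose G
rose-swap {n} {G} P = record
  { c = c ; x = y ; y = x ; xs = ys ; ys = xs ; chainˣ = chainʸ ; chainʸ = chainˣ ; uniqueˣ = uniqueʸ ; uniqueʸ = uniqueˣ
  ; c∉ˣ = c∉ʸ ; c∉ʸ = c∉ˣ ; disjoint = λ p q → disjoint q p ; centre = centre′ ; covers = covers′
  ; size = trans (cong suc (ℕP.+-comm (length (y ∷ ys)) (length (x ∷ xs)))) size
  ; tree-det = trans tree-det (cong₂ (λ j k → sgn j * + k) (ℕP.+-comm (length (x ∷ xs)) (length (y ∷ ys))) (ℕP.*-comm (suc (length (x ∷ xs))) (suc (length (y ∷ ys))))) }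
  where
  open Rose P
  covers′ : ∀ v → v ≡ c ⊎ (v ∈ y ∷ ys ⊎ v ∈ x ∷ xs)
  covers′ v with covers v
  ... | inj₁ e = inj₁ e
  ... | inj₂ (inj₁ p) = inj₂ (inj₂ p)
  ... | inj₂ (inj₂ p) = inj₂ (inj₁ p)
  reorder : Unique (x ∷ lastOf x xs ∷ y ∷ lastOf y ys ∷ []) → Unique (y ∷ lastOf y ys ∷ x ∷ lastOf x xs ∷ [])
  reorder ((p ∷ q ∷ r ∷ []) ∷ (s ∷ t ∷ []) ∷ (u ∷ []) ∷ [] ∷ []) =
    (u ∷ ≢-sym q ∷ ≢-sym s ∷ []) ∷ (≢-sym r ∷ ≢-sym t ∷ []) ∷ (p ∷ []) ∷ [] ∷ []
  centre′ : Nbrs G c (y ∷ lastOf y ys ∷ x ∷ lastOf x xs ∷ [])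
  centre′ = nbrs-from G c (y ∷ lastOf y ys ∷ x ∷ lastOf x xs ∷ []) (reorder (uniq centre))
    (λ { (here e) → adj-of centre (there (there (here e))) ; (there (here e)) → adj-of centre (there (there (there (here e))))
       ; (there (there (here e))) → adj-of centre (here e) ; (there (there (there (here e)))) → adj-of centre (there (here e)) })
    (ℕP.≤-reflexive (sym (nbrs-deg G centre)))

-- `p` is a root of (X - p′)(X - q′), because this quadratic has the coefficients of (X - p)(X - q).
sum-product : ∀ p q p′ q′ → p ℕ.+ q ≡ p′ ℕ.+ q′ → p ℕ.* q ≡ p′ ℕ.* q′ → p ≡ p′ ⊎ p ≡ q′
sum-product p q p′ q′ es ep with ℤP.i*j≡0⇒i≡0∨j≡0 (+ p - + p′) {+ p - + q′} vanish
  where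
  alg₁ : ∀ p p′ q′ → (p - p′) * (p - q′) ≡ p * p - p * (p′ + q′) + p′ * q′
  alg₁ = solve-∀
  alg₂ : ∀ p q → p * p - p * (p + q) + p * q ≡ + 0
  alg₂ = solve-∀
  es′ : + p′ + + q′ ≡ + p + + q
  es′ = trans (sym (ℤP.pos-+ p′ q′)) (trans (cong +_ (sym es)) (ℤP.pos-+ p q))
  ep′ : + p′ * + q′ ≡ + p * + q
  ep′ = trans (sym (ℤP.pos-* p′ q′)) (trans (cong +_ (sym ep)) (ℤP.pos-* p q))
  vanish : (+ p - + p′) * (+ p - + q′) ≡ + 0
  vanish = trans (alg₁ (+ p) (+ p′) (+ q′)) (trans (cong₂ (λ s t → + p * + p - + p * s + t) es′ ep′) (alg₂ (+ p) (+ q)))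
... | inj₁ e = inj₁ (ℤP.+-injective (ℤP.i-j≡0⇒i≡j (+ p) (+ p′) e))
... | inj₂ e = inj₂ (ℤP.+-injective (ℤP.i-j≡0⇒i≡j (+ p) (+ q′) e))

rose-nonzero : {G : Graph n} → Connected G → Rose G → ∀ v → treeNum G v ≢ + 0
rose-nonzero {n} {G} conn P v e = contra (trans (sym (trans (sym (treeNum-invariant G G (λ _ → refl) c v)) (treeNum-connected G conn c))) e)
  where
  open Rose P
  j = length (x ∷ xs)
  k = length (y ∷ ys)
  sgn≢0 : ∀ i → sgn i ≢ + 0
  sgn≢0 zero ()
  sgn≢0 (suc zero) ()
  sgn≢0 (suc (suc i)) e = sgn≢0 i e
  contra : + n * D G (c ∷ []) ≢ + 0
  contra e with ℤP.i*j≡0⇒i≡0∨j≡0 (+ n) e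
  ... | inj₁ n≡0 = no-vertex n≡0 c
    where
    no-vertex : ∀ {n} → + n ≡ + 0 → Fin n → ⊥
    no-vertex refl ()
  ... | inj₂ d≡0 with ℤP.i*j≡0⇒i≡0∨j≡0 (sgn (j ℕ.+ k)) {+ (suc j ℕ.* suc k)} (trans (sym tree-det) d≡0)
  ...   | inj₁ s≡0 = sgn≢0 (j ℕ.+ k) s≡0
  ...   | inj₂ ()

samePolys-connected : (G : Graph n) (H : Graph m) → SamePolys H G → Connected G → Rose G → Connected H
samePolys-connected G H same conn P = connected-if H (λ v e → rose-nonzero conn P (Rose.c P) (trans (sym (treeNum-invariant H G same v (Rose.c P))) e))

roses-determined : (G H : Graph n) → Connected G → Connected H → Rose G → Rose H → SamePolys H G → H ≅ G
roses-determined {n} G H connG connH P P′ same = decide (sum-product (suc j′) (suc k′) (suc j) (suc k) sums products)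
  where
  module P = Rose P
  module P′ = Rose P′
  j = length (P.x ∷ P.xs)
  k = length (P.y ∷ P.ys)
  j′ = length (P′.x ∷ P′.xs)
  k′ = length (P′.y ∷ P′.ys)
  lengths : j′ ℕ.+ k′ ≡ j ℕ.+ k
  lengths = ℕP.suc-injective (trans P′.size (sym P.size))
  sums : suc j′ ℕ.+ suc k′ ≡ suc j ℕ.+ suc k
  sums = cong suc (trans (ℕP.+-suc j′ k′) (trans (cong suc lengths) (sym (ℕP.+-suc j k))))
  cancel : ∀ i {a b} → sgn i * a ≡ sgn i * b → a ≡ b
  cancel zero {a} {b} e = ℤP.*-cancelˡ-≡ (+ 1) a b e
  cancel (suc zero) {a} {b} e = ℤP.*-cancelˡ-≡ (- + 1) a b e
  cancel (suc (suc i)) e = cancel i e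
  nonZero : ∀ {n} → Fin n → ℕ.NonZero n
  nonZero zero = _
  nonZero (suc _) = _
  dets : D H (P′.c ∷ []) ≡ D G (P.c ∷ [])
  dets = ℤP.*-cancelˡ-≡ (+ n) (D H (P′.c ∷ [])) (D G (P.c ∷ [])) {{nonZero P.c}}
    (trans (sym (treeNum-connected H connH P′.c)) (trans (treeNum-invariant H G same P′.c P.c) (treeNum-connected G connG P.c)))
  products : suc j′ ℕ.* suc k′ ≡ suc j ℕ.* suc k
  products = ℤP.+-injective (cancel (j ℕ.+ k) (trans (cong (λ i → sgn i * + (suc j′ ℕ.* suc k′)) (sym lengths)) (trans (sym P′.tree-det) (trans dets P.tree-det))))
  decide : suc j′ ≡ suc j ⊎ suc j′ ≡ suc k → H ≅ G
  decide (inj₁ e) = rose-≅ P′ P (ℕP.suc-injective (ℕP.suc-injective e))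
    (ℕP.suc-injective (ℕP.+-cancelˡ-≡ j′ k′ k (trans lengths (cong (ℕ._+ k) (sym (ℕP.suc-injective e))))))
  decide (inj₂ e) = rose-≅ P′ (rose-swap P) (ℕP.suc-injective (ℕP.suc-injective e))
    (ℕP.suc-injective (ℕP.+-cancelˡ-≡ j′ k′ j (trans lengths (trans (ℕP.+-comm j k) (cong (ℕ._+ j) (sym (ℕP.suc-injective e)))))))

rose-bipartite : {G : Graph n} (P : Rose G) → Σ (Fin n → Bool) λ χ → ∀ {u v} → u ≢ Rose.c P → v ≢ Rose.c P → adj G u v ≡ true → χ u ≡ not (χ v)
rose-bipartite {n} {G} P = χ , proper
  where
  open Rose P
  χ : Fin n → Bool
  χ v = if setOf (x ∷ xs) v then colour (x ∷ xs) v else colour (y ∷ ys) v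
  χˣ : ∀ {v} → v ∈ x ∷ xs → χ v ≡ colour (x ∷ xs) v
  χˣ {v} p = cong (λ b → if b then colour (x ∷ xs) v else colour (y ∷ ys) v) (setOf-∈ p)
  χʸ : ∀ {v} → v ∈ y ∷ ys → χ v ≡ colour (y ∷ ys) v
  χʸ {v} p = cong (λ b → if b then colour (x ∷ xs) v else colour (y ∷ ys) v) (setOf-false {V = x ∷ xs} (λ q → disjoint q p))
  proper : ∀ {u v} → u ≢ c → v ≢ c → adj G u v ≡ true → χ u ≡ not (χ v)
  proper {u} {v} u≢c v≢c e with covers u
  ... | inj₁ u≡c = ⊥-elim (u≢c u≡c)
  ... | inj₂ (inj₁ p) with chain-colour chainˣ uniqueˣ p v≢c e
  ...   | inj₁ (v≡c , _) = ⊥-elim (v≢c v≡c)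
  ...   | inj₂ (q , eq) = trans (χˣ p) (trans eq (cong not (sym (χˣ q))))
  proper {u} {v} u≢c v≢c e | inj₂ (inj₂ p) with chain-colour chainʸ uniqueʸ p v≢c e
  ...   | inj₁ (v≡c , _) = ⊥-elim (v≢c v≡c)
  ...   | inj₂ (q , eq) = trans (χʸ p) (trans eq (cong not (sym (χʸ q))))

-- Closed walks in roses

-- Allows the remaining factor to be studied under the assumption that an edge is present, so that
-- identities between walk counts need to hold only on actual walks.
𝟙*-zero : ∀ b {X : ℤ} → (b ≡ true → X ≡ + 0) → 𝟙 b * X ≡ + 0
𝟙*-zero true  h = trans (ℤP.*-identityˡ _) (h refl)
𝟙*-zero false h = refl

private
  scale² : (a b : ℤ) (f : Fin n → ℤ) → ∑ (λ i → a * (b * f i)) ≡ a * (b * ∑ f)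
  scale² a b f = trans (∑-scale a (λ i → b * f i)) (cong (a *_) (∑-scale b f))

  scale³ : (a b c : ℤ) (f : Fin n → ℤ) → ∑ (λ i → a * (b * (c * f i))) ≡ a * (b * (c * ∑ f))
  scale³ a b c f = trans (∑-scale a (λ i → b * (c * f i))) (cong (a *_) (scale² b c f))

  scale⁴ : (a b c d : ℤ) (f : Fin n → ℤ) → ∑ (λ i → a * (b * (c * (d * f i)))) ≡ a * (b * (c * (d * ∑ f)))
  scale⁴ a b c d f = trans (∑-scale a (λ i → b * (c * (d * f i)))) (cong (a *_) (scale³ b c d f))

  scale⁵ : (a b c d e : ℤ) (f : Fin n → ℤ) → ∑ (λ i → a * (b * (c * (d * (e * f i))))) ≡ a * (b * (c * (d * (e * ∑ f))))
  scale⁵ a b c d e f = trans (∑-scale a (λ i → b * (c * (d * (e * f i))))) (cong (a *_) (scale⁴ b c d e f))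

∑³ : (Fin n → Fin n → Fin n → ℤ) → ℤ
∑³ F = ∑ λ i → ∑ λ j → ∑ λ k → F i j k

∑⁵ : (Fin n → Fin n → Fin n → Fin n → Fin n → ℤ) → ℤ
∑⁵ F = ∑ λ i → ∑ λ j → ∑ λ l → ∑ λ k → ∑ λ m → F i j l k m

∑³-rotate : (F : Fin n → Fin n → Fin n → ℤ) → ∑³ (λ i j k → F j k i) ≡ ∑³ F
∑³-rotate F = trans (∑-comm (λ i j → ∑ λ k → F j k i)) (∑-cong λ j → ∑-comm (λ i k → F j k i))

∑⁵-rotate : (F : Fin n → Fin n → Fin n → Fin n → Fin n → ℤ) → ∑⁵ (λ i j l k m → F j l k m i) ≡ ∑⁵ F
∑⁵-rotate F = trans (∑-comm (λ i j → ∑ λ l → ∑ λ k → ∑ λ m → F j l k m i)) (∑-cong λ j →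
  trans (∑-comm (λ i l → ∑ λ k → ∑ λ m → F j l k m i)) (∑-cong λ l →
    trans (∑-comm (λ i k → ∑ λ m → F j l k m i)) (∑-cong λ k → ∑-comm (λ i m → F j l k m i))))

∑³-cong : {F F′ : Fin n → Fin n → Fin n → ℤ} → (∀ i j k → F i j k ≡ F′ i j k) → ∑³ F ≡ ∑³ F′
∑³-cong h = ∑-cong λ i → ∑-cong λ j → ∑-cong (h i j)

∑⁵-cong : {F F′ : Fin n → Fin n → Fin n → Fin n → Fin n → ℤ} → (∀ i j l k m → F i j l k m ≡ F′ i j l k m) → ∑⁵ F ≡ ∑⁵ F′
∑⁵-cong h = ∑-cong λ i → ∑-cong λ j → ∑-cong λ l → ∑-cong λ k → ∑-cong (h i j l k)

∑³-add : (F F′ : Fin n → Fin n → Fin n → ℤ) → ∑³ (λ i j k → F i j k + F′ i j k) ≡ ∑³ F + ∑³ F′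
∑³-add F F′ = trans (∑-cong λ i → trans (∑-cong λ j → ∑-add (F i j) (F′ i j)) (∑-add (λ j → ∑ (F i j)) (λ j → ∑ (F′ i j))))
  (∑-add (λ i → ∑ λ j → ∑ (F i j)) (λ i → ∑ λ j → ∑ (F′ i j)))

∑⁵-add : (F F′ : Fin n → Fin n → Fin n → Fin n → Fin n → ℤ) → ∑⁵ (λ i j l k m → F i j l k m + F′ i j l k m) ≡ ∑⁵ F + ∑⁵ F′
∑⁵-add F F′ = trans (∑-cong λ i → trans (∑-cong λ j → ∑³-add (F i j) (F′ i j)) (∑-add (λ j → ∑³ (F i j)) (λ j → ∑³ (F′ i j))))
  (∑-add (λ i → ∑ λ j → ∑³ (F i j)) (λ i → ∑ λ j → ∑³ (F′ i j)))

-- Every odd closed walk passes through c, since G - c is bipartite; a closed 5-walk does so at most twice.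
module OddWalks (G : Graph n) (c : Fin n) (χ : Fin n → Bool)
  (proper : ∀ {u v} → u ≢ c → v ≢ c → adj G u v ≡ true → χ u ≡ not (χ v)) where

  private
    module G = T G
    a : Mat n
    a = A G

    at : Fin n → Bool
    at i = does (i ≟ c)

    not-both : ∀ {i j} → adj G i j ≡ true → at i ≡ true → at j ≡ true → ⊥
    not-both {i} {j} e p q with i ≟ c | j ≟ c
    ... | yes refl | yes refl = edge-≢ G e refl
    not-both e () q | no _ | _
    not-both e p () | yes _ | no _

    flip : ∀ {i j} → adj G i j ≡ true → at i ≡ false → at j ≡ false → χ i ≡ not (χ j)
    flip {i} {j} e p q with i ≟ c | j ≟ c
    ... | no i≢c | no j≢c = proper i≢c j≢c e
    flip e () q | yes _ | _
    flip e p () | no _ | yes _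

    odd³ : ∀ x y z → x ≡ not y → y ≡ not z → z ≡ not x → ⊥
    odd³ true  true  _     () _ _
    odd³ true  false true  _ _ ()
    odd³ true  false false _ () _
    odd³ false false _     () _ _
    odd³ false true  true  _ () _
    odd³ false true  false _ _ ()

    flip² : ∀ {x y z} → x ≡ not y → y ≡ not z → x ≡ z
    flip² {z = true}  refl refl = refl
    flip² {z = false} refl refl = refl

    count³ : ∀ x y z → (x ≡ true → y ≡ true → ⊥) → (y ≡ true → z ≡ true → ⊥) → (z ≡ true → x ≡ true → ⊥) →
      (x ≡ false → y ≡ false → z ≡ false → ⊥) → + 1 - (𝟙 x + 𝟙 y + 𝟙 z) ≡ + 0
    count³ true  true  _     h _ _ _ = ⊥-elim (h refl refl)
    count³ _     true  true  _ h _ _ = ⊥-elim (h refl refl)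
    count³ true  _     true  _ _ h _ = ⊥-elim (h refl refl)
    count³ true  false false _ _ _ _ = refl
    count³ false true  false _ _ _ _ = refl
    count³ false false true  _ _ _ _ = refl
    count³ false false false _ _ _ h = ⊥-elim (h refl refl refl)

    -- A closed 5-walk without loops visits `c` at most twice, and two visits are then two steps
    -- apart. So the number of visits minus the number of pairs of visits is 1.
    count⁵ : ∀ x y z u v → (x ≡ true → y ≡ true → ⊥) → (y ≡ true → z ≡ true → ⊥) → (z ≡ true → u ≡ true → ⊥) →
      (u ≡ true → v ≡ true → ⊥) → (v ≡ true → x ≡ true → ⊥) →
      (x ≡ false → y ≡ false → z ≡ false → u ≡ false → v ≡ false → ⊥) →
      + 1 - (𝟙 x + 𝟙 y + 𝟙 z + 𝟙 u + 𝟙 v) + (𝟙 x * 𝟙 z + 𝟙 y * 𝟙 u + 𝟙 z * 𝟙 v + 𝟙 u * 𝟙 x + 𝟙 v * 𝟙 y) ≡ + 0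
    count⁵ true  true  _     _     _     h _ _ _ _ _ = ⊥-elim (h refl refl)
    count⁵ true  false _     _     true  _ _ _ _ h _ = ⊥-elim (h refl refl)
    count⁵ true  false true  true  false _ _ h _ _ _ = ⊥-elim (h refl refl)
    count⁵ true  false true  false false _ _ _ _ _ _ = refl
    count⁵ true  false false true  false _ _ _ _ _ _ = refl
    count⁵ true  false false false false _ _ _ _ _ _ = refl
    count⁵ false true  true  _     _     _ h _ _ _ _ = ⊥-elim (h refl refl)
    count⁵ false true  false true  true  _ _ _ h _ _ = ⊥-elim (h refl refl)
    count⁵ false true  false true  false _ _ _ _ _ _ = refl
    count⁵ false true  false false true  _ _ _ _ _ _ = refl
    count⁵ false true  false false false _ _ _ _ _ _ = refl
    count⁵ false false true  true  _     _ _ h _ _ _ = ⊥-elim (h refl refl)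
    count⁵ false false true  false true  _ _ _ _ _ _ = refl
    count⁵ false false true  false false _ _ _ _ _ _ = refl
    count⁵ false false false true  true  _ _ _ h _ _ = ⊥-elim (h refl refl)
    count⁵ false false false true  false _ _ _ _ _ _ = refl
    count⁵ false false false false true  _ _ _ _ _ _ = refl
    count⁵ false false false false false _ _ _ _ _ h = ⊥-elim (h refl refl refl refl refl)

    g³ : Fin n → Fin n → Fin n → ℤ
    g³ i j k = δ i c * (a i j * (a j k * a k i))

    walk³ : ∀ i j k → a i j * (a j k * a k i) ≡ g³ i j k + (g³ j k i + g³ k i j)
    walk³ i j k = trans (alg (a i j) (a j k) (a k i) (δ i c) (δ j c) (δ k c))
      (trans (cong (λ z → rhs + z) vanish) (ℤP.+-identityʳ rhs))
      where
      rhs = g³ i j k + (g³ j k i + g³ k i j)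
      alg : ∀ p q r x y z → p * (q * r) ≡ x * (p * (q * r)) + (y * (q * (r * p)) + z * (r * (p * q))) + p * (q * (r * (+ 1 - (x + y + z))))
      alg = solve-∀
      vanish : a i j * (a j k * (a k i * (+ 1 - (δ i c + δ j c + δ k c)))) ≡ + 0
      vanish = 𝟙*-zero (adj G i j) λ ij → 𝟙*-zero (adj G j k) λ jk → 𝟙*-zero (adj G k i) λ ki →
        count³ (at i) (at j) (at k) (not-both ij) (not-both jk) (not-both ki)
          (λ p q r → odd³ (χ i) (χ j) (χ k) (flip ij p q) (flip jk q r) (flip ki r p))

    -- Exactly one of the five rotations of a closed 5-walk starts at `c` and is not back at `c`
    -- after two steps; `g⁵` selects it. Summed over the rotations, its factors give the expression
    -- in `count⁵`.
    g⁵ : Fin n → Fin n → Fin n → Fin n → Fin n → ℤ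
    g⁵ i j l k m = δ i c * (a i j * (a j l * ((+ 1 - δ l c) * (a l k * (a k m * a m i)))))

    walk⁵ : ∀ i j l k m → a i j * (a j l * (a l k * (a k m * a m i))) ≡
      g⁵ i j l k m + (g⁵ j l k m i + (g⁵ l k m i j + (g⁵ k m i j l + g⁵ m i j l k)))
    walk⁵ i j l k m = trans (alg (a i j) (a j l) (a l k) (a k m) (a m i) (δ i c) (δ j c) (δ l c) (δ k c) (δ m c))
      (trans (cong (λ z → rhs + z) vanish) (ℤP.+-identityʳ rhs))
      where
      rhs = g⁵ i j l k m + (g⁵ j l k m i + (g⁵ l k m i j + (g⁵ k m i j l + g⁵ m i j l k)))
      alg : ∀ p q r s t x y z u v → p * (q * (r * (s * t))) ≡
        x * (p * (q * ((+ 1 - z) * (r * (s * t))))) + (y * (q * (r * ((+ 1 - u) * (s * (t * p)))))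
        + (z * (r * (s * ((+ 1 - v) * (t * (p * q))))) + (u * (s * (t * ((+ 1 - x) * (p * (q * r)))))
        + v * (t * (p * ((+ 1 - y) * (q * (r * s))))))))
        + p * (q * (r * (s * (t * (+ 1 - (x + y + z + u + v) + (x * z + y * u + z * v + u * x + v * y))))))
      alg = solve-∀
      vanish : a i j * (a j l * (a l k * (a k m * (a m i * (+ 1 - (δ i c + δ j c + δ l c + δ k c + δ m c)
        + (δ i c * δ l c + δ j c * δ k c + δ l c * δ m c + δ k c * δ i c + δ m c * δ j c)))))) ≡ + 0
      vanish = 𝟙*-zero (adj G i j) λ ij → 𝟙*-zero (adj G j l) λ jl → 𝟙*-zero (adj G l k) λ lk → 𝟙*-zero (adj G k m) λ km → 𝟙*-zero (adj G m i) λ mi →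
        count⁵ (at i) (at j) (at l) (at k) (at m) (not-both ij) (not-both jl) (not-both lk) (not-both km) (not-both mi)
          (λ p q r s t → odd³ (χ i) (χ j) (χ l) (flip ij p q) (flip jl q r)
            (trans (flip² (flip lk r s) (flip km s t)) (flip mi t p)))

    triple : ∀ (F : Fin n → Fin n → Fin n → ℤ) → ∑³ (λ i j k → F i j k + (F j k i + F k i j)) ≡ + 3 * ∑³ F
    triple F = trans (∑³-add F (λ i j k → F j k i + F k i j))
      (trans (cong (λ z → ∑³ F + z) (trans (∑³-add (λ i j k → F j k i) (λ i j k → F k i j))
        (cong₂ _+_ (∑³-rotate F) (trans (∑³-rotate (λ i j k → F j k i)) (∑³-rotate F))))) (alg (∑³ F)))
      where
      alg : ∀ x → x + (x + x) ≡ + 3 * x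
      alg = solve-∀

    quintuple : ∀ (F : Fin n → Fin n → Fin n → Fin n → Fin n → ℤ) →
      ∑⁵ (λ i j l k m → F i j l k m + (F j l k m i + (F l k m i j + (F k m i j l + F m i j l k)))) ≡ + 5 * ∑⁵ F
    quintuple F = trans (∑⁵-add F (λ i j l k m → F j l k m i + (F l k m i j + (F k m i j l + F m i j l k))))
      (trans (cong (λ z → ∑⁵ F + z) (trans (∑⁵-add F₁ (λ i j l k m → F l k m i j + (F k m i j l + F m i j l k))) (cong₂ _+_ r₁
        (trans (∑⁵-add F₂ (λ i j l k m → F k m i j l + F m i j l k)) (cong₂ _+_ r₂
          (trans (∑⁵-add F₃ F₄) (cong₂ _+_ r₃ r₄)))))))
        (alg (∑⁵ F)))
      where
      F₁ F₂ F₃ F₄ : Fin n → Fin n → Fin n → Fin n → Fin n → ℤ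
      F₁ i j l k m = F j l k m i
      F₂ i j l k m = F l k m i j
      F₃ i j l k m = F k m i j l
      F₄ i j l k m = F m i j l k
      r₁ : ∑⁵ F₁ ≡ ∑⁵ F
      r₁ = ∑⁵-rotate F
      r₂ : ∑⁵ F₂ ≡ ∑⁵ F
      r₂ = trans (∑⁵-rotate F₁) r₁
      r₃ : ∑⁵ F₃ ≡ ∑⁵ F
      r₃ = trans (∑⁵-rotate F₂) r₂
      r₄ : ∑⁵ F₄ ≡ ∑⁵ F
      r₄ = trans (∑⁵-rotate F₃) r₃
      alg : ∀ x → x + (x + (x + (x + x))) ≡ + 5 * x
      alg = solve-∀

  trA³≡ : G.trA³ ≡ + 3 * G.t c
  trA³≡ = trans (∑-cong open³) (trans (∑³-cong walk³) (trans (triple g³) (cong (+ 3 *_) collapse)))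
    where
    open³ : ∀ i → G.t i ≡ ∑ (λ j → ∑ (λ k → a i j * (a j k * a k i)))
    open³ i = ∑-cong λ j → trans (cong (a i j *_) (G.c-sym i j)) (sym (∑-scale (a i j) (λ k → a j k * a k i)))
    collapse : ∑³ g³ ≡ G.t c
    collapse = trans (∑-cong λ i → trans (∑-cong λ j → scale² (δ i c) (a i j) (λ k → a j k * a k i)) (∑-scale (δ i c) (λ j → a i j * G.c j i)))
      (trans (∑-δʳ c (λ i → ∑ (λ j → a i j * G.c j i))) (∑-cong λ j → cong (a c j *_) (G.c-sym j c)))

  trA⁵≡ : G.trA⁵ ≡ + 5 * ∑ (λ j → a c j * ∑ (λ l → a j l * ((+ 1 - δ l c) * G.A³ l c)))
  trA⁵≡ = trans (∑-cong open⁵) (trans (∑⁵-cong walk⁵) (trans (quintuple g⁵) (cong (+ 5 *_) collapse)))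
    where
    open⁵ : ∀ i → ∑ (λ k → G.A³ i k * G.c i k) ≡ ∑ (λ j → ∑ (λ l → ∑ (λ k → ∑ (λ m → a i j * (a j l * (a l k * (a k m * a m i)))))))
    open⁵ i = trans (∑-cong λ l → trans (trans (ℤP.*-comm (G.A³ i l) (G.c i l)) (cong (G.c i l *_) (G.A³-sym i l))) (sym (∑-scaleʳ (G.A³ l i) (λ j → a i j * a j l))))
      (trans (∑-comm (λ l j → a i j * a j l * G.A³ l i))
        (∑-cong λ j → ∑-cong λ l → trans (ℤP.*-assoc (a i j) (a j l) (G.A³ l i))
          (sym (trans (∑-cong λ k → scale³ (a i j) (a j l) (a l k) (λ m → a k m * a m i)) (scale² (a i j) (a j l) (λ k → a l k * G.c k i))))))
    collapse : ∑⁵ g⁵ ≡ ∑ (λ j → a c j * ∑ (λ l → a j l * ((+ 1 - δ l c) * G.A³ l c)))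
    collapse = trans (∑-cong λ i → trans (∑-cong λ j → trans (∑-cong λ l →
        trans (∑-cong λ k → scale⁵ (δ i c) (a i j) (a j l) (+ 1 - δ l c) (a l k) (λ m → a k m * a m i))
          (scale⁴ (δ i c) (a i j) (a j l) (+ 1 - δ l c) (λ k → a l k * G.c k i)))
        (scale² (δ i c) (a i j) (λ l → a j l * ((+ 1 - δ l c) * G.A³ l i))))
        (∑-scale (δ i c) (λ j → a i j * ∑ (λ l → a j l * ((+ 1 - δ l c) * G.A³ l i)))))
      (∑-δʳ c (λ i → ∑ (λ j → a i j * ∑ (λ l → a j l * ((+ 1 - δ l c) * G.A³ l i)))))

-- `short` is a triangle. `long` is a cycle of length at least four, and `s` and `q` are its
-- vertices at distance two from `c`; they coincide in a 4-cycle.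
data Ends (G : Graph n) (c x : Fin n) (xs : List (Fin n)) : Set where
  short : (z : Fin n) → xs ≡ z ∷ [] → Nbrs G x (c ∷ z ∷ []) → Nbrs G z (x ∷ c ∷ []) → Ends G c x xs
  long  : (s q : Fin n) → Nbrs G x (c ∷ s ∷ []) → Nbrs G (lastOf x xs) (q ∷ c ∷ []) →
          ¬ (adj G s c ≡ true) → ¬ (adj G q c ≡ true) → 2 ℕ.≤ length xs → Ends G c x xs

ends : {G : Graph n} {c x : Fin n} {xs : List (Fin n)} → Chain G c c x xs → Unique (x ∷ xs) → c ∉ x ∷ xs → Ends G c x xs
ends (end N) uq c∉ with uniq N
... | (c≢c ∷ _) ∷ _ = ⊥-elim (c≢c refl)
ends (link {z = z} {zs = []} N (end N′)) uq c∉ = short z refl N N′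
ends {n} {G} {c} {x} (link {z = s} {zs = s′ ∷ rest} N ch) uq@((x≢s ∷ _) ∷ (s∉ ∷ _)) c∉ =
  long s q N Nl s≁c q≁c (s≤s (s≤s z≤n))
  where
  full = link N ch
  l = lastOf s (s′ ∷ rest)
  l∈ : l ∈ s′ ∷ rest
  l∈ = lastOf-∈ s′ rest
  q = proj₁ (chain-last full)
  Nl = proj₂ (chain-last full)
  s≢l : s ≢ l
  s≢l e = All≢⇒∉ s∉ (subst (_∈ s′ ∷ rest) (sym e) l∈)
  s≁c : ¬ (adj G s c ≡ true)
  s≁c e with chain-c full c∉ (there (here refl)) e
  ... | inj₁ s≡l = s≢l s≡l
  ... | inj₂ (s≡x , _) = x≢s (sym s≡x)
  q≢c : q ≢ c
  q≢c e with uniq Nl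
  ... | (q≢c ∷ []) ∷ _ = q≢c e
  l~q : adj G l q ≡ true
  l~q = adj-of Nl (here refl)
  q≁c : ¬ (adj G q c ≡ true)
  -- The colouring lemma serves here only to place `q` on the chain.
  q≁c e with chain-colour full uq (lastOf-∈ x (s ∷ s′ ∷ rest)) q≢c l~q
  ... | inj₁ (q≡c , _) = q≢c q≡c
  ... | inj₂ (q∈ , _) with chain-c full c∉ q∈ e
  ...   | inj₁ q≡l = edge-≢ G l~q (sym q≡l)
  ...   | inj₂ (q≡x , _) with of-adj N (edge-sym G (subst (λ v → adj G l v ≡ true) q≡x l~q))
  ...     | here l≡c = c∉ (subst (_∈ x ∷ s ∷ s′ ∷ rest) l≡c (there (there l∈)))
  ...     | there (here l≡s) = s≢l (sym l≡s)

-- Common neighbours and 4-cycles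

record Common (G : Graph n) (i k : Fin n) : Set where
  field
    list  : List (Fin n)
    uniqᶜ : Unique list
    both  : ∀ {j} → j ∈ list → adj G i j ≡ true × adj G j k ≡ true
    count : T.c G i k ≡ + length list

record Support (b : Fin n → Bool) : Set where
  field
    list  : List (Fin n)
    uniqˢ : Unique list
    sound : ∀ {j} → j ∈ list → b j ≡ true
    member : ∀ j → b j ≡ setOf list j
    count : ∑ (λ j → 𝟙 (b j)) ≡ + length list

support : (b : Fin n → Bool) → Support b
support {n} b = record { list = xs ; uniqˢ = u ; sound = sound ; member = bool-eq ; count = trans (∑-cong (λ j → cong 𝟙 (bool-eq j))) (∑-𝟙-setOf xs u) }
  where
  P? : (j : Fin n) → Dec (b j ≡ true)
  P? j = b j BoolP.≟ true
  xs = filter P? (allFin n)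
  u : Unique xs
  u = unique-filter⁺ P? (allFin⁺ n)
  sound : ∀ {j} → j ∈ xs → b j ≡ true
  sound p = proj₂ (∈-filter⁻ P? {xs = allFin n} p)
  false-of : ∀ {p} → (p ≡ true → ⊥) → p ≡ false
  false-of {true}  h = ⊥-elim (h refl)
  false-of {false} h = refl
  bool-eq : ∀ j → b j ≡ setOf xs j
  bool-eq j = go (j ∈? xs)
    where
    go : Dec (j ∈ xs) → b j ≡ setOf xs j
    go (yes p) = trans (sound p) (sym (setOf-∈ p))
    go (no ¬p) = trans (false-of (λ e → ¬p (∈-filter⁺ P? (∈-allFin j) e))) (sym (setOf-false ¬p))

𝟙-∧ : ∀ p q → 𝟙 p * 𝟙 q ≡ 𝟙 (p ∧ q)
𝟙-∧ true  q = ℤP.*-identityˡ (𝟙 q)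
𝟙-∧ false q = refl

common : (G : Graph n) (i k : Fin n) → Common G i k
common G i k = record { list = list ; uniqᶜ = uniqˢ ; both = λ {j} p → ∧-both (adj G i j) (adj G j k) (sound p)
                      ; count = trans (∑-cong (λ j → 𝟙-∧ (adj G i j) (adj G j k))) count }
  where
  open Support (support (λ j → adj G i j ∧ adj G j k))
  ∧-both : ∀ p q → p ∧ q ≡ true → p ≡ true × q ≡ true
  ∧-both true true _ = refl , refl

0≤c : (G : Graph n) (i k : Fin n) → + 0 ≤ T.c G i k
0≤c G i k = subst (+ 0 ≤_) (sym (Common.count (common G i k))) (ℤ.+≤+ z≤n)

c≥ : (G : Graph n) (i k : Fin n) (xs : List (Fin n)) → Unique xs → (∀ {j} → j ∈ xs → adj G i j ≡ true × adj G j k ≡ true) → + length xs ≤ T.c G i k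
c≥ G i k xs u h = subst (+ length xs ≤_) (∑-cong (λ j → sym (𝟙-∧ (adj G i j) (adj G j k))))
  (length-⊆ xs (λ j → adj G i j ∧ adj G j k) u (λ p → cong₂ _∧_ (proj₁ (h p)) (proj₂ (h p))))

0≤1-δ : (i k : Fin n) → + 0 ≤ + 1 - δ i k
0≤1-δ i k with does (i ≟ k)
... | true  = ℤP.≤-refl
... | false = ℤ.+≤+ z≤n

0≤* : ∀ {x y} → + 0 ≤ x → + 0 ≤ y → + 0 ≤ x * y
0≤* {+ x} {+ y} _ _ = subst (+ 0 ≤_) (ℤP.pos-* x y) (ℤ.+≤+ z≤n)

falling : ∀ k → + k * (+ k - + 1) ≡ + (k ℕ.* (k ℕ.∸ 1))
falling zero = refl
falling (suc k) = sym (ℤP.pos-* (suc k) k)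

falling-≥ : ∀ k {x} → + k ≤ x → + (k ℕ.* (k ℕ.∸ 1)) ≤ x * (x - + 1)
falling-≥ k {+ x} (ℤ.+≤+ k≤x) = subst (+ (k ℕ.* (k ℕ.∸ 1)) ≤_) (sym (falling x)) (ℤ.+≤+ (ℕP.*-mono-≤ k≤x (ℕP.∸-monoˡ-≤ 1 k≤x)))

κ-term : (G : Graph n) → Mat n
κ-term G i k = (+ 1 - δ i k) * (T.c G i k * (T.c G i k - + 1))

0≤κ-term : (G : Graph n) (i k : Fin n) → + 0 ≤ κ-term G i k
0≤κ-term G i k = 0≤* (0≤1-δ i k) (falling-≥ 0 (0≤c G i k))

0≤κ : (G : Graph n) (i : Fin n) → + 0 ≤ T.κ G i
0≤κ G i = ∑-nonneg (κ-term G i) (0≤κ-term G i)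

κ-term-off : (G : Graph n) {i k : Fin n} → i ≢ k → κ-term G i k ≡ T.c G i k * (T.c G i k - + 1)
κ-term-off G {i} {k} i≢k = trans (cong (λ e → (+ 1 - e) * (T.c G i k * (T.c G i k - + 1))) (δ-≢ i≢k)) (ℤP.*-identityˡ _)

κ-term-diag : (G : Graph n) (i : Fin n) → κ-term G i i ≡ + 0
κ-term-diag G i = cong (λ e → (+ 1 - e) * (T.c G i i * (T.c G i i - + 1))) (δ-refl i)

Square : (G : Graph n) → Fin n → Fin n → Fin n → Fin n → Set
Square G i j k l = adj G i j ≡ true × adj G j k ≡ true × adj G k l ≡ true × adj G l i ≡ true × i ≢ k × j ≢ l

square-rotate : (G : Graph n) {i j k l : Fin n} → Square G i j k l → Square G j k l i
square-rotate G (p , q , r , s , t , u) = q , r , s , p , u , ≢-sym t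

κ-no-squares : (G : Graph n) → (∀ {i j k l} → ¬ Square G i j k l) → ∀ i → T.κ G i ≡ + 0
κ-no-squares G none i = ∑-zero λ k → go k (i ≟ k)
  where
  small : ∀ k (xs : List (Fin _)) → i ≢ k → Unique xs → (∀ {j} → j ∈ xs → adj G i j ≡ true × adj G j k ≡ true) → + length xs * (+ length xs - + 1) ≡ + 0
  small k [] _ _ _ = refl
  small k (j ∷ []) _ _ _ = refl
  small k (j ∷ l ∷ _) i≢k ((j≢l ∷ _) ∷ _) both = ⊥-elim (none (proj₁ (both (here refl)) , proj₂ (both (here refl)) ,
    edge-sym G (proj₂ (both (there (here refl)))) , edge-sym G (proj₁ (both (there (here refl)))) , i≢k , j≢l))
  go : ∀ k → Dec (i ≡ k) → κ-term G i k ≡ + 0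
  go k (yes refl) = κ-term-diag G i
  go k (no i≢k) = trans (κ-term-off G i≢k) (trans (cong (λ x → x * (x - + 1)) (Common.count C)) (small k (Common.list C) i≢k (Common.uniqᶜ C) (Common.both C)))
    where C = common G i k

covers-≤ : (xs : List (Fin n)) → (∀ v → v ∈ xs) → n ℕ.≤ length xs
covers-≤ {n} xs all = ℤP.drop‿+≤+ (subst (_≤ + length xs)
  (trans (∑-cong (λ v → cong 𝟙 (setOf-∈ (all v)))) (trans (∑-const n (+ 1)) (ℤP.*-identityʳ (+ n)))) (bound xs))
  where
  bound : ∀ xs → ∑ (λ v → 𝟙 (setOf {n} xs v)) ≤ + length xs
  bound [] = ℤP.≤-reflexive (∑-zero (λ _ → refl))
  bound (x ∷ xs) = ℤP.≤-trans (∑-mono (λ v → 𝟙 (setOf (x ∷ xs) v)) (λ v → δ v x * + 1 + 𝟙 (setOf xs v)) le)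
    (subst (_≤ + suc (length xs)) (sym (trans (∑-add (λ v → δ v x * + 1) (λ v → 𝟙 (setOf xs v))) (cong (_+ ∑ (λ v → 𝟙 (setOf xs v))) (∑-δʳ x (λ _ → + 1)))))
      (ℤP.+-monoʳ-≤ (+ 1) (bound xs)))
    where
    le : ∀ v → 𝟙 (setOf (x ∷ xs) v) ≤ δ v x * + 1 + 𝟙 (setOf xs v)
    le v with does (v ≟ x) | setOf xs v
    ... | true  | true  = ℤ.+≤+ (s≤s z≤n)
    ... | true  | false = ℤP.≤-refl
    ... | false | true  = ℤP.≤-refl
    ... | false | false = ℤP.≤-refl

chain-deg : {G : Graph n} {c p u : Fin n} {zs : List (Fin n)} → Chain G c p u zs → ∀ {v} → v ∈ u ∷ zs → deg G v ≡ 2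
chain-deg {G = G} (end N) (here refl) = sym (nbrs-deg G N)
chain-deg {G = G} (link N ch) (here refl) = sym (nbrs-deg G N)
chain-deg (link N ch) (there p) = chain-deg ch p

module RoseFacts {G : Graph n} (P : Rose G) where
  open Rose P public
  private module G = T G

  deg-c : deg G c ≡ 4
  deg-c = sym (nbrs-deg G centre)

  deg-other : ∀ v → v ≢ c → deg G v ≡ 2
  deg-other v v≢c with covers v
  ... | inj₁ e = ⊥-elim (v≢c e)
  ... | inj₂ (inj₁ p) = chain-deg chainˣ p
  ... | inj₂ (inj₂ p) = chain-deg chainʸ p

  excess≡ : ∀ i → excess G i ≡ δ i c * + 2
  excess≡ i = go (i ≟ c)
    where
    go : Dec (i ≡ c) → excess G i ≡ δ i c * + 2
    go (yes refl) = trans (cong (λ d → + d - + 2) deg-c) (sym (cong (_* + 2) (δ-refl i)))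
    go (no i≢c) = trans (cong (λ d → + d - + 2) (deg-other i i≢c)) (sym (cong (_* + 2) (δ-≢ i≢c)))

  ∑-excess : (f : Fin n → ℤ) → ∑ (λ i → excess G i * f i) ≡ + 2 * f c
  ∑-excess f = trans (∑-cong (λ i → trans (cong (_* f i) (excess≡ i)) (ℤP.*-assoc (δ i c) (+ 2) (f i)))) (∑-δʳ c (λ i → + 2 * f i))

  excess-c : excess G c ≡ + 2
  excess-c = cong (λ d → + d - + 2) deg-c

  d-c : G.d c ≡ + 4
  d-c = trans (sym (deg≡∑ G c)) (cong +_ deg-c)

  aw-c : G.aw c ≡ + 0
  aw-c = trans (∑-cong (λ k → ℤP.*-comm (A G c k) (excess G k))) (trans (∑-excess (A G c)) (cong (+ 2 *_) (A-diag G c)))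

  acw-c : G.acw c ≡ + 0
  acw-c = trans (∑-cong (λ k → alg (A G c k) (excess G k) (G.c c k))) (trans (∑-excess (λ k → A G c k * G.c c k)) (cong (λ z → + 2 * (z * G.c c c)) (A-diag G c)))
    where
    alg : ∀ x w y → x * w * y ≡ w * (x * y)
    alg = solve-∀

  open OddWalks G c (proj₁ (rose-bipartite P)) (proj₂ (rose-bipartite P)) public

  ∑-nbr-c : (f : Fin n → ℤ) → ∑ (λ k → A G c k * f k) ≡ f x + (f (lastOf x xs) + (f y + (f (lastOf y ys) + + 0)))
  ∑-nbr-c f = ∑-nbrs G centre f

  c-two : ∀ {k u v} → Nbrs G k (u ∷ v ∷ []) → ∀ l → G.c k l ≡ A G u l + (A G v l + + 0)
  c-two N l = ∑-nbrs G N (λ j → A G j l)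

  t-c : G.t c ≡ G.c x c + (G.c (lastOf x xs) c + (G.c y c + (G.c (lastOf y ys) c + + 0)))
  t-c = trans (∑-cong (λ k → cong (A G c k *_) (G.c-sym c k))) (∑-nbr-c (λ k → G.c k c))

  -- Closed 3-walks at c inside one loop.
  loopWalks : ∀ {u us} → Ends G c u us → ℤ
  loopWalks (short _ _ _ _)        = + 2
  loopWalks (long _ _ _ _ _ _ _)   = + 0

  loopWalks≡ : ∀ {u us} (E : Ends G c u us) → G.c u c + G.c (lastOf u us) c ≡ loopWalks E
  loopWalks≡ {u} (short z refl N N′) = cong₂ _+_
    (trans (c-two N c) (cong₂ (λ p q → p + (q + + 0)) (A-diag G c) (A-adj G (adj-of N′ (there (here refl))))))
    (trans (c-two N′ c) (cong₂ (λ p q → p + (q + + 0)) (A-adj G (adj-of N (here refl))) (A-diag G c)))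
  loopWalks≡ (long s q N N′ s≁c q≁c _) = cong₂ _+_
    (trans (c-two N c) (cong₂ (λ p q → p + (q + + 0)) (A-diag G c) (A-nonadj G s≁c)))
    (trans (c-two N′ c) (cong₂ (λ p q → p + (q + + 0)) (A-nonadj G q≁c) (A-diag G c)))

  t-c≡ : (E : Ends G c x xs) (E′ : Ends G c y ys) → G.t c ≡ loopWalks E + loopWalks E′
  t-c≡ E E′ = trans t-c (trans (alg (G.c x c) (G.c (lastOf x xs) c) (G.c y c) (G.c (lastOf y ys) c)) (cong₂ _+_ (loopWalks≡ E) (loopWalks≡ E′)))
    where
    alg : ∀ p q r s → p + (q + (r + (s + + 0))) ≡ (p + q) + (r + s)
    alg = solve-∀

-- A rose with exactly one triangle c x z.
module TriangleRose {G : Graph n} (P : Rose G) (z : Fin n) (xs≡ : Rose.xs P ≡ z ∷ [])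
  (Nx : Nbrs G (Rose.x P) (Rose.c P ∷ z ∷ [])) (Nz : Nbrs G z (Rose.x P ∷ Rose.c P ∷ []))
  (s q : Fin n) (Ny : Nbrs G (Rose.y P) (Rose.c P ∷ s ∷ [])) (Nl : Nbrs G (lastOf (Rose.y P) (Rose.ys P)) (q ∷ Rose.c P ∷ []))
  (s≁c : ¬ (adj G s (Rose.c P) ≡ true)) (q≁c : ¬ (adj G q (Rose.c P) ≡ true)) where
  open RoseFacts P
  private
    module G = T G
    b : Fin n
    b = lastOf y ys

  centre′ : Nbrs G c (x ∷ z ∷ y ∷ b ∷ [])
  centre′ = subst (λ us → Nbrs G c (x ∷ lastOf x us ∷ y ∷ b ∷ [])) xs≡ centre

  private
    c~x : adj G c x ≡ true
    c~x = adj-of centre′ (here refl)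
    c~z : adj G c z ≡ true
    c~z = adj-of centre′ (there (here refl))
    c≢s : c ≢ s
    c≢s = ≢₁₂ (uniq Ny)
    q≢c : q ≢ c
    q≢c = ≢₁₂ (uniq Nl)

    far-x : ∀ {v} → c ≢ v → ¬ (adj G v c ≡ true) → ¬ (adj G x v ≡ true)
    far-x c≢v v≁c e with of-adj Nx e
    ... | here refl = c≢v refl
    ... | there (here refl) = v≁c (edge-sym G c~z)
    far-z : ∀ {v} → c ≢ v → ¬ (adj G v c ≡ true) → ¬ (adj G z v ≡ true)
    far-z c≢v v≁c e with of-adj Nz e
    ... | here refl = v≁c (edge-sym G c~x)
    ... | there (here refl) = c≢v refl

    a3 : ∀ l → G.A³ l c ≡ (A G c l + (A G z l + + 0)) + ((A G x l + (A G c l + + 0)) + ((A G c l + (A G s l + + 0)) + ((A G q l + (A G c l + + 0)) + + 0)))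
    a3 l = trans (G.A³-sym l c) (trans (∑-nbrs G centre′ (λ j → G.c j l))
      (cong₂ _+_ (c-two Nx l) (cong₂ _+_ (c-two Nz l) (cong₂ _+_ (c-two Ny l) (cong (_+ + 0) (c-two Nl l))))))

    value : ∀ l {p o r t u} → A G c l ≡ p → A G z l ≡ o → A G x l ≡ r → A G s l ≡ t → A G q l ≡ u →
      G.A³ l c ≡ (p + (o + + 0)) + ((r + (p + + 0)) + ((p + (t + + 0)) + ((u + (p + + 0)) + + 0)))
    value l refl refl refl refl refl = a3 l

    α : ℤ
    α = A G q s

    a3x : G.A³ x c ≡ + 5
    a3x = value x (A-adj G c~x) (A-adj G (adj-of Nz (here refl))) (A-diag G x)
      (A-nonadj G (λ e → far-x c≢s s≁c (edge-sym G e))) (A-nonadj G (λ e → far-x (≢-sym q≢c) q≁c (edge-sym G e)))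
    a3z : G.A³ z c ≡ + 5
    a3z = value z (A-adj G c~z) (A-diag G z) (A-adj G (adj-of Nx (there (here refl))))
      (A-nonadj G (λ e → far-z c≢s s≁c (edge-sym G e))) (A-nonadj G (λ e → far-z (≢-sym q≢c) q≁c (edge-sym G e)))
    simp : ∀ u → (+ 0 + (+ 0 + + 0)) + ((+ 0 + (+ 0 + + 0)) + ((+ 0 + (+ 0 + + 0)) + ((u + (+ 0 + + 0)) + + 0))) ≡ u
    simp = solve-∀
    simp′ : ∀ u → (+ 0 + (+ 0 + + 0)) + ((+ 0 + (+ 0 + + 0)) + ((+ 0 + (u + + 0)) + ((+ 0 + (+ 0 + + 0)) + + 0))) ≡ u
    simp′ = solve-∀
    a3s : G.A³ s c ≡ α
    a3s = trans (value s (A-nonadj G (λ e → s≁c (edge-sym G e))) (A-nonadj G (far-z c≢s s≁c)) (A-nonadj G (far-x c≢s s≁c)) (A-diag G s) refl) (simp α)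
    a3q : G.A³ q c ≡ α
    a3q = trans (value q (A-nonadj G (λ e → q≁c (edge-sym G e))) (A-nonadj G (far-z (≢-sym q≢c) q≁c)) (A-nonadj G (far-x (≢-sym q≢c) q≁c)) (A-sym G s q) (A-diag G q)) (simp′ α)

    outer : ∀ {l} → l ≢ c → (+ 1 - δ l c) * G.A³ l c ≡ G.A³ l c
    outer {l} l≢c = trans (cong (λ e → (+ 1 - e) * G.A³ l c) (δ-≢ l≢c)) (ℤP.*-identityˡ _)
    inner : (+ 1 - δ c c) * G.A³ c c ≡ + 0
    inner = cong (λ e → (+ 1 - e) * G.A³ c c) (δ-refl c)

    branchˡ : ∀ {j l v} → Nbrs G j (c ∷ l ∷ []) → l ≢ c → G.A³ l c ≡ v → ∑ (λ l → A G j l * ((+ 1 - δ l c) * G.A³ l c)) ≡ + 0 + (v + + 0)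
    branchˡ N l≢c e = trans (∑-nbrs G N _) (cong₂ (λ p r → p + (r + + 0)) inner (trans (outer l≢c) e))
    branchʳ : ∀ {j l v} → Nbrs G j (l ∷ c ∷ []) → l ≢ c → G.A³ l c ≡ v → ∑ (λ l → A G j l * ((+ 1 - δ l c) * G.A³ l c)) ≡ v + (+ 0 + + 0)
    branchʳ N l≢c e = trans (∑-nbrs G N _) (cong₂ (λ p r → p + (r + + 0)) (trans (outer l≢c) e) inner)

  -- In the selected walks the triangle gives 5 + 5, one 5 for each of its vertices other than `c`.
  -- The second loop gives two walks if `q` and `s` are adjacent, that is, if it is a pentagon, and
  -- none otherwise; five rotations multiply this.
  trA⁵-value : G.trA⁵ ≡ + 50 + + 10 * A G q s
  trA⁵-value = trans trA⁵≡ (trans (cong (+ 5 *_) (trans (∑-nbrs G centre′ (λ j → ∑ (λ l → A G j l * ((+ 1 - δ l c) * G.A³ l c))))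
      (cong₂ _+_ (branchˡ Nx (≢-sym (edge-≢ G c~z)) a3z) (cong₂ _+_ (branchʳ Nz (≢-sym (edge-≢ G c~x)) a3x)
        (cong₂ _+_ (branchˡ Ny (≢-sym c≢s) a3s) (cong (_+ + 0) (branchʳ Nl q≢c a3q))))))) (alg α))
    where
    alg : ∀ u → + 5 * ((+ 0 + (+ 5 + + 0)) + ((+ 5 + (+ 0 + + 0)) + ((+ 0 + (u + + 0)) + ((u + (+ 0 + + 0)) + + 0)))) ≡ + 50 + + 10 * u
    alg = solve-∀

  trA⁵≤60 : G.trA⁵ ≤ + 60
  trA⁵≤60 = subst (_≤ + 60) (sym trA⁵-value) (bound (adj G q s))
    where
    bound : ∀ e → + 50 + + 10 * 𝟙 e ≤ + 60
    bound true  = ℤP.≤-refl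
    bound false = ℤ.+≤+ (ℕP.m≤m+n 50 10)

  -- No 4-cycle enters the triangle, since a vertex there has no way out but `c`. So it leaves `c`
  -- along `y` and `b`, is the whole second loop, and the rose has no more than six vertices.
  square-at-c : Connected G → ∀ {j k l} → Square G c j k l → n ℕ.≤ 6
  square-at-c conn {j} {k} {l} (cj , jk , kl , lc , c≢k , j≢l) = sides (of-adj centre′ cj) (of-adj centre′ (edge-sym G lc))
    where
    meet : Nbrs G y (c ∷ k ∷ []) → Nbrs G b (k ∷ c ∷ []) → n ℕ.≤ 6
    meet N N′ = covers-≤ V (fenced-spread G conn V i₀
        ((_ , centre′ , i₁ ∷ i₂ ∷ i₃ ∷ i₄ ∷ []) ∷ (_ , Nx , i₀ ∷ i₂ ∷ []) ∷ (_ , Nz , i₁ ∷ i₀ ∷ [])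
          ∷ (_ , N , i₀ ∷ i₅ ∷ []) ∷ (_ , N′ , i₅ ∷ i₀ ∷ []) ∷ (_ , Nk , i₃ ∷ i₄ ∷ []) ∷ []))
      where
      V : List (Fin n)
      V = c ∷ x ∷ z ∷ y ∷ b ∷ k ∷ []
      i₀ : c ∈ V
      i₀ = here refl
      i₁ : x ∈ V
      i₁ = there (here refl)
      i₂ : z ∈ V
      i₂ = there (there (here refl))
      i₃ : y ∈ V
      i₃ = there (there (there (here refl)))
      i₄ : b ∈ V
      i₄ = there (there (there (there (here refl))))
      i₅ : k ∈ V
      i₅ = there (there (there (there (there (here refl)))))
      y≢b : y ≢ b
      y≢b with uniq centre′
      ... | _ ∷ uq = ≢₂₃ uq
      Nk : Nbrs G k (y ∷ b ∷ [])
      Nk = nbrs-from G k (y ∷ b ∷ []) ((y≢b ∷ []) ∷ [] ∷ [])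
        (λ { (here refl) → edge-sym G (adj-of N (there (here refl))) ; (there (here refl)) → edge-sym G (adj-of N′ (here refl)) })
        (ℕP.≤-reflexive (deg-other k (≢-sym c≢k)))
    k-from-y : adj G y k ≡ true → k ≡ s
    k-from-y e with of-adj Ny e
    ... | here p = ⊥-elim (c≢k (sym p))
    ... | there (here p) = p
    k-from-b : adj G b k ≡ true → k ≡ q
    k-from-b e with of-adj Nl e
    ... | here p = p
    ... | there (here p) = ⊥-elim (c≢k (sym p))
    meet′ : adj G y k ≡ true → adj G b k ≡ true → n ℕ.≤ 6
    meet′ e f = meet (subst (λ v → Nbrs G y (c ∷ v ∷ [])) (sym (k-from-y e)) Ny) (subst (λ v → Nbrs G b (v ∷ c ∷ [])) (sym (k-from-b f)) Nl)
    via-x : ∀ {u} → adj G x k ≡ true → adj G k u ≡ true → u ≢ c → x ≢ u → ⊥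
    via-x e f u≢c x≢u with of-adj Nx e
    ... | here p = c≢k (sym p)
    ... | there (here refl) with of-adj Nz f
    ...   | here p = x≢u (sym p)
    ...   | there (here p) = u≢c p
    via-z : ∀ {u} → adj G z k ≡ true → adj G k u ≡ true → u ≢ c → z ≢ u → ⊥
    via-z e f u≢c z≢u with of-adj Nz e
    ... | there (here p) = c≢k (sym p)
    ... | here refl with of-adj Nx f
    ...   | here p = u≢c p
    ...   | there (here p) = z≢u (sym p)
    j≢c : j ≢ c
    j≢c e = edge-≢ G cj (sym e)
    l≢c : l ≢ c
    l≢c e = edge-≢ G lc e
    sides : j ∈ x ∷ z ∷ y ∷ b ∷ [] → l ∈ x ∷ z ∷ y ∷ b ∷ [] → n ℕ.≤ 6
    sides (here refl) _ = ⊥-elim (via-x jk kl l≢c j≢l)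
    sides (there (here refl)) _ = ⊥-elim (via-z jk kl l≢c j≢l)
    sides _ (here refl) = ⊥-elim (via-x (edge-sym G kl) (edge-sym G jk) j≢c (≢-sym j≢l))
    sides _ (there (here refl)) = ⊥-elim (via-z (edge-sym G kl) (edge-sym G jk) j≢c (≢-sym j≢l))
    sides (there (there (here refl))) (there (there (here e))) = ⊥-elim (j≢l (sym e))
    sides (there (there (there (here refl)))) (there (there (there (here e)))) = ⊥-elim (j≢l (sym e))
    sides (there (there (here refl))) (there (there (there (here refl)))) = meet′ jk (edge-sym G kl)
    sides (there (there (there (here refl)))) (there (there (here refl))) = meet′ (edge-sym G kl) jk

  -- A 4-cycle that avoids `c` consists of vertices of degree two, hence would be a component
  -- without `c`. After rotation any other passes `c` at its first vertex.
  no-squares : Connected G → 7 ℕ.≤ n → ∀ {i j k l} → ¬ Square G i j k l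
  no-squares conn 7≤n {i} {j} {k} {l} sq@(ij , jk , kl , li , i≢k , j≢l) = at-c (i ≟ c) (j ≟ c) (k ≟ c) (l ≟ c)
    where
    big : ¬ (n ℕ.≤ 6)
    big n≤6 = ℕP.<⇒≱ 7≤n n≤6
    pair : ∀ {u v v′} → u ≢ c → adj G u v ≡ true → adj G u v′ ≡ true → v ≢ v′ → Nbrs G u (v ∷ v′ ∷ [])
    pair {u} u≢c e e′ v≢v′ = nbrs-from G u _ ((v≢v′ ∷ []) ∷ [] ∷ []) (λ { (here refl) → e ; (there (here refl)) → e′ }) (ℕP.≤-reflexive (deg-other u u≢c))
    at-c : Dec (i ≡ c) → Dec (j ≡ c) → Dec (k ≡ c) → Dec (l ≡ c) → ⊥
    at-c (yes refl) _ _ _ = big (square-at-c conn sq)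
    at-c _ (yes refl) _ _ = big (square-at-c conn (square-rotate G sq))
    at-c _ _ (yes refl) _ = big (square-at-c conn (square-rotate G (square-rotate G sq)))
    at-c _ _ _ (yes refl) = big (square-at-c conn (square-rotate G (square-rotate G (square-rotate G sq))))
    at-c (no i≢c) (no j≢c) (no k≢c) (no l≢c) =
        All≢⇒∉ (≢-sym i≢c ∷ ≢-sym j≢c ∷ ≢-sym k≢c ∷ ≢-sym l≢c ∷ []) (fenced-spread G conn V i₀
          ((_ , pair i≢c ij (edge-sym G li) j≢l , i₁ ∷ i₃ ∷ []) ∷ (_ , pair j≢c (edge-sym G ij) jk i≢k , i₀ ∷ i₂ ∷ [])
            ∷ (_ , pair k≢c (edge-sym G jk) kl j≢l , i₁ ∷ i₃ ∷ []) ∷ (_ , pair l≢c (edge-sym G kl) li (≢-sym i≢k) , i₂ ∷ i₀ ∷ []) ∷ []) c)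
      where
      V : List (Fin n)
      V = i ∷ j ∷ k ∷ l ∷ []
      i₀ : i ∈ V
      i₀ = here refl
      i₁ : j ∈ V
      i₁ = there (here refl)
      i₂ : k ∈ V
      i₂ = there (there (here refl))
      i₃ : l ∈ V
      i₃ = there (there (there (here refl)))

-- The degree sequence 3, 3, 3, 2, …, 2, 1

∑-≥-list : (f : Fin n → ℤ) (xs : List (Fin n)) → Unique xs → (∀ i → + 0 ≤ f i) → sumOver f xs ≤ ∑ f
∑-≥-list f xs u h = subst (_≤ ∑ f) (∑-setOf f xs u) (∑-mono (λ v → 𝟙 (setOf xs v) * f v) f (λ v → drop (setOf xs v) (h v)))
  where
  drop : ∀ b {x} → + 0 ≤ x → 𝟙 b * x ≤ x
  drop true  {x} _ = ℤP.≤-reflexive (ℤP.*-identityˡ x)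
  drop false h = h

0≤+ : ∀ {x y} → + 0 ≤ x → + 0 ≤ y → + 0 ≤ x + y
0≤+ p q = ℤP.+-mono-≤ p q

0≤𝟙 : ∀ b → + 0 ≤ 𝟙 b
0≤𝟙 true  = ℤ.+≤+ z≤n
0≤𝟙 false = ℤP.≤-refl

0≤A³ : (G : Graph n) (i k : Fin n) → + 0 ≤ T.A³ G i k
0≤A³ G i k = ∑-nonneg _ (λ j → 0≤* (0≤𝟙 (adj G i j)) (0≤c G j k))

0≤trA⁵ : (G : Graph n) → + 0 ≤ T.trA⁵ G
0≤trA⁵ G = ∑-nonneg _ (λ i → ∑-nonneg _ (λ k → 0≤* (0≤A³ G i k) (0≤c G i k)))

0≤t-term : (G : Graph n) (i k : Fin n) → + 0 ≤ A G i k * T.c G i k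
0≤t-term G i k = 0≤* (0≤𝟙 (adj G i k)) (0≤c G i k)

0≤t : (G : Graph n) (i : Fin n) → + 0 ≤ T.t G i
0≤t G i = ∑-nonneg _ (0≤t-term G i)

0≤trA³ : (G : Graph n) → + 0 ≤ T.trA³ G
0≤trA³ G = ∑-nonneg _ (0≤t G)

TriangleFree : Graph n → Set
TriangleFree G = ∀ {i j k} → adj G i j ≡ true → adj G j k ≡ true → adj G i k ≡ true → ⊥

a·c≡0 : (G : Graph n) → T.trA³ G ≡ + 0 → ∀ i k → A G i k * T.c G i k ≡ + 0
a·c≡0 G e i k = ∑-≡0 (λ k → A G i k * T.c G i k) (0≤t-term G i) (∑-≡0 (T.t G) (0≤t G) e i) k

triangleFree : (G : Graph n) → T.trA³ G ≡ + 0 → TriangleFree G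
triangleFree G e {i} {j} {k} ij jk ik = absurd (subst (+ 1 ≤_) zero-c (c≥ G i k (j ∷ []) ([] ∷ []) (λ { (here refl) → ij , jk })))
  where
  zero-c : T.c G i k ≡ + 0
  zero-c = trans (sym (ℤP.*-identityˡ (T.c G i k))) (trans (cong (_* T.c G i k) (sym (A-adj G ik))) (a·c≡0 G e i k))
  absurd : ¬ (+ 1 ≤ + 0)
  absurd (ℤ.+≤+ ())

record Mate (H : Graph n) : Set where
  field
    r s t y : Fin n
    distinct : Unique (r ∷ s ∷ t ∷ [])
    deg3 : ∀ {v} → v ∈ r ∷ s ∷ t ∷ [] → deg H v ≡ 3
    deg1 : deg H y ≡ 1
    deg2 : ∀ {v} → v ∉ r ∷ s ∷ t ∷ [] → v ≢ y → deg H v ≡ 2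

module MateFacts {H : Graph n} (M : Mate H) where
  open Mate M public
  private module H = T H

  y∉ : y ∉ r ∷ s ∷ t ∷ []
  y∉ p with trans (sym deg1) (deg3 p)
  ... | ()

  excess≡ : ∀ i → excess H i ≡ 𝟙 (setOf (r ∷ s ∷ t ∷ []) i) - δ i y
  excess≡ i = go (i ∈? (r ∷ s ∷ t ∷ [])) (i ≟ y)
    where
    go : Dec (i ∈ r ∷ s ∷ t ∷ []) → Dec (i ≡ y) → excess H i ≡ 𝟙 (setOf (r ∷ s ∷ t ∷ []) i) - δ i y
    go (yes p) (yes refl) = ⊥-elim (y∉ p)
    go (yes p) (no i≢y) = trans (cong (λ d → + d - + 2) (deg3 p)) (sym (cong₂ (λ b e → 𝟙 b - e) (setOf-∈ p) (δ-≢ i≢y)))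
    go (no ¬p) (yes refl) = trans (cong (λ d → + d - + 2) deg1) (sym (cong₂ (λ b e → 𝟙 b - e) (setOf-false {V = r ∷ s ∷ t ∷ []} ¬p) (δ-refl i)))
    go (no ¬p) (no i≢y) = trans (cong (λ d → + d - + 2) (deg2 ¬p i≢y)) (sym (cong₂ (λ b e → 𝟙 b - e) (setOf-false {V = r ∷ s ∷ t ∷ []} ¬p) (δ-≢ i≢y)))

  ∑-excess : (f : Fin n → ℤ) → ∑ (λ i → excess H i * f i) ≡ f r + f s + f t - f y
  ∑-excess f = trans (∑-cong (λ i → trans (cong (_* f i) (excess≡ i)) (alg (𝟙 (setOf (r ∷ s ∷ t ∷ []) i)) (δ i y) (f i))))
    (trans (∑-sub (λ i → 𝟙 (setOf (r ∷ s ∷ t ∷ []) i) * f i) (λ i → δ i y * f i))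
      (trans (cong₂ _-_ (∑-setOf f (r ∷ s ∷ t ∷ []) distinct) (∑-δʳ y f)) (alg₂ (f r) (f s) (f t) (f y))))
    where
    alg : ∀ p q x → (p - q) * x ≡ p * x - q * x
    alg = solve-∀
    alg₂ : ∀ a b c d → a + (b + (c + + 0)) - d ≡ a + b + c - d
    alg₂ = solve-∀

  deg-≤3 : ∀ v → deg H v ℕ.≤ 3
  deg-≤3 v with v ∈? (r ∷ s ∷ t ∷ []) | v ≟ y
  ... | yes p | _ = ℕP.≤-reflexive (deg3 p)
  ... | no _ | yes refl = subst (ℕ._≤ 3) (sym deg1) (s≤s z≤n)
  ... | no ¬p | no v≢y = subst (ℕ._≤ 3) (sym (deg2 ¬p v≢y)) (s≤s (s≤s z≤n))

  deg≥3⇒∈ : ∀ {v} → 3 ℕ.≤ deg H v → v ∈ r ∷ s ∷ t ∷ []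
  deg≥3⇒∈ {v} h with v ∈? (r ∷ s ∷ t ∷ []) | v ≟ y
  ... | yes p | _ = p
  ... | no _ | yes refl with subst (3 ℕ.≤_) deg1 h
  ...   | s≤s ()
  deg≥3⇒∈ {v} h | no ¬p | no v≢y with subst (3 ℕ.≤_) (deg2 ¬p v≢y) h
  ...   | s≤s (s≤s ())

  twoNbrs⇒≢y : ∀ {v a b} → a ≢ b → adj H v a ≡ true → adj H v b ≡ true → v ≢ y
  twoNbrs⇒≢y {v} {a} {b} a≢b va vb refl with ℤP.drop‿+≤+ (subst (+ 2 ≤_) (trans (sym (deg≡∑ H v)) (cong +_ deg1))
      (length-⊆ (a ∷ b ∷ []) (adj H v) ((a≢b ∷ []) ∷ [] ∷ []) (λ { (here refl) → va ; (there (here refl)) → vb })))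
  ... | s≤s ()

  nbrs⇒y≢ : ∀ {v a b xs} → Nbrs H v (a ∷ b ∷ xs) → y ≢ v
  nbrs⇒y≢ N e = twoNbrs⇒≢y (≢₁₂ (uniq N)) (adj-of N (here refl)) (adj-of N (there (here refl))) (sym e)

  -- There are only three vertices of degree three, so any three of them may take the roles `r`,
  -- `s`, `t`. The trace identities then apply to the names that come with a configuration; the leaf
  -- stays the same.
  rechoose : (i j k : Fin n) → Unique (i ∷ j ∷ k ∷ []) → (∀ {v} → v ∈ i ∷ j ∷ k ∷ [] → 3 ℕ.≤ deg H v) → Mate H
  rechoose i j k u h = record { r = i ; s = j ; t = k ; y = y ; distinct = u
    ; deg3 = λ p → ℕP.≤-antisym (deg-≤3 _) (h p) ; deg1 = deg1 ; deg2 = λ {v} v∉ v≢y → deg2 (λ p → v∉ (only p)) v≢y }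
    where
    only : ∀ {v} → v ∈ r ∷ s ∷ t ∷ [] → v ∈ i ∷ j ∷ k ∷ []
    only {v} p with v ∈? (i ∷ j ∷ k ∷ [])
    ... | yes q = q
    ... | no ¬q with escape (v ∷ i ∷ j ∷ k ∷ []) (r ∷ s ∷ t ∷ []) (¬q ∷ᵁ u) distinct (s≤s (s≤s (s≤s (s≤s z≤n))))
    ...   | w , here refl , w∉ = ⊥-elim (w∉ p)
    ...   | w , there w∈ , w∉ = ⊥-elim (w∉ (deg≥3⇒∈ (h w∈)))

  aw≡ : ∀ i → H.aw i ≡ A H i r + A H i s + A H i t - A H i y
  aw≡ i = trans (∑-cong (λ k → ℤP.*-comm (A H i k) (excess H k))) (∑-excess (A H i))

  d≡deg : ∀ i {k} → deg H i ≡ k → H.d i ≡ + k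
  d≡deg i e = trans (sym (deg≡∑ H i)) (cong +_ e)

  w≡deg : ∀ i {k} → deg H i ≡ k → excess H i ≡ + k - + 2
  w≡deg i e = cong (λ d → + d - + 2) e

does-true : {P : Set} (p? : Dec P) → does p? ≡ true → P
does-true (yes p) _ = p
does-true (no _) ()

-- The nonnegative numbers (deg - 2)(deg - 1) sum to 4 + 2 = 6. They are 0, 0, 2, 6 for degrees 1 to
-- 4 and at least 12 beyond. So either one vertex of degree four uses up the total, or exactly three
-- vertices have degree three; the sum of deg - 2 then settles the number of leaves.
dichotomy : (H : Graph n) → (∀ v → 1 ℕ.≤ deg H v) → ∑ (excess H) ≡ + 2 → ∑ (λ i → excess H i * excess H i) ≡ + 4 →
  (Σ (Fin n) λ v → deg H v ≡ 4 × (∀ w → ¬ (w ≡ v) → deg H w ≡ 2)) ⊎ Mate H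
dichotomy {n} H pos ∑w ∑w² = by-max (FinP.any? (λ v → 4 ℕP.≤? deg H v))
  where
  w : Fin n → ℤ
  w = excess H
  f : Fin n → ℤ
  f i = w i * (w i + + 1)
  value : ∀ i → Σ ℕ λ k → deg H i ≡ suc k
  value i with deg H i | pos i
  ... | suc k | _ = k , refl
  0≤f : ∀ i → + 0 ≤ f i
  0≤f i with value i
  ... | zero , e = subst (λ d → + 0 ≤ (+ d - + 2) * (+ d - + 2 + + 1)) (sym e) ℤP.≤-refl
  ... | suc k , e = subst (λ d → + 0 ≤ (+ d - + 2) * (+ d - + 2 + + 1)) (sym e) (0≤* {+ k} {+ k + + 1} (ℤ.+≤+ z≤n) (ℤ.+≤+ z≤n))
  ∑f : ∑ f ≡ + 6
  ∑f = trans (∑-cong (λ i → alg (w i))) (trans (∑-add (λ i → w i * w i) w) (cong₂ _+_ ∑w² ∑w))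
    where
    alg : ∀ x → x * (x + + 1) ≡ x * x + x
    alg = solve-∀
  by-max : Dec (Σ (Fin n) λ v → 4 ℕ.≤ deg H v) → (Σ (Fin n) λ v → deg H v ≡ 4 × (∀ w → ¬ (w ≡ v) → deg H w ≡ 2)) ⊎ Mate H
  by-max (yes (v , big)) = inj₁ (v , proj₁ dv , others)
    where
    f-of : ∀ i {k} → deg H i ≡ suc (suc k) → f i ≡ + (k ℕ.* suc k)
    f-of i {k} e = trans (cong (λ d → (+ d - + 2) * (+ d - + 2 + + 1)) e)
      (trans (cong (λ z → + k * z) (trans (sym (ℤP.pos-+ k 1)) (cong +_ (ℕP.+-comm k 1)))) (sym (ℤP.pos-* k (suc k))))
    single : f v ≤ + 6
    single = subst (f v ≤_) ∑f (∑-≥ f 0≤f v)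
    dv : deg H v ≡ 4 × f v ≡ + 6
    dv = exact (deg H v) refl big
      where
      exact : ∀ d → deg H v ≡ d → 4 ℕ.≤ d → deg H v ≡ 4 × f v ≡ + 6
      exact (suc (suc (suc (suc zero)))) e _ = e , f-of v e
      exact (suc (suc (suc (suc (suc k))))) e _ =
        ⊥-elim (ℕP.<⇒≱ {6} {12} (ℕP.m≤m+n 7 5) (ℕP.≤-trans le12 (ℤP.drop‿+≤+ (subst (_≤ + 6) (f-of v e) single))))
        where
        le12 : 12 ℕ.≤ (3 ℕ.+ k) ℕ.* suc (3 ℕ.+ k)
        le12 = ℕP.*-mono-≤ (ℕP.m≤m+n 3 k) (ℕP.m≤m+n 4 k)
      exact zero e ()
      exact (suc zero) e (s≤s ())
      exact (suc (suc zero)) e (s≤s (s≤s ()))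
      exact (suc (suc (suc zero))) e (s≤s (s≤s (s≤s ())))
    small : ∀ i → i ≢ v → deg H i ℕ.≤ 2
    small i i≢v with value i
    ... | zero , e = subst (ℕ._≤ 2) (sym e) (s≤s z≤n)
    ... | suc zero , e = ℕP.≤-reflexive e
    ... | suc (suc k) , e = ⊥-elim (absurd (ℤP.≤-trans (ℤP.+-monoʳ-≤ (f v) 1≤fi) pair))
      where
      pair : f v + f i ≤ + 6
      pair = subst₂ _≤_ (cong (λ z → f v + z) (ℤP.+-identityʳ (f i))) ∑f (∑-≥-list f (v ∷ i ∷ []) ((≢-sym i≢v ∷ []) ∷ [] ∷ []) 0≤f)
      1≤fi : + 1 ≤ f i
      1≤fi = subst (+ 1 ≤_) (sym (f-of i e)) (ℤ.+≤+ (s≤s z≤n))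
      absurd : ¬ (f v + + 1 ≤ + 6)
      absurd p with subst (λ z → z + + 1 ≤ + 6) (proj₂ dv) p
      ... | ℤ.+≤+ q = ℕP.<⇒≱ (ℕP.n<1+n 6) q
    -- With every other degree at most two, `h` is nonnegative, and its sum is 2 - 2 = 0; hence no
    -- other vertex has degree one.
    h : Fin n → ℤ
    h i = δ i v * + 2 - w i
    h≡0 : ∀ i → h i ≡ + 0
    h≡0 = ∑-≡0 h h≥0 (trans (∑-sub (λ i → δ i v * + 2) w) (cong₂ _-_ (∑-δʳ v (λ _ → + 2)) ∑w))
      where
      h≥0 : ∀ i → + 0 ≤ h i
      h≥0 i = go (i ≟ v)
        where
        go : Dec (i ≡ v) → + 0 ≤ h i
        go (yes refl) = ℤP.≤-reflexive (sym (trans (cong₂ (λ e d → e * + 2 - (+ d - + 2)) (δ-refl i) (proj₁ dv)) refl))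
        go (no i≢v) = subst (+ 0 ≤_) (sym (cong (λ e → e * + 2 - w i) (δ-≢ i≢v))) (le (deg H i) (small i i≢v))
          where
          le : ∀ d → d ℕ.≤ 2 → + 0 ≤ + 0 * + 2 - (+ d - + 2)
          le zero _ = ℤ.+≤+ z≤n
          le (suc zero) _ = ℤ.+≤+ z≤n
          le (suc (suc zero)) _ = ℤ.+≤+ z≤n
          le (suc (suc (suc d))) (s≤s (s≤s ()))
    others : ∀ i → ¬ (i ≡ v) → deg H i ≡ 2
    others i i≢v = ℤP.+-injective (ℤP.i-j≡0⇒i≡j (+ deg H i) (+ 2) (trans (sym (alg (w i))) (cong -_ (trans (sym (cong (λ e → e * + 2 - w i) (δ-≢ i≢v))) (h≡0 i)))))
      where
      alg : ∀ x → - (+ 0 * + 2 - x) ≡ x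
      alg = solve-∀
  by-max (no ¬big) = inj₂ (from-lists (Support.list S₃) (Support.uniqˢ S₃) (λ p → sound₃ (Support.sound S₃ p)) (λ j → Support.member S₃ j) count₃
                                 (Support.list S₁) (λ p → sound₁ (Support.sound S₁ p)) (λ j → Support.member S₁ j) count₁)
    where
    is : ℕ → Fin n → Bool
    is k i = does (deg H i ℕP.≟ k)
    sound-is : ∀ k {i} → is k i ≡ true → deg H i ≡ k
    sound-is k {i} e = does-true (deg H i ℕP.≟ k) e
    S₃ = support (is 3)
    S₁ = support (is 1)
    sound₃ : ∀ {i} → is 3 i ≡ true → deg H i ≡ 3
    sound₃ = sound-is 3
    sound₁ : ∀ {i} → is 1 i ≡ true → deg H i ≡ 1
    sound₁ = sound-is 1
    range : ∀ i → deg H i ≡ 1 ⊎ (deg H i ≡ 2 ⊎ deg H i ≡ 3)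
    range i with value i
    ... | zero , e = inj₁ e
    ... | suc zero , e = inj₂ (inj₁ e)
    ... | suc (suc zero) , e = inj₂ (inj₂ e)
    ... | suc (suc (suc k)) , e = ⊥-elim (¬big (i , subst (4 ℕ.≤_) (sym e) (s≤s (s≤s (s≤s (s≤s z≤n))))))
    f≡ : ∀ i → f i ≡ + 2 * 𝟙 (is 3 i)
    f≡ i = go (range i)
      where
      at : ∀ {k} → deg H i ≡ k → (+ k - + 2) * (+ k - + 2 + + 1) ≡ + 2 * 𝟙 (does (k ℕP.≟ 3)) → f i ≡ + 2 * 𝟙 (is 3 i)
      at e q = trans (cong (λ d → (+ d - + 2) * (+ d - + 2 + + 1)) e) (trans q (cong (λ d → + 2 * 𝟙 (does (d ℕP.≟ 3))) (sym e)))
      go : deg H i ≡ 1 ⊎ (deg H i ≡ 2 ⊎ deg H i ≡ 3) → f i ≡ + 2 * 𝟙 (is 3 i)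
      go (inj₁ e) = at e refl
      go (inj₂ (inj₁ e)) = at e refl
      go (inj₂ (inj₂ e)) = at e refl
    w≡ : ∀ i → w i ≡ 𝟙 (is 3 i) - 𝟙 (is 1 i)
    w≡ i = go (range i)
      where
      at : ∀ {k} → deg H i ≡ k → + k - + 2 ≡ 𝟙 (does (k ℕP.≟ 3)) - 𝟙 (does (k ℕP.≟ 1)) → w i ≡ 𝟙 (is 3 i) - 𝟙 (is 1 i)
      at e q = trans (cong (λ d → + d - + 2) e) (trans q (cong (λ d → 𝟙 (does (d ℕP.≟ 3)) - 𝟙 (does (d ℕP.≟ 1))) (sym e)))
      go : deg H i ≡ 1 ⊎ (deg H i ≡ 2 ⊎ deg H i ≡ 3) → w i ≡ 𝟙 (is 3 i) - 𝟙 (is 1 i)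
      go (inj₁ e) = at e refl
      go (inj₂ (inj₁ e)) = at e refl
      go (inj₂ (inj₂ e)) = at e refl
    ∑₃ : ∑ (λ i → 𝟙 (is 3 i)) ≡ + 3
    ∑₃ = ℤP.*-cancelˡ-≡ (+ 2) _ (+ 3) (trans (sym (∑-scale (+ 2) (λ i → 𝟙 (is 3 i)))) (trans (∑-cong (λ i → sym (f≡ i))) ∑f))
    ∑₁ : ∑ (λ i → 𝟙 (is 1 i)) ≡ + 1
    ∑₁ = trans (alg (∑ (λ i → 𝟙 (is 3 i))) (∑ (λ i → 𝟙 (is 1 i))))
      (cong₂ _-_ ∑₃ (trans (sym (trans (∑-cong w≡) (∑-sub (λ i → 𝟙 (is 3 i)) (λ i → 𝟙 (is 1 i))))) ∑w))
      where
      alg : ∀ x y → y ≡ x - (x - y)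
      alg = solve-∀
    count₃ : length (Support.list S₃) ≡ 3
    count₃ = ℤP.+-injective (trans (sym (Support.count S₃)) ∑₃)
    count₁ : length (Support.list S₁) ≡ 1
    count₁ = ℤP.+-injective (trans (sym (Support.count S₁)) ∑₁)
    from-lists : (xs : List (Fin n)) → Unique xs → (∀ {i} → i ∈ xs → deg H i ≡ 3) → (∀ i → is 3 i ≡ setOf xs i) → length xs ≡ 3 →
      (ys : List (Fin n)) → (∀ {i} → i ∈ ys → deg H i ≡ 1) → (∀ i → is 1 i ≡ setOf ys i) → length ys ≡ 1 → Mate H
    from-lists (r ∷ s ∷ t ∷ []) u d3 m3 _ (y ∷ []) d1 m1 _ =
      record { r = r ; s = s ; t = t ; y = y ; distinct = u ; deg3 = d3 ; deg1 = d1 (here refl) ; deg2 = two }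
      where
      two : ∀ {v} → v ∉ r ∷ s ∷ t ∷ [] → v ≢ y → deg H v ≡ 2
      two {v} v∉ v≢y with range v
      ... | inj₂ (inj₁ e) = e
      ... | inj₂ (inj₂ e) = ⊥-elim (v∉ (setOf-true (r ∷ s ∷ t ∷ []) (trans (sym (m3 v)) (dec-true (deg H v ℕP.≟ 3) e))))
      ... | inj₁ e with setOf-true (y ∷ []) (trans (sym (m1 v)) (dec-true (deg H v ℕP.≟ 1) e))
      ...   | here p = ⊥-elim (v≢y p)
    from-lists [] _ _ _ () _ _ _ _
    from-lists (_ ∷ []) _ _ _ () _ _ _ _
    from-lists (_ ∷ _ ∷ []) _ _ _ () _ _ _ _
    from-lists (_ ∷ _ ∷ _ ∷ _ ∷ _) _ _ _ () _ _ _ _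
    from-lists (_ ∷ _ ∷ _ ∷ []) _ _ _ _ [] _ _ ()
    from-lists (_ ∷ _ ∷ _ ∷ []) _ _ _ _ (_ ∷ _ ∷ _) _ _ ()

-- Comparing the traces of a rose and of its mate

module Cospectral (G H : Graph (suc n)) (same : SamePolys H G) (P : Rose G) where
  open Invariants H G same
  private
    module G = T G
    module H = T H
    module P = RoseFacts P

  ∑w≡2 : ∑ (excess H) ≡ + 2
  ∑w≡2 = trans (sym H.tr-Q) (trans tr¹ (trans G.tr-Q (trans (∑-cong (λ i → sym (ℤP.*-identityʳ (excess G i)))) (P.∑-excess (λ _ → + 1)))))

  private
    ∑-w²+d : (K : Graph (suc n)) → ∑ (excess K) ≡ + 2 → ∑ (λ i → excess K i * excess K i + T.d K i) ≡ ∑ (λ i → excess K i * excess K i) + (+ 2 + + suc n * + 2)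
    ∑-w²+d K e = trans (∑-add (λ i → excess K i * excess K i) (T.d K)) (cong (λ z → ∑ (λ i → excess K i * excess K i) + z)
      (trans (∑-cong (d≡ K)) (trans (∑-add (excess K) (λ _ → + 2)) (cong₂ _+_ e (∑-const (suc n) (+ 2))))))
    ∑wG : ∑ (excess G) ≡ + 2
    ∑wG = trans (∑-cong (λ i → sym (ℤP.*-identityʳ (excess G i)))) (P.∑-excess (λ _ → + 1))
    ∑wG² : ∑ (λ i → excess G i * excess G i) ≡ + 4
    ∑wG² = trans (P.∑-excess (excess G)) (cong (+ 2 *_) P.excess-c)

    +-cancelʳ : ∀ x a b → a + x ≡ b + x → a ≡ b
    +-cancelʳ x a b e = +-cancelˡ x a b (trans (ℤP.+-comm x a) (trans e (ℤP.+-comm b x)))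

  ∑w²≡4 : ∑ (λ i → excess H i * excess H i) ≡ + 4
  ∑w²≡4 = trans (+-cancelʳ (+ 2 + + suc n * + 2) _ _
    (trans (sym (∑-w²+d H ∑w≡2)) (trans (sym H.tr-Q²) (trans tr² (trans G.tr-Q² (∑-w²+d G ∑wG)))))) ∑wG²

  private
    base : Graph (suc n) → ℤ
    base K = ∑ (λ i → T.d K i * T.d K i + T.d K i + T.aw K i)

    -- Closed 4-walks that do not run around a 4-cycle are counted through degrees, since the sum of
    -- `aw` is the sum of d (d - 2). Their total is therefore the same in both graphs and cancels in
    -- `squares`.
    base≡ : (K : Graph (suc n)) → ∑ (excess K) ≡ + 2 → ∑ (λ i → excess K i * excess K i) ≡ + 4 → base K ≡ + 2 * + 4 + + 7 * + 2 + + suc n * + 6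
    base≡ K e e² =
      trans (∑-add (λ i → T.d K i * T.d K i + T.d K i) (T.aw K))
        (trans (cong (λ z → ∑ (λ i → T.d K i * T.d K i + T.d K i) + z) ∑aw)
          (trans (sym (∑-add (λ i → T.d K i * T.d K i + T.d K i) (λ k → T.d K k * excess K k)))
            (trans (∑-cong (λ i → trans (cong (λ d → d * d + d + d * excess K i) (d≡ K i)) (alg (excess K i))))
              (trans (∑-add (λ i → + 2 * (excess K i * excess K i) + + 7 * excess K i) (λ _ → + 6))
                (cong₂ _+_ (trans (∑-lin (+ 2) (+ 7) (λ i → excess K i * excess K i) (excess K)) (cong₂ (λ x y → + 2 * x + + 7 * y) e² e)) (∑-const (suc n) (+ 6)))))))
      where
      alg : ∀ w → (w + + 2) * (w + + 2) + (w + + 2) + (w + + 2) * w ≡ + 2 * (w * w) + + 7 * w + + 6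
      alg = solve-∀
      ∑aw : ∑ (T.aw K) ≡ ∑ (λ k → T.d K k * excess K k)
      ∑aw = trans (∑-comm (λ i k → A K i k * excess K k)) (∑-cong (λ k → trans (∑-scaleʳ (excess K k) (λ i → A K i k)) (cong (_* excess K k) (∑-cong (λ i → A-sym K i k)))))

    ∑r≡ : (K : Graph (suc n)) → ∑ (T.r K) ≡ ∑ (T.κ K) + base K
    ∑r≡ K = trans (∑-cong (λ i → trans (T.r≡κ K (d≡ K) i) (alg (T.κ K i) (T.d K i * T.d K i) (T.d K i) (T.aw K i))))
      (∑-add (T.κ K) (λ i → T.d K i * T.d K i + T.d K i + T.aw K i))
      where
      alg : ∀ k x d q → k + x + d + q ≡ k + (x + d + q)
      alg = solve-∀

  module WithMate (M : Mate H) where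
    open MateFacts M
    private
      w3 : ∀ {v} → v ∈ r ∷ s ∷ t ∷ [] → excess H v ≡ + 1
      w3 {v} p = w≡deg v (deg3 p)
      d3 : ∀ {v} → v ∈ r ∷ s ∷ t ∷ [] → H.d v ≡ + 3
      d3 {v} p = d≡deg v (deg3 p)
      wy : excess H y ≡ - + 1
      wy = w≡deg y deg1
      dy : H.d y ≡ + 1
      dy = d≡deg y deg1
      r∈ : r ∈ r ∷ s ∷ t ∷ []
      r∈ = here refl
      s∈ : s ∈ r ∷ s ∷ t ∷ []
      s∈ = there (here refl)
      t∈ : t ∈ r ∷ s ∷ t ∷ []
      t∈ = there (there (here refl))

      by-values : (f : Fin (suc n) → ℤ) {p q u v : ℤ} → f r ≡ p → f s ≡ q → f t ≡ u → f y ≡ v → ∑ (λ i → excess H i * f i) ≡ p + q + u - v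
      by-values f refl refl refl refl = ∑-excess f

    -- From tr Q³: the weighted part is 2 (4 + 12) = 32 at the centre of the rose, and 3 · 10 - 4 =
    -- 26 at the four special vertices of the mate.
    triangles : + 3 * G.t P.c ≡ H.trA³ + + 6
    triangles = lemma H.trA³ (+ 3 * G.t P.c)
      (trans (cong (_- H.trA³) (sym (by-values (λ i → excess H i * excess H i + + 3 * H.d i) (at r∈) (at s∈) (at t∈) (cong₂ (λ x d → x * x + + 3 * d) wy dy))))
        (trans (sym H.tr-Q³) (trans tr³ (trans G.tr-Q³
          (cong₂ _-_ (trans (P.∑-excess (λ i → excess G i * excess G i + + 3 * G.d i)) (cong₂ (λ x d → + 2 * (x * x + + 3 * d)) P.excess-c P.d-c)) P.trA³≡)))))
      where
      at : ∀ {v} → v ∈ r ∷ s ∷ t ∷ [] → excess H v * excess H v + + 3 * H.d v ≡ + 10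
      at p = cong₂ (λ x d → x * x + + 3 * d) (w3 p) (d3 p)
      lemma : ∀ x y → + 10 + + 10 + + 10 - + 4 - x ≡ + 32 - y → y ≡ x + + 6
      lemma x y e = trans (alg₁ y) (trans (cong (λ z → + 32 - z) (sym e)) (alg₂ x))
        where
        alg₁ : ∀ y → y ≡ + 32 - (+ 32 - y)
        alg₁ = solve-∀
        alg₂ : ∀ x → + 32 - (+ 26 - x) ≡ x + + 6
        alg₂ = solve-∀

    module OneTriangle (tc : G.t P.c ≡ + 2) (free : H.trA³ ≡ + 0) where
      private
        t0 : ∀ i → H.t i ≡ + 0
        t0 i = ∑-zero (a·c≡0 H free i)
        acw0 : ∀ i → H.acw i ≡ + 0
        acw0 i = ∑-zero (λ k → trans (alg (A H i k) (excess H k) (H.c i k)) (trans (cong (_* excess H k) (a·c≡0 H free i k)) refl))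
          where
          alg : ∀ x w y → x * w * y ≡ x * y * w
          alg = solve-∀
        rκ : ∀ i → H.r i ≡ H.κ i + H.d i * H.d i + H.d i + H.aw i
        rκ = H.r≡κ (d≡ H)

      -- From tr Q⁴: the constants are 2 · 32 = 64 for the rose and 3 · 13 + 5 = 44 for the mate,
      -- where no triangle term remains.
      squares : + 2 * (H.aw r + H.aw s + H.aw t - H.aw y) + ∑ H.κ ≡ + 20 + ∑ G.κ
      squares = lemma (H.aw r) (H.aw s) (H.aw t) (H.aw y) (∑ H.κ) (∑ G.κ) (+ 2 * + 4 + + 7 * + 2 + + suc n * + 6)
        (trans (sym sideH) (trans (sym H.tr-Q⁴) (trans tr⁴ (trans G.tr-Q⁴ sideG))))
        where
        Y : (K : Graph (suc n)) → Fin (suc n) → ℤ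
        Y K i = excess K i * excess K i * excess K i + + 4 * (excess K i * T.d K i) + + 2 * T.aw K i - + 4 * T.t K i
        eval : ∀ {w d t q w₀ d₀ t₀} → w ≡ w₀ → d ≡ d₀ → t ≡ t₀ → w * w * w + + 4 * (w * d) + + 2 * q - + 4 * t ≡ w₀ * w₀ * w₀ + + 4 * (w₀ * d₀) + + 2 * q - + 4 * t₀
        eval refl refl refl = refl
        alg₃ : ∀ q → + 1 * + 1 * + 1 + + 4 * (+ 1 * + 3) + + 2 * q - + 4 * + 0 ≡ + 13 + + 2 * q
        alg₃ = solve-∀
        alg₁ : ∀ q → - + 1 * - + 1 * - + 1 + + 4 * (- + 1 * + 1) + + 2 * q - + 4 * + 0 ≡ - + 5 + + 2 * q
        alg₁ = solve-∀
        at : ∀ {v} → v ∈ r ∷ s ∷ t ∷ [] → Y H v ≡ + 13 + + 2 * H.aw v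
        at {v} p = trans (eval {q = H.aw v} (w3 p) (d3 p) (t0 v)) (alg₃ (H.aw v))
        sideH : ∑ (λ i → excess H i * Y H i + H.r i) ≡ (+ 13 + + 2 * H.aw r) + (+ 13 + + 2 * H.aw s) + (+ 13 + + 2 * H.aw t) - (- + 5 + + 2 * H.aw y) + (∑ H.κ + (+ 2 * + 4 + + 7 * + 2 + + suc n * + 6))
        sideH = trans (∑-add (λ i → excess H i * Y H i) H.r)
          (cong₂ _+_ (by-values (Y H) (at r∈) (at s∈) (at t∈) (trans (eval {q = H.aw y} wy dy (t0 y)) (alg₁ (H.aw y))))
                     (trans (∑r≡ H) (cong (λ z → ∑ H.κ + z) (base≡ H ∑w≡2 ∑w²≡4))))
        sideG : ∑ (λ i → excess G i * Y G i + G.r i) ≡ + 64 + (∑ G.κ + (+ 2 * + 4 + + 7 * + 2 + + suc n * + 6))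
        sideG = trans (∑-add (λ i → excess G i * Y G i) G.r)
          (cong₂ _+_ (trans (P.∑-excess (Y G)) (cong (+ 2 *_) (trans (eval {q = G.aw P.c} P.excess-c P.d-c tc) (cong (λ q → + 2 * + 2 * + 2 + + 4 * (+ 2 * + 4) + + 2 * q - + 4 * + 2) P.aw-c))))
                     (trans (∑r≡ G) (cong (λ z → ∑ G.κ + z) (base≡ G ∑wG ∑wG²))))
        lemma : ∀ a b c d k k′ e → (+ 13 + + 2 * a) + (+ 13 + + 2 * b) + (+ 13 + + 2 * c) - (- + 5 + + 2 * d) + (k + e) ≡ + 64 + (k′ + e) →
          + 2 * (a + b + c - d) + k ≡ + 20 + k′
        lemma a b c d k k′ e eq = trans (alg a b c d k e) (trans (cong (λ z → z - + 44 - e) eq) (alg′ k′ e))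
          where
          alg : ∀ a b c d k e → + 2 * (a + b + c - d) + k ≡ (+ 13 + + 2 * a) + (+ 13 + + 2 * b) + (+ 13 + + 2 * c) - (- + 5 + + 2 * d) + (k + e) - + 44 - e
          alg = solve-∀
          alg′ : ∀ k e → + 64 + (k + e) - + 44 - e ≡ + 20 + k
          alg′ = solve-∀

      -- From tr Q⁵: the constants are 2 · 176 = 352 for the rose and 3 · 76 - 16 = 212 for the
      -- mate. At the leaf the contributions of `aw` cancel.
      pentagons : + 5 * (H.κ r + H.κ s + H.κ t) ≡ + 140 + + 10 * G.κ P.c - G.trA⁵ - + 10 * (H.aw r + H.aw s + H.aw t) + + 5 * H.κ y + H.trA⁵
      pentagons = lemma (H.aw r) (H.aw s) (H.aw t) (H.κ r) (H.κ s) (H.κ t) (H.κ y) H.trA⁵ (G.κ P.c) G.trA⁵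
        (trans (cong (_- H.trA⁵) (sym (by-values (X H) (at r∈) (at s∈) (at t∈) (trans (eval {q = H.aw y} {k = H.κ y} wy dy (t0 y) (acw0 y) (rκ y)) (alg₁ (H.aw y) (H.κ y))))))
          (trans (sym H.tr-Q⁵) (trans tr⁵ (trans G.tr-Q⁵ (cong (_- G.trA⁵)
            (trans (P.∑-excess (X G)) (cong (+ 2 *_) (trans (eval {q = G.aw P.c} {k = G.κ P.c} P.excess-c P.d-c tc P.acw-c (G.r≡κ (d≡ G) P.c))
              (trans (cong (λ q → poly (+ 2) (+ 4) q (+ 2) (+ 0) (G.κ P.c + + 4 * + 4 + + 4 + q)) P.aw-c) (algG (G.κ P.c)))))))))))
        where
        poly : (w d q t p ρ : ℤ) → ℤ
        poly w d q t p ρ = w * w * w * w + + 5 * (w * w * d) + + 5 * (w * q) - + 5 * (w * t) - + 5 * p + + 5 * ρ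
        X : (K : Graph (suc n)) → Fin (suc n) → ℤ
        X K i = poly (excess K i) (T.d K i) (T.aw K i) (T.t K i) (T.acw K i) (T.r K i)
        eval : ∀ {w d q t p ρ k w₀ d₀ t₀ p₀} → w ≡ w₀ → d ≡ d₀ → t ≡ t₀ → p ≡ p₀ → ρ ≡ k + d * d + d + q →
          poly w d q t p ρ ≡ poly w₀ d₀ q t₀ p₀ (k + d₀ * d₀ + d₀ + q)
        eval refl refl refl refl refl = refl
        alg₃ : ∀ q k → + 1 * + 1 * + 1 * + 1 + + 5 * (+ 1 * + 1 * + 3) + + 5 * (+ 1 * q) - + 5 * (+ 1 * + 0) - + 5 * + 0 + + 5 * (k + + 3 * + 3 + + 3 + q) ≡ + 76 + + 10 * q + + 5 * k
        alg₃ = solve-∀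
        alg₁ : ∀ q k → - + 1 * - + 1 * - + 1 * - + 1 + + 5 * (- + 1 * - + 1 * + 1) + + 5 * (- + 1 * q) - + 5 * (- + 1 * + 0) - + 5 * + 0 + + 5 * (k + + 1 * + 1 + + 1 + q) ≡ + 16 + + 5 * k
        alg₁ = solve-∀
        algG : ∀ k → + 2 * + 2 * + 2 * + 2 + + 5 * (+ 2 * + 2 * + 4) + + 5 * (+ 2 * + 0) - + 5 * (+ 2 * + 2) - + 5 * + 0 + + 5 * (k + + 4 * + 4 + + 4 + + 0) ≡ + 176 + + 5 * k
        algG = solve-∀
        at : ∀ {v} → v ∈ r ∷ s ∷ t ∷ [] → X H v ≡ + 76 + + 10 * H.aw v + + 5 * H.κ v
        at {v} p = trans (eval {q = H.aw v} {k = H.κ v} (w3 p) (d3 p) (t0 v) (acw0 v) (rκ v)) (alg₃ (H.aw v) (H.κ v))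
        lemma : ∀ a b c x y z u p k g →
          (+ 76 + + 10 * a + + 5 * x) + (+ 76 + + 10 * b + + 5 * y) + (+ 76 + + 10 * c + + 5 * z) - (+ 16 + + 5 * u) - p ≡ + 2 * (+ 176 + + 5 * k) - g →
          + 5 * (x + y + z) ≡ + 140 + + 10 * k - g - + 10 * (a + b + c) + + 5 * u + p
        lemma a b c x y z u p k g e = trans (alg a b c x y z u p) (trans (cong (λ q → q - + 212 - + 10 * (a + b + c) + + 5 * u + p) e) (alg′ a b c u p k g))
          where
          alg : ∀ a b c x y z u p → + 5 * (x + y + z) ≡
            (+ 76 + + 10 * a + + 5 * x) + (+ 76 + + 10 * b + + 5 * y) + (+ 76 + + 10 * c + + 5 * z) - (+ 16 + + 5 * u) - p - + 212 - + 10 * (a + b + c) + + 5 * u + p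
          alg = solve-∀
          alg′ : ∀ a b c u p k g → + 2 * (+ 176 + + 5 * k) - g - + 212 - + 10 * (a + b + c) + + 5 * u + p ≡ + 140 + + 10 * k - g - + 10 * (a + b + c) + + 5 * u + p
          alg′ = solve-∀

      -- Without triangles there are at most two edges among `r`, `s`, `t`, so their `aw` total at
      -- most 4. Then `pentagons` makes five times the sum of the three `κ` at least 140 - 60 - 40 =
      -- 40, and a sum of 8 exceeds 3 · 2. Since `κ` counts each 4-cycle twice, the value 3 already
      -- means two 4-cycles.
      rich : G.trA⁵ ≤ + 60 → Σ (Fin (suc n)) λ v → 3 ℕ.≤ deg H v × + 3 ≤ H.κ v
      rich bound = pick (ℤP._≤?_ (+ 3) (H.κ r)) (ℤP._≤?_ (+ 3) (H.κ s)) (ℤP._≤?_ (+ 3) (H.κ t))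
        where
        few-edges : ∀ p q o → (p ≡ true → q ≡ true → o ≡ true → ⊥) → + 0 ≤ + 2 - (𝟙 p + 𝟙 q + 𝟙 o)
        few-edges true  true  true  h = ⊥-elim (h refl refl refl)
        few-edges true  true  false h = ℤ.+≤+ z≤n
        few-edges true  false true  h = ℤ.+≤+ z≤n
        few-edges true  false false h = ℤ.+≤+ z≤n
        few-edges false true  true  h = ℤ.+≤+ z≤n
        few-edges false true  false h = ℤ.+≤+ z≤n
        few-edges false false true  h = ℤ.+≤+ z≤n
        few-edges false false false h = ℤ.+≤+ z≤n
        edges : + 0 ≤ + 4 - (H.aw r + H.aw s + H.aw t)
        edges = subst (+ 0 ≤_) (sym (trans (cong (λ z → + 4 - z) (cong₂ _+_ (cong₂ _+_ (aw≡ r) (aw≡ s)) (aw≡ t)))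
            (trans (cong₂ (λ { (p , q , o) (e , f , g) → + 4 - (e + A H r s + A H r t - A H r y + (p + f + A H s t - A H s y) + (q + o + g - A H t y)) })
                      (cong₂ _,_ (A-sym H s r) (cong₂ _,_ (A-sym H t r) (A-sym H t s)))
                      (cong₂ _,_ (A-diag H r) (cong₂ _,_ (A-diag H s) (A-diag H t))))
              (alg (A H r s) (A H r t) (A H s t) (A H r y) (A H s y) (A H t y)))))
          (0≤+ (0≤* {+ 2} (ℤ.+≤+ z≤n) (few-edges (adj H r s) (adj H r t) (adj H s t) (λ p q o → triangleFree H free p o q)))
               (0≤+ (0≤+ (0≤𝟙 (adj H r y)) (0≤𝟙 (adj H s y))) (0≤𝟙 (adj H t y))))
          where
          alg : ∀ x y z a b c → + 4 - (+ 0 + x + y - a + (x + + 0 + z - b) + (y + z + + 0 - c)) ≡ + 2 * (+ 2 - (x + y + z)) + (a + b + c)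
          alg = solve-∀
        nonneg : + 0 ≤ + 5 * (H.κ r + H.κ s + H.κ t) - + 40
        nonneg = subst (+ 0 ≤_) (sym (trans (cong (_- + 40) pentagons) (alg (G.κ P.c) G.trA⁵ (H.aw r + H.aw s + H.aw t) (H.κ y) H.trA⁵)))
          (0≤+ (0≤+ (0≤+ (0≤+ (0≤* {+ 10} (ℤ.+≤+ z≤n) (0≤κ G P.c)) (ℤP.i≤j⇒0≤j-i bound)) (0≤* {+ 10} (ℤ.+≤+ z≤n) edges)) (0≤* {+ 5} (ℤ.+≤+ z≤n) (0≤κ H y))) (0≤trA⁵ H))
          where
          alg : ∀ k g e u p → + 140 + + 10 * k - g - + 10 * e + + 5 * u + p - + 40 ≡ + 10 * k + (+ 60 - g) + + 10 * (+ 4 - e) + + 5 * u + p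
          alg = solve-∀
        at-most-2 : ∀ {x} → ¬ (+ 3 ≤ x) → + 0 ≤ + 2 - x
        at-most-2 {x} h = ℤP.i≤j⇒0≤j-i (ℤP.i<j⇒i≤pred[j] (ℤP.≰⇒> h))
        pick : Dec (+ 3 ≤ H.κ r) → Dec (+ 3 ≤ H.κ s) → Dec (+ 3 ≤ H.κ t) → Σ (Fin (suc n)) λ v → 3 ℕ.≤ deg H v × + 3 ≤ H.κ v
        pick (yes p) _ _ = r , ℕP.≤-reflexive (sym (deg3 r∈)) , p
        pick _ (yes p) _ = s , ℕP.≤-reflexive (sym (deg3 s∈)) , p
        pick _ _ (yes p) = t , ℕP.≤-reflexive (sym (deg3 t∈)) , p
        -- If each `κ` were at most 2, then 5 · 6 - 40 = -10 would be nonnegative.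
        pick (no p) (no q) (no o) = ⊥-elim (absurd (subst (+ 0 ≤_) (alg (H.κ r) (H.κ s) (H.κ t))
            (0≤+ nonneg (0≤* {+ 5} (ℤ.+≤+ z≤n) (0≤+ (0≤+ (at-most-2 p) (at-most-2 q)) (at-most-2 o))))))
          where
          alg : ∀ x y z → + 5 * (x + y + z) - + 40 + + 5 * ((+ 2 - x) + (+ 2 - y) + (+ 2 - z)) ≡ - + 10
          alg = solve-∀
          absurd : ¬ (+ 0 ≤ - + 10)
          absurd ()

-- K₂₃ and the 2 × 3 grid

nbrs-reorder : (G : Graph n) {v : Fin n} {xs : List (Fin n)} (ys : List (Fin n)) → Nbrs G v xs → Unique ys → (∀ {u} → u ∈ ys → u ∈ xs) → length xs ≡ length ys → Nbrs G v ys
nbrs-reorder G {v} ys N u sub e = nbrs-from G v ys u (λ p → adj-of N (sub p)) (ℕP.≤-reflexive (trans (sym (nbrs-deg G N)) e))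

-- The lists at the hubs `i` and `j` are complete: a vertex of degree three has no room for another
-- neighbour.
record K₂₃ (H : Graph n) : Set where
  field
    i j x₁ x₂ x₃ : Fin n
    i≢j : i ≢ j
    Nᵢ  : Nbrs H i (x₁ ∷ x₂ ∷ x₃ ∷ [])
    Nⱼ  : Nbrs H j (x₁ ∷ x₂ ∷ x₃ ∷ [])

-- `u v` is the middle rung of the grid, `x j` and `z l` are the outer ones; the long sides are x u
-- z and j v l.
record Domino (H : Graph n) : Set where
  field
    u v x z j l : Fin n
    Nᵤ  : Nbrs H u (v ∷ x ∷ z ∷ [])
    Nᵥ  : Nbrs H v (u ∷ j ∷ l ∷ [])
    x~j : adj H x j ≡ true
    z~l : adj H z l ≡ true

-- The pendant vertex hangs at `x₁`, a vertex of the side of three. This is the mate of R(3,4).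
record K₂₃-Leaf (H : Graph n) : Set where
  field
    i j x₁ x₂ x₃ o : Fin n
    unique : Unique (i ∷ j ∷ x₁ ∷ x₂ ∷ x₃ ∷ o ∷ [])
    all    : ∀ v → v ∈ i ∷ j ∷ x₁ ∷ x₂ ∷ x₃ ∷ o ∷ []
    Nᵢ : Nbrs H i (x₁ ∷ x₂ ∷ x₃ ∷ [])
    Nⱼ : Nbrs H j (x₁ ∷ x₂ ∷ x₃ ∷ [])
    N₁ : Nbrs H x₁ (i ∷ j ∷ o ∷ [])
    N₂ : Nbrs H x₂ (i ∷ j ∷ [])
    N₃ : Nbrs H x₃ (i ∷ j ∷ [])
    Nₒ : Nbrs H o (x₁ ∷ [])

-- The 2 × 3 grid with a pendant vertex o at a corner.
record Domino-Leaf (H : Graph n) : Set where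
  field
    u v x z j l o : Fin n
    unique : Unique (u ∷ v ∷ x ∷ z ∷ j ∷ l ∷ o ∷ [])
    all    : ∀ w → w ∈ u ∷ v ∷ x ∷ z ∷ j ∷ l ∷ o ∷ []
    Nᵤ : Nbrs H u (v ∷ x ∷ z ∷ [])
    Nᵥ : Nbrs H v (u ∷ j ∷ l ∷ [])
    Nₓ : Nbrs H x (u ∷ j ∷ o ∷ [])
    N_z : Nbrs H z (u ∷ l ∷ [])
    Nⱼ : Nbrs H j (v ∷ x ∷ [])
    Nₗ : Nbrs H l (v ∷ z ∷ [])
    Nₒ : Nbrs H o (x ∷ [])

private
  at-pair : (ps : List (Fin n × Fin m)) {u : Fin n} {v : Fin m} → At (map proj₁ ps) (map proj₂ ps) u v → (u , v) ∈ ps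
  at-pair (p ∷ ps) at-here = here refl
  at-pair (p ∷ ps) (at-there q) = there (at-pair ps q)

  pair-at : (ps : List (Fin n × Fin m)) {p : Fin n × Fin m} → p ∈ ps → At (map proj₁ ps) (map proj₂ ps) (proj₁ p) (proj₂ p)
  pair-at (p ∷ ps) (here refl) = at-here
  pair-at (p ∷ ps) (there q) = at-there (pair-at ps q)

  pairs-≅ : (G : Graph n) (H : Graph m) (ps : List (Fin n × Fin m)) → Unique (map proj₁ ps) → Unique (map proj₂ ps) →
    (∀ u → u ∈ map proj₁ ps) → (∀ v → v ∈ map proj₂ ps) → All (λ p → NbrMatch {G = G} {H} (λ u v → (u , v) ∈ ps) (proj₁ p) (proj₂ p)) ps → G ≅ H
  pairs-≅ G H ps uu uv allu allv match = correspondence⇒≅ G H {R = λ u v → (u , v) ∈ ps} record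
    { to = λ u → let v , p = at-to (map proj₂ ps) lengths (allu u) in v , at-pair ps p
    ; from = λ v → let u , p = at-from (map proj₁ ps) lengths (allv v) in u , at-pair ps p
    ; functional = λ p q → at-functional uu (pair-at ps p) (pair-at ps q) ; injective = λ p q → at-injective uv (pair-at ps p) (pair-at ps q)
    ; matches = λ p → All.lookup match p }
    where
    lengths : length (map proj₁ ps) ≡ length (map proj₂ ps)
    lengths = trans (ListP.length-map proj₁ ps) (sym (ListP.length-map proj₂ ps))

K₂₃-Leaf-≅ : {G : Graph n} {H : Graph m} → K₂₃-Leaf G → K₂₃-Leaf H → G ≅ H
K₂₃-Leaf-≅ {n} {m} {G} {H} K L = pairs-≅ G H ps (unique K) (unique L) (all K) (all L)
    ((q₁ ∷ q₂ ∷ q₃ ∷ [] , Nᵢ K , Nᵢ L , p₁ ∷ p₂ ∷ p₃ ∷ []) ∷ (q₁ ∷ q₂ ∷ q₃ ∷ [] , Nⱼ K , Nⱼ L , p₁ ∷ p₂ ∷ p₃ ∷ [])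
      ∷ (qᵢ ∷ qⱼ ∷ qₒ ∷ [] , N₁ K , N₁ L , pᵢ ∷ pⱼ ∷ pₒ ∷ []) ∷ (qᵢ ∷ qⱼ ∷ [] , N₂ K , N₂ L , pᵢ ∷ pⱼ ∷ [])
      ∷ (qᵢ ∷ qⱼ ∷ [] , N₃ K , N₃ L , pᵢ ∷ pⱼ ∷ []) ∷ (q₁ ∷ [] , Nₒ K , Nₒ L , p₁ ∷ []) ∷ [])
  where
  open K₂₃-Leaf
  qᵢ qⱼ q₁ q₂ q₃ qₒ : Fin n × Fin m
  qᵢ = i K , i L
  qⱼ = j K , j L
  q₁ = x₁ K , x₁ L
  q₂ = x₂ K , x₂ L
  q₃ = x₃ K , x₃ L
  qₒ = o K , o L
  ps : List (Fin n × Fin m)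
  ps = qᵢ ∷ qⱼ ∷ q₁ ∷ q₂ ∷ q₃ ∷ qₒ ∷ []
  pᵢ : qᵢ ∈ ps
  pᵢ = here refl
  pⱼ : qⱼ ∈ ps
  pⱼ = there (here refl)
  p₁ : q₁ ∈ ps
  p₁ = there (there (here refl))
  p₂ : q₂ ∈ ps
  p₂ = there (there (there (here refl)))
  p₃ : q₃ ∈ ps
  p₃ = there (there (there (there (here refl))))
  pₒ : qₒ ∈ ps
  pₒ = there (there (there (there (there (here refl)))))

Domino-Leaf-≅ : {G : Graph n} {H : Graph m} → Domino-Leaf G → Domino-Leaf H → G ≅ H
Domino-Leaf-≅ {n} {m} {G} {H} K L = pairs-≅ G H ps (unique K) (unique L) (all K) (all L)
    ((qᵥ ∷ qₓ ∷ q_z ∷ [] , Nᵤ K , Nᵤ L , pᵥ ∷ pₓ ∷ p_z ∷ []) ∷ (qᵤ ∷ qⱼ ∷ qₗ ∷ [] , Nᵥ K , Nᵥ L , pᵤ ∷ pⱼ ∷ pₗ ∷ [])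
      ∷ (qᵤ ∷ qⱼ ∷ qₒ ∷ [] , Nₓ K , Nₓ L , pᵤ ∷ pⱼ ∷ pₒ ∷ []) ∷ (qᵤ ∷ qₗ ∷ [] , N_z K , N_z L , pᵤ ∷ pₗ ∷ [])
      ∷ (qᵥ ∷ qₓ ∷ [] , Nⱼ K , Nⱼ L , pᵥ ∷ pₓ ∷ []) ∷ (qᵥ ∷ q_z ∷ [] , Nₗ K , Nₗ L , pᵥ ∷ p_z ∷ []) ∷ (qₓ ∷ [] , Nₒ K , Nₒ L , pₓ ∷ []) ∷ [])
  where
  open Domino-Leaf
  qᵤ qᵥ qₓ q_z qⱼ qₗ qₒ : Fin n × Fin m
  qᵤ = u K , u L
  qᵥ = v K , v L
  qₓ = x K , x L
  q_z = z K , z L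
  qⱼ = j K , j L
  qₗ = l K , l L
  qₒ = o K , o L
  ps : List (Fin n × Fin m)
  ps = qᵤ ∷ qᵥ ∷ qₓ ∷ q_z ∷ qⱼ ∷ qₗ ∷ qₒ ∷ []
  pᵤ : qᵤ ∈ ps
  pᵤ = here refl
  pᵥ : qᵥ ∈ ps
  pᵥ = there (here refl)
  pₓ : qₓ ∈ ps
  pₓ = there (there (here refl))
  p_z : q_z ∈ ps
  p_z = there (there (there (here refl)))
  pⱼ : qⱼ ∈ ps
  pⱼ = there (there (there (there (here refl))))
  pₗ : qₗ ∈ ps
  pₗ = there (there (there (there (there (here refl)))))
  pₒ : qₒ ∈ ps
  pₒ = there (there (there (there (there (there (here refl))))))

module Classify {H : Graph n} (conn : Connected H) (free : TriangleFree H) (M : Mate H) where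
  open MateFacts M
  private
    _~_ : Fin n → Fin n → Set
    a ~ b = adj H a b ≡ true

    three : ∀ {v a b c} → Unique (a ∷ b ∷ c ∷ []) → v ~ a → v ~ b → v ~ c → Nbrs H v (a ∷ b ∷ c ∷ [])
    three {v} u p q o = nbrs-from H v _ u (λ { (here refl) → p ; (there (here refl)) → q ; (there (there (here refl))) → o }) (deg-≤3 v)

    uniq₃ : ∀ {a b c : Fin n} → a ≢ b → a ≢ c → b ≢ c → Unique (a ∷ b ∷ c ∷ [])
    uniq₃ p q o = (p ∷ q ∷ []) ∷ (o ∷ []) ∷ [] ∷ []

    shared : ∀ v k → ℕ
    shared v k = length (Common.list (common H v k))

    term≡ : ∀ {v k} → v ≢ k → κ-term H v k ≡ + (shared v k ℕ.* (shared v k ℕ.∸ 1))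
    term≡ {v} {k} v≢k = trans (κ-term-off H v≢k) (trans (cong (λ x → x * (x - + 1)) (Common.count (common H v k))) (falling (shared v k)))

    small-term : ∀ m → ¬ (2 ℕ.≤ m) → m ℕ.* (m ℕ.∸ 1) ≡ 0
    small-term zero _ = refl
    small-term (suc zero) _ = refl
    small-term (suc (suc m)) h = ⊥-elim (h (s≤s (s≤s z≤n)))

    from-triple : ∀ {v k} (xs : List (Fin n)) → Unique xs → (∀ {a} → a ∈ xs → v ~ a × a ~ k) → v ≢ k → 3 ℕ.≤ length xs → K₂₃ H
    from-triple {v} {k} (a ∷ b ∷ c ∷ _) ((p ∷ q ∷ _) ∷ (o ∷ _) ∷ _) both v≢k _ = record
      { i = v ; j = k ; x₁ = a ; x₂ = b ; x₃ = c ; i≢j = v≢k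
      ; Nᵢ = three (uniq₃ p q o) (proj₁ (both (here refl))) (proj₁ (both (there (here refl)))) (proj₁ (both (there (there (here refl)))))
      ; Nⱼ = three (uniq₃ p q o) (edge-sym H (proj₂ (both (here refl)))) (edge-sym H (proj₂ (both (there (here refl))))) (edge-sym H (proj₂ (both (there (there (here refl)))))) }
    from-triple [] _ _ _ ()
    from-triple (_ ∷ []) _ _ _ (s≤s ())
    from-triple (_ ∷ _ ∷ []) _ _ _ (s≤s (s≤s ()))

    -- As `v` has at most three neighbours, its two pairs of common neighbours meet. If they
    -- coincide, their members are the hubs of a K₂₃ on v, k, k′; if they share just one vertex, the
    -- edge from `v` to it is the middle rung of a grid.
    from-pairs : ∀ {v k k′} → v ≢ k → v ≢ k′ → k ≢ k′ → (xs : List (Fin n)) → Unique xs → (∀ {a} → a ∈ xs → v ~ a × a ~ k) → 2 ℕ.≤ length xs →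
      (zs : List (Fin n)) → Unique zs → (∀ {a} → a ∈ zs → v ~ a × a ~ k′) → 2 ℕ.≤ length zs → K₂₃ H ⊎ Domino H
    from-pairs {v} {k} {k′} v≢k v≢k′ k≢k′ (a ∷ b ∷ _) ((a≢b ∷ _) ∷ _) bx _ (c ∷ d ∷ _) ((c≢d ∷ _) ∷ _) bz _ = go (c ≟ a) (c ≟ b) (d ≟ a) (d ≟ b)
      where
      va = proj₁ (bx (here refl))
      ak = proj₂ (bx (here refl))
      vb = proj₁ (bx (there (here refl)))
      bk = proj₂ (bx (there (here refl)))
      vc = proj₁ (bz (here refl))
      ck = proj₂ (bz (here refl))
      vd = proj₁ (bz (there (here refl)))
      dk = proj₂ (bz (there (here refl)))
      hubs : a ~ k′ → b ~ k′ → K₂₃ H ⊎ Domino H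
      hubs ak′ bk′ = inj₁ record { i = a ; j = b ; x₁ = v ; x₂ = k ; x₃ = k′ ; i≢j = a≢b
        ; Nᵢ = three (uniq₃ v≢k v≢k′ k≢k′) (edge-sym H va) ak ak′ ; Nⱼ = three (uniq₃ v≢k v≢k′ k≢k′) (edge-sym H vb) bk bk′ }
      grid : ∀ {e p q} → v ~ e → e ~ k → e ~ k′ → v ~ p → p ~ k → v ~ q → q ~ k′ → e ≢ p → e ≢ q → p ≢ q → K₂₃ H ⊎ Domino H
      grid {e} {p} {q} ve ek ek′ vp pk vq qk e≢p e≢q p≢q = inj₂ record { u = v ; v = e ; x = p ; z = q ; j = k ; l = k′
        ; Nᵤ = three (uniq₃ e≢p e≢q p≢q) ve vp vq ; Nᵥ = three (uniq₃ v≢k v≢k′ k≢k′) (edge-sym H ve) ek ek′ ; x~j = pk ; z~l = qk }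
      go : Dec (c ≡ a) → Dec (c ≡ b) → Dec (d ≡ a) → Dec (d ≡ b) → K₂₃ H ⊎ Domino H
      go (yes refl) _ _ (yes refl) = hubs ck dk
      go _ (yes refl) (yes refl) _ = hubs dk ck
      go (yes refl) _ _ (no d≢b) = grid va ak ck vb bk vd dk a≢b c≢d (≢-sym d≢b)
      go _ (yes refl) (no d≢a) _ = grid vb bk ck va ak vd dk (≢-sym a≢b) c≢d (≢-sym d≢a)
      go (no c≢a) (no c≢b) (yes refl) _ = grid va ak dk vb bk vc ck a≢b (≢-sym c≢d) (≢-sym c≢b)
      go (no c≢a) (no c≢b) _ (yes refl) = grid vb bk dk va ak vc ck (≢-sym a≢b) (≢-sym c≢d) (≢-sym c≢a)
      go (no c≢a) (no c≢b) (no d≢a) (no d≢b) with of-adj (three (uniq₃ a≢b (≢-sym c≢a) (≢-sym c≢b)) va vb vc) vd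
      ... | here e = ⊥-elim (d≢a e)
      ... | there (here e) = ⊥-elim (d≢b e)
      ... | there (there (here e)) = ⊥-elim (c≢d (sym e))
    from-pairs _ _ _ [] _ _ () _ _ _ _
    from-pairs _ _ _ (_ ∷ []) _ _ (s≤s ()) _ _ _ _
    from-pairs _ _ _ (_ ∷ _ ∷ _) _ _ _ [] _ _ ()
    from-pairs _ _ _ (_ ∷ _ ∷ _) _ _ _ (_ ∷ []) _ _ (s≤s ())

  -- Opposite vertices with fewer than two common neighbours contribute nothing to `κ`, and a single
  -- one with exactly two contributes only 2. So there is one with three, or there are two.
  find : ∀ v → + 3 ≤ T.κ H v → K₂₃ H ⊎ Domino H
  find v rich = triple (FinP.any? λ k → ¬? (v ≟ k) ×-dec (3 ℕP.≤? shared v k))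
    where
    C : ∀ k → Common H v k
    C = common H v
    triple : Dec (Σ (Fin n) λ k → v ≢ k × 3 ℕ.≤ shared v k) → K₂₃ H ⊎ Domino H
    triple (yes (k , v≢k , p)) = inj₁ (from-triple (Common.list (C k)) (Common.uniqᶜ (C k)) (Common.both (C k)) v≢k p)
    triple (no none₃) = first (FinP.any? λ k → ¬? (v ≟ k) ×-dec (2 ℕP.≤? shared v k))
      where
      first : Dec (Σ (Fin n) λ k → v ≢ k × 2 ℕ.≤ shared v k) → K₂₃ H ⊎ Domino H
      first (no none₂) = ⊥-elim (absurd (subst (+ 3 ≤_) (∑-zero zero-term) rich))
        where
        absurd : ¬ (+ 3 ≤ + 0)
        absurd (ℤ.+≤+ ())
        zero-term : ∀ k → κ-term H v k ≡ + 0
        zero-term k = go (v ≟ k)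
          where
          go : Dec (v ≡ k) → κ-term H v k ≡ + 0
          go (yes refl) = κ-term-diag H v
          go (no v≢k) = trans (term≡ v≢k) (cong +_ (small-term (shared v k) (λ p → none₂ (k , v≢k , p))))
      first (yes (k , v≢k , p)) = second (FinP.any? λ k′ → ¬? (v ≟ k′) ×-dec (¬? (k ≟ k′) ×-dec (2 ℕP.≤? shared v k′)))
        where
        second : Dec (Σ (Fin n) λ k′ → v ≢ k′ × k ≢ k′ × 2 ℕ.≤ shared v k′) → K₂₃ H ⊎ Domino H
        second (yes (k′ , v≢k′ , k≢k′ , q)) = from-pairs v≢k v≢k′ k≢k′
          (Common.list (C k)) (Common.uniqᶜ (C k)) (Common.both (C k)) p (Common.list (C k′)) (Common.uniqᶜ (C k′)) (Common.both (C k′)) q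
        second (no none) = ⊥-elim (two-max (shared v k) (λ q → none₃ (k , v≢k , q))
            (ℤP.drop‿+≤+ (subst (+ 3 ≤_) (trans (∑-single k zero-term) (term≡ v≢k)) rich)))
          where
          two-max : ∀ m → ¬ (3 ℕ.≤ m) → ¬ (3 ℕ.≤ m ℕ.* (m ℕ.∸ 1))
          two-max zero _ ()
          two-max (suc zero) _ ()
          two-max (suc (suc zero)) _ (s≤s (s≤s ()))
          two-max (suc (suc (suc m))) h _ = h (s≤s (s≤s (s≤s z≤n)))
          zero-term : ∀ k′ → k′ ≢ k → κ-term H v k′ ≡ + 0
          zero-term k′ k′≢k = go (v ≟ k′)
            where
            go : Dec (v ≡ k′) → κ-term H v k′ ≡ + 0
            go (yes refl) = κ-term-diag H v
            go (no v≢k′) = trans (term≡ v≢k′) (cong +_ (small-term (shared v k′) (λ q → none (k′ , v≢k′ , ≢-sym k′≢k , q))))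

  private
    degree-three : ∀ {v a b c} → Nbrs H v (a ∷ b ∷ c ∷ []) → 3 ℕ.≤ deg H v
    degree-three N = ℕP.≤-reflexive (nbrs-deg H N)

    two : ∀ {v a b} → deg H v ℕ.≤ 2 → a ≢ b → v ~ a → v ~ b → Nbrs H v (a ∷ b ∷ [])
    two {v} le a≢b p q = nbrs-from H v _ ((a≢b ∷ []) ∷ [] ∷ []) (λ { (here refl) → p ; (there (here refl)) → q }) le

    third : ∀ v a b → a ≢ b → v ~ a → v ~ b → 3 ℕ.≤ deg H v → Σ (Fin n) λ o → Nbrs H v (a ∷ b ∷ o ∷ [])
    third v a b a≢b va vb d with neighbours H v
    ... | xs , N with escape xs (a ∷ b ∷ []) (uniq N) ((a≢b ∷ []) ∷ [] ∷ []) (ℕP.≤-trans d (ℕP.≤-reflexive (sym (nbrs-deg H N))))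
    ... | o , o∈ , o∉ = o , three (uniq₃ a≢b (λ e → o∉ (here (sym e))) (λ e → o∉ (there (here (sym e))))) va vb (adj-of N o∈)

    pairTerm : ∀ {v k a b} → v ≢ k → a ≢ b → v ~ a → a ~ k → v ~ b → b ~ k → + 2 ≤ κ-term H v k
    pairTerm {v} {k} {a} {b} v≢k a≢b va ak vb bk = subst (+ 2 ≤_) (sym (κ-term-off H v≢k))
      (falling-≥ 2 (c≥ H v k (a ∷ b ∷ []) ((a≢b ∷ []) ∷ [] ∷ []) (λ { (here refl) → va , ak ; (there (here refl)) → vb , bk })))

    κ≥ : ∀ v xs → Unique xs → sumOver (κ-term H v) xs ≤ T.κ H v
    κ≥ v xs u = ∑-≥-list (κ-term H v) xs u (0≤κ-term H v)

    one : ∀ v k {p} → p ≤ κ-term H v k → p ≤ T.κ H v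
    one v k {p} h = ℤP.≤-trans h (∑-≥ (κ-term H v) (0≤κ-term H v) k)

    both : ∀ v {k k′} → k ≢ k′ → + 2 ≤ κ-term H v k → + 2 ≤ κ-term H v k′ → + 4 ≤ T.κ H v
    both v {k} {k′} k≢k′ p q = ℤP.≤-trans (ℤP.+-mono-≤ p (ℤP.+-mono-≤ q ℤP.≤-refl)) (κ≥ v (k ∷ k′ ∷ []) ((k≢k′ ∷ []) ∷ [] ∷ []))

  -- The value of tr Q⁴ forced by a cospectral rose with one triangle and no 4-cycle.
  SquareCount : Set
  SquareCount = (M : Mate H) →
    + 2 * (T.aw H (Mate.r M) + T.aw H (Mate.s M) + T.aw H (Mate.t M) - T.aw H (Mate.y M)) + ∑ (T.κ H) ≡ + 20

  private
    -- The three `aw` add up to twice the number of edges among `i`, `j`, `k`, minus the possible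
    -- edge from `k` to the leaf; `aw y` takes that edge away once more. With the factor 2 this
    -- gives 4 (edges - b), to which the 4-cycles are added.
    crowded : SquareCount → (i j k : Fin n) (u : Unique (i ∷ j ∷ k ∷ [])) → (∀ {v} → v ∈ i ∷ j ∷ k ∷ [] → 3 ℕ.≤ deg H v) →
      ∀ e → + e ≤ A H i j + A H i k + A H j k → ¬ (adj H i y ≡ true) → ¬ (adj H j y ≡ true) → ∀ b → A H k y ≤ b → ∀ q → + q ≤ ∑ (T.κ H) →
      + 4 * (+ e - b) + + q ≤ + 20
    crowded sq i j k u d e edges iy jy b ky q κs = subst (+ 4 * (+ e - b) + + q ≤_) (trans (cong (_+ ∑ (T.κ H)) (sym total)) (sq M′))
        (ℤP.+-mono-≤ (ℤP.*-monoˡ-≤-nonNeg (+ 4) (ℤP.+-mono-≤ edges (ℤP.neg-mono-≤ ky))) κs)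
      where
      M′ = rechoose i j k u d
      module M′ = MateFacts M′
      alg : ∀ a b c f → + 2 * ((+ 0 + a + b - + 0) + (a + + 0 + c - + 0) + (b + c + + 0 - f) - (+ 0 + + 0 + f - + 0)) ≡ + 4 * (a + b + c - f)
      alg = solve-∀
      row : ∀ v {p q o f} → A H v i ≡ p → A H v j ≡ q → A H v k ≡ o → A H v y ≡ f → T.aw H v ≡ p + q + o - f
      row v refl refl refl refl = M′.aw≡ v
      iy0 : A H i y ≡ + 0
      iy0 = A-nonadj H iy
      jy0 : A H j y ≡ + 0
      jy0 = A-nonadj H jy
      total : + 2 * (T.aw H i + T.aw H j + T.aw H k - T.aw H y) ≡ + 4 * (A H i j + A H i k + A H j k - A H k y)
      total = trans (cong₂ (λ p q → + 2 * (p - q))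
          (cong₂ _+_ (cong₂ _+_ (row i (A-diag H i) refl refl iy0) (row j (A-sym H j i) (A-diag H j) refl jy0)) (row k (A-sym H k i) (A-sym H k j) (A-diag H k) refl))
          (row y (trans (A-sym H y i) iy0) (trans (A-sym H y j) jy0) (A-sym H y k) (A-diag H y)))
        (alg (A H i j) (A H i k) (A H j k) (A H k y))

    A≤1 : ∀ a b → A H a b ≤ + 1
    A≤1 a b with adj H a b
    ... | true  = ℤP.≤-refl
    ... | false = ℤ.+≤+ z≤n

    absurd : ∀ {a b} → b ℕ.< a → ¬ (+ a ≤ + b)
    absurd b<a (ℤ.+≤+ a≤b) = ℕP.<⇒≱ b<a a≤b

  module FromK₂₃ (sq : 7 ℕ.≤ n → SquareCount) where
    private
      -- The third vertex of degree three is x₁.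
      finish : (K : K₂₃ H) → 3 ℕ.≤ deg H (K₂₃.x₁ K) → K₂₃-Leaf H
      finish K d₁ = record { i = i ; j = j ; x₁ = x₁ ; x₂ = x₂ ; x₃ = x₃ ; o = o ; unique = U ; all = complete
        ; Nᵢ = Nᵢ ; Nⱼ = Nⱼ ; N₁ = N₁ ; N₂ = N₂ ; N₃ = N₃ ; Nₒ = Nₒ }
        where
        open K₂₃ K
        ix₁ = adj-of Nᵢ (here refl)
        ix₂ = adj-of Nᵢ (there (here refl))
        ix₃ = adj-of Nᵢ (there (there (here refl)))
        jx₁ = adj-of Nⱼ (here refl)
        jx₂ = adj-of Nⱼ (there (here refl))
        jx₃ = adj-of Nⱼ (there (there (here refl)))
        x₁≢x₂ : x₁ ≢ x₂
        x₁≢x₂ = ≢₁₂ (uniq Nᵢ)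
        x₁≢x₃ : x₁ ≢ x₃
        x₁≢x₃ = ≢₁₃ (uniq Nᵢ)
        x₂≢x₃ : x₂ ≢ x₃
        x₂≢x₃ = ≢₂₃ (uniq Nᵢ)
        ox = third x₁ i j i≢j (edge-sym H ix₁) (edge-sym H jx₁) d₁
        o = proj₁ ox
        N₁ = proj₂ ox
        x₁o : x₁ ~ o
        x₁o = adj-of N₁ (there (there (here refl)))
        i≢o : i ≢ o
        i≢o = ≢₁₃ (uniq N₁)
        j≢o : j ≢ o
        j≢o = ≢₂₃ (uniq N₁)
        -- An edge from `i` to `o` would close a triangle with `x₁`.
        ix≢ : ∀ {a} → i ~ a → a ≢ o
        ix≢ ia refl = free ix₁ x₁o ia
        U₃ : Unique (i ∷ j ∷ x₁ ∷ [])
        U₃ = uniq₃ i≢j (edge-≢ H ix₁) (edge-≢ H jx₁)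
        D₃ : ∀ {v} → v ∈ i ∷ j ∷ x₁ ∷ [] → 3 ℕ.≤ deg H v
        D₃ (here refl) = degree-three Nᵢ
        D₃ (there (here refl)) = degree-three Nⱼ
        D₃ (there (there (here refl))) = d₁
        module M′ = MateFacts (rechoose i j x₁ U₃ D₃)
        low : ∀ {v} → v ∉ i ∷ j ∷ x₁ ∷ [] → v ≢ y → deg H v ℕ.≤ 2
        low v∉ v≢y = ℕP.≤-reflexive (M′.deg2 v∉ v≢y)
        x₂≢y : x₂ ≢ y
        x₂≢y = twoNbrs⇒≢y i≢j (edge-sym H ix₂) (edge-sym H jx₂)
        x₃≢y : x₃ ≢ y
        x₃≢y = twoNbrs⇒≢y i≢j (edge-sym H ix₃) (edge-sym H jx₃)
        N₂ : Nbrs H x₂ (i ∷ j ∷ [])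
        N₂ = two (low (λ { (here e) → edge-≢ H ix₂ (sym e) ; (there (here e)) → edge-≢ H jx₂ (sym e) ; (there (there (here e))) → x₁≢x₂ (sym e) }) x₂≢y) i≢j (edge-sym H ix₂) (edge-sym H jx₂)
        N₃ : Nbrs H x₃ (i ∷ j ∷ [])
        N₃ = two (low (λ { (here e) → edge-≢ H ix₃ (sym e) ; (there (here e)) → edge-≢ H jx₃ (sym e) ; (there (there (here e))) → x₁≢x₃ (sym e) }) x₃≢y) i≢j (edge-sym H ix₃) (edge-sym H jx₃)
        V = i ∷ j ∷ x₁ ∷ x₂ ∷ x₃ ∷ o ∷ []
        U : Unique V
        U = (i≢j ∷ edge-≢ H ix₁ ∷ edge-≢ H ix₂ ∷ edge-≢ H ix₃ ∷ i≢o ∷ []) ∷ (edge-≢ H jx₁ ∷ edge-≢ H jx₂ ∷ edge-≢ H jx₃ ∷ j≢o ∷ [])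
          ∷ (x₁≢x₂ ∷ x₁≢x₃ ∷ edge-≢ H x₁o ∷ []) ∷ (x₂≢x₃ ∷ ix≢ ix₂ ∷ []) ∷ (ix≢ ix₃ ∷ []) ∷ [] ∷ []
        i≢y : i ≢ y
        i≢y = twoNbrs⇒≢y x₁≢x₂ ix₁ ix₂
        j≢y : j ≢ y
        j≢y = twoNbrs⇒≢y x₁≢x₂ jx₁ jx₂
        x₁≢y : x₁ ≢ y
        x₁≢y = twoNbrs⇒≢y i≢j (edge-sym H ix₁) (edge-sym H jx₁)
        hub≁y : ∀ {h} → Nbrs H h (x₁ ∷ x₂ ∷ x₃ ∷ []) → ¬ (h ~ y)
        hub≁y N e with of-adj N e
        ... | here p = x₁≢y (sym p)
        ... | there (here p) = x₂≢y (sym p)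
        ... | there (there (here p)) = x₃≢y (sym p)
        pt : ∀ {a b} → i ~ a → i ~ b → j ~ a → j ~ b → a ≢ b → + 2 ≤ κ-term H a b
        pt ia ib ja jb a≢b = pairTerm a≢b i≢j (edge-sym H ia) ib (edge-sym H ja) jb
        hub-term : ∀ {h h′} → h ≢ h′ → Nbrs H h (x₁ ∷ x₂ ∷ x₃ ∷ []) → Nbrs H h′ (x₁ ∷ x₂ ∷ x₃ ∷ []) → + 6 ≤ T.κ H h
        hub-term {h} {h′} h≢ N N′ = one h h′ (subst (+ 6 ≤_) (sym (κ-term-off H h≢))
          (falling-≥ 3 (c≥ H h h′ (x₁ ∷ x₂ ∷ x₃ ∷ []) (uniq N) (λ p → adj-of N p , edge-sym H (adj-of N′ p)))))
        -- K₂₃ has three 4-cycles; each hub lies on all of them, each of the other vertices on two: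
        -- 6 + 6 + 4 + 4 + 4.
        κs : + 24 ≤ ∑ (T.κ H)
        κs = ℤP.≤-trans (ℤP.+-mono-≤ (hub-term i≢j Nᵢ Nⱼ) (ℤP.+-mono-≤ (hub-term (≢-sym i≢j) Nⱼ Nᵢ)
               (ℤP.+-mono-≤ (both x₁ x₂≢x₃ (pt ix₁ ix₂ jx₁ jx₂ x₁≢x₂) (pt ix₁ ix₃ jx₁ jx₃ x₁≢x₃))
               (ℤP.+-mono-≤ (both x₂ x₁≢x₃ (pt ix₂ ix₁ jx₂ jx₁ (≢-sym x₁≢x₂)) (pt ix₂ ix₃ jx₂ jx₃ x₂≢x₃))
               (ℤP.+-mono-≤ (both x₃ x₁≢x₂ (pt ix₃ ix₁ jx₃ jx₁ (≢-sym x₁≢x₃)) (pt ix₃ ix₂ jx₃ jx₂ (≢-sym x₂≢x₃))) (ℤP.≤-refl {+ 0}))))))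
             (∑-≥-list (T.κ H) (i ∷ j ∷ x₁ ∷ x₂ ∷ x₃ ∷ []) U₅ (0≤κ H))
          where
          U₅ : Unique (i ∷ j ∷ x₁ ∷ x₂ ∷ x₃ ∷ [])
          U₅ = (i≢j ∷ edge-≢ H ix₁ ∷ edge-≢ H ix₂ ∷ edge-≢ H ix₃ ∷ []) ∷ (edge-≢ H jx₁ ∷ edge-≢ H jx₂ ∷ edge-≢ H jx₃ ∷ [])
            ∷ (x₁≢x₂ ∷ x₁≢x₃ ∷ []) ∷ (x₂≢x₃ ∷ []) ∷ [] ∷ []
        edges : + 2 ≤ A H i j + A H i x₁ + A H j x₁
        edges = subst₂ (λ p q → + 2 ≤ A H i j + p + q) (sym (A-adj H ix₁)) (sym (A-adj H jx₁)) (ℤP.+-mono-≤ (ℤP.+-mono-≤ (0≤𝟙 (adj H i j)) (ℤP.≤-refl {+ 1})) (ℤP.≤-refl {+ 1}))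
        n≡6 : length V ≡ n
        n≡6 with 7 ℕP.≤? n
        ... | no 7≰n = ℕP.≤-antisym (unique-length≤ V U) (ℕ.s≤s⁻¹ (ℕP.≰⇒> 7≰n))
        -- Even if `x₁` is adjacent to the leaf, 4 (2 - 1) + 24 = 28 exceeds 20.
        ... | yes 7≤n = ⊥-elim (absurd (ℕP.m≤m+n 21 7) (crowded (sq 7≤n) i j x₁ U₃ D₃ 2 edges (hub≁y Nᵢ) (hub≁y Nⱼ) (+ 1) (A≤1 x₁ y) 24 κs))
        complete : ∀ v → v ∈ V
        complete = full-complete V U n≡6
        o≡y : o ≡ y
        o≡y with complete y
        ... | here e = ⊥-elim (i≢y (sym e))
        ... | there (here e) = ⊥-elim (j≢y (sym e))
        ... | there (there (here e)) = ⊥-elim (x₁≢y (sym e))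
        ... | there (there (there (here e))) = ⊥-elim (x₂≢y (sym e))
        ... | there (there (there (there (here e)))) = ⊥-elim (x₃≢y (sym e))
        ... | there (there (there (there (there (here e))))) = sym e
        Nₒ : Nbrs H o (x₁ ∷ [])
        Nₒ = nbrs-from H o (x₁ ∷ []) ([] ∷ []) (λ { (here refl) → edge-sym H x₁o }) (ℕP.≤-reflexive (trans (cong (deg H) o≡y) deg1))

      swap₁₂ : K₂₃ H → K₂₃ H
      swap₁₂ K = record { i = i ; j = j ; x₁ = x₂ ; x₂ = x₁ ; x₃ = x₃ ; i≢j = i≢j ; Nᵢ = re Nᵢ ; Nⱼ = re Nⱼ }
        where
        open K₂₃ K
        re : ∀ {h} → Nbrs H h (x₁ ∷ x₂ ∷ x₃ ∷ []) → Nbrs H h (x₂ ∷ x₁ ∷ x₃ ∷ [])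
        re N with uniq N
        ... | (p ∷ q ∷ []) ∷ (o ∷ []) ∷ _ = nbrs-reorder H _ N (uniq₃ (≢-sym p) o q)
                (λ { (here e) → there (here e) ; (there (here e)) → here e ; (there (there e)) → there (there e) }) refl

      swap₁₃ : K₂₃ H → K₂₃ H
      swap₁₃ K = record { i = i ; j = j ; x₁ = x₃ ; x₂ = x₂ ; x₃ = x₁ ; i≢j = i≢j ; Nᵢ = re Nᵢ ; Nⱼ = re Nⱼ }
        where
        open K₂₃ K
        re : ∀ {h} → Nbrs H h (x₁ ∷ x₂ ∷ x₃ ∷ []) → Nbrs H h (x₃ ∷ x₂ ∷ x₁ ∷ [])
        re N with uniq N
        ... | (p ∷ q ∷ []) ∷ (o ∷ []) ∷ _ = nbrs-reorder H _ N (uniq₃ (≢-sym o) (≢-sym q) (≢-sym p))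
                (λ { (here e) → there (there (here e)) ; (there (here e)) → there (here e) ; (there (there (here e))) → here e }) refl

    fromK₂₃ : K₂₃ H → K₂₃-Leaf H
    fromK₂₃ K = go (3 ℕP.≤? deg H x₁) (3 ℕP.≤? deg H x₂) (3 ℕP.≤? deg H x₃)
      where
      open K₂₃ K
      go : Dec (3 ℕ.≤ deg H x₁) → Dec (3 ℕ.≤ deg H x₂) → Dec (3 ℕ.≤ deg H x₃) → K₂₃-Leaf H
      go (yes d) _ _ = finish K d
      go _ (yes d) _ = finish (swap₁₂ K) d
      go _ _ (yes d) = finish (swap₁₃ K) d
      -- With all three of degree two, K₂₃ would be a whole component, yet none of its vertices is
      -- the leaf `y`.
      go (no d₁) (no d₂) (no d₃) = ⊥-elim (All≢⇒∉ (nbrs⇒y≢ Nᵢ ∷ nbrs⇒y≢ Nⱼ ∷ nbrs⇒y≢ N₁ ∷ nbrs⇒y≢ N₂ ∷ nbrs⇒y≢ N₃ ∷ [])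
          (fenced-spread H conn V iᵢ ((_ , Nᵢ , i₁ ∷ i₂ ∷ i₃ ∷ []) ∷ (_ , Nⱼ , i₁ ∷ i₂ ∷ i₃ ∷ [])
            ∷ (_ , N₁ , iᵢ ∷ iⱼ ∷ []) ∷ (_ , N₂ , iᵢ ∷ iⱼ ∷ []) ∷ (_ , N₃ , iᵢ ∷ iⱼ ∷ []) ∷ []) y))
        where
        small : ∀ {x} → ¬ (3 ℕ.≤ deg H x) → i ~ x → j ~ x → Nbrs H x (i ∷ j ∷ [])
        small d ix jx = two (ℕ.s≤s⁻¹ (ℕP.≰⇒> d)) i≢j (edge-sym H ix) (edge-sym H jx)
        N₁ = small d₁ (adj-of Nᵢ (here refl)) (adj-of Nⱼ (here refl))
        N₂ = small d₂ (adj-of Nᵢ (there (here refl))) (adj-of Nⱼ (there (here refl)))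
        N₃ = small d₃ (adj-of Nᵢ (there (there (here refl)))) (adj-of Nⱼ (there (there (here refl))))
        V : List (Fin n)
        V = i ∷ j ∷ x₁ ∷ x₂ ∷ x₃ ∷ []
        iᵢ : i ∈ V
        iᵢ = here refl
        iⱼ : j ∈ V
        iⱼ = there (here refl)
        i₁ : x₁ ∈ V
        i₁ = there (there (here refl))
        i₂ : x₂ ∈ V
        i₂ = there (there (there (here refl)))
        i₃ : x₃ ∈ V
        i₃ = there (there (there (there (here refl))))

  module FromDomino (sq : 7 ℕ.≤ n → SquareCount) where
    private
      -- The third vertex of degree three is x.
      finish : (K : Domino H) → 3 ℕ.≤ deg H (Domino.x K) → Domino-Leaf H
      finish K dₓ = record { u = u ; v = v ; x = x ; z = z ; j = j ; l = l ; o = o ; unique = U ; all = complete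
        ; Nᵤ = Nᵤ ; Nᵥ = Nᵥ ; Nₓ = Nₓ ; N_z = N_z ; Nⱼ = Nⱼ ; Nₗ = Nₗ ; Nₒ = Nₒ }
        where
        open Domino K
        uv = adj-of Nᵤ (here refl)
        ux = adj-of Nᵤ (there (here refl))
        uz = adj-of Nᵤ (there (there (here refl)))
        vj = adj-of Nᵥ (there (here refl))
        vl = adj-of Nᵥ (there (there (here refl)))
        v≢x : v ≢ x
        v≢x = ≢₁₂ (uniq Nᵤ)
        v≢z : v ≢ z
        v≢z = ≢₁₃ (uniq Nᵤ)
        x≢z : x ≢ z
        x≢z = ≢₂₃ (uniq Nᵤ)
        u≢j : u ≢ j
        u≢j = ≢₁₂ (uniq Nᵥ)
        u≢l : u ≢ l
        u≢l = ≢₁₃ (uniq Nᵥ)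
        j≢l : j ≢ l
        j≢l = ≢₂₃ (uniq Nᵥ)
        x≢l : x ≢ l
        x≢l refl = free uv vl ux
        z≢j : z ≢ j
        z≢j refl = free uv vj uz
        ox = third x u j u≢j (edge-sym H ux) x~j dₓ
        o = proj₁ ox
        Nₓ = proj₂ ox
        xo : x ~ o
        xo = adj-of Nₓ (there (there (here refl)))
        u≢o : u ≢ o
        u≢o = ≢₁₃ (uniq Nₓ)
        j≢o : j ≢ o
        j≢o = ≢₂₃ (uniq Nₓ)
        U₃ : Unique (u ∷ v ∷ x ∷ [])
        U₃ = uniq₃ (edge-≢ H uv) (edge-≢ H ux) v≢x
        D₃ : ∀ {w} → w ∈ u ∷ v ∷ x ∷ [] → 3 ℕ.≤ deg H w
        D₃ (here refl) = degree-three Nᵤ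
        D₃ (there (here refl)) = degree-three Nᵥ
        D₃ (there (there (here refl))) = dₓ
        module M′ = MateFacts (rechoose u v x U₃ D₃)
        low : ∀ {w a b} → w ≢ u → w ≢ v → w ≢ x → a ≢ b → w ~ a → w ~ b → Nbrs H w (a ∷ b ∷ [])
        low w≢u w≢v w≢x a≢b wa wb = two (ℕP.≤-reflexive (M′.deg2 (λ { (here e) → w≢u e ; (there (here e)) → w≢v e ; (there (there (here e))) → w≢x e })
          (twoNbrs⇒≢y a≢b wa wb))) a≢b wa wb
        N_z : Nbrs H z (u ∷ l ∷ [])
        N_z = low (≢-sym (edge-≢ H uz)) (≢-sym v≢z) (≢-sym x≢z) u≢l (edge-sym H uz) z~l
        Nⱼ : Nbrs H j (v ∷ x ∷ [])
        Nⱼ = low (≢-sym u≢j) (≢-sym (edge-≢ H vj)) (≢-sym (edge-≢ H x~j)) v≢x (edge-sym H vj) (edge-sym H x~j)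
        Nₗ : Nbrs H l (v ∷ z ∷ [])
        Nₗ = low (≢-sym u≢l) (≢-sym (edge-≢ H vl)) (≢-sym x≢l) v≢z (edge-sym H vl) (edge-sym H z~l)
        x~w : ∀ {w} → w ≡ o → x ~ w
        x~w e = subst (x ~_) (sym e) xo
        v≢o : v ≢ o
        v≢o e with of-adj Nᵥ (edge-sym H (x~w e))
        ... | here e = edge-≢ H ux (sym e)
        ... | there (here e) = edge-≢ H x~j e
        ... | there (there (here e)) = x≢l e
        z≢o : z ≢ o
        z≢o e = free ux (x~w e) uz
        l≢o : l ≢ o
        l≢o e with of-adj Nₗ (edge-sym H (x~w e))
        ... | here e = v≢x (sym e)
        ... | there (here e) = x≢z e
        V = u ∷ v ∷ x ∷ z ∷ j ∷ l ∷ o ∷ []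
        U : Unique V
        U = (edge-≢ H uv ∷ edge-≢ H ux ∷ edge-≢ H uz ∷ u≢j ∷ u≢l ∷ u≢o ∷ []) ∷ (v≢x ∷ v≢z ∷ edge-≢ H vj ∷ edge-≢ H vl ∷ v≢o ∷ [])
          ∷ (x≢z ∷ edge-≢ H x~j ∷ x≢l ∷ edge-≢ H xo ∷ []) ∷ (z≢j ∷ edge-≢ H z~l ∷ z≢o ∷ []) ∷ (j≢l ∷ j≢o ∷ []) ∷ (l≢o ∷ []) ∷ [] ∷ []
        u≢y : u ≢ y
        u≢y = twoNbrs⇒≢y v≢x uv ux
        v≢y : v ≢ y
        v≢y = twoNbrs⇒≢y j≢l vj vl
        x≢y : x ≢ y
        x≢y = twoNbrs⇒≢y u≢j (edge-sym H ux) x~j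
        z≢y : z ≢ y
        z≢y = twoNbrs⇒≢y u≢l (edge-sym H uz) z~l
        j≢y : j ≢ y
        j≢y = twoNbrs⇒≢y v≢x (edge-sym H vj) (edge-sym H x~j)
        l≢y : l ≢ y
        l≢y = twoNbrs⇒≢y v≢z (edge-sym H vl) (edge-sym H z~l)
        u≁y : ¬ (u ~ y)
        u≁y e with of-adj Nᵤ e
        ... | here p = v≢y (sym p)
        ... | there (here p) = x≢y (sym p)
        ... | there (there (here p)) = z≢y (sym p)
        v≁y : ¬ (v ~ y)
        v≁y e with of-adj Nᵥ e
        ... | here p = u≢y (sym p)
        ... | there (here p) = j≢y (sym p)
        ... | there (there (here p)) = l≢y (sym p)
        xv : + 2 ≤ κ-term H x v
        xv = pairTerm (≢-sym v≢x) u≢j (edge-sym H ux) uv x~j (edge-sym H vj)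
        vx : + 2 ≤ κ-term H v x
        vx = pairTerm v≢x u≢j (edge-sym H uv) ux vj (edge-sym H x~j)
        zv : + 2 ≤ κ-term H z v
        zv = pairTerm (≢-sym v≢z) u≢l (edge-sym H uz) uv z~l (edge-sym H vl)
        vz : + 2 ≤ κ-term H v z
        vz = pairTerm v≢z u≢l (edge-sym H uv) uz vl (edge-sym H z~l)
        uj : + 2 ≤ κ-term H u j
        uj = pairTerm u≢j v≢x uv vj ux x~j
        ju : + 2 ≤ κ-term H j u
        ju = pairTerm (≢-sym u≢j) v≢x (edge-sym H vj) (edge-sym H uv) (edge-sym H x~j) (edge-sym H ux)
        ul : + 2 ≤ κ-term H u l
        ul = pairTerm u≢l v≢z uv vl uz z~l
        lu : + 2 ≤ κ-term H l u
        lu = pairTerm (≢-sym u≢l) v≢z (edge-sym H vl) (edge-sym H uv) (edge-sym H z~l) (edge-sym H uz)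
        -- The two faces of the grid: `u` and `v` lie on both, the four corners on one each, so 4 +
        -- 4 + 2 + 2 + 2 + 2.
        κs : + 16 ≤ ∑ (T.κ H)
        κs = ℤP.≤-trans (ℤP.+-mono-≤ (both u j≢l uj ul) (ℤP.+-mono-≤ (both v x≢z vx vz) (ℤP.+-mono-≤ (one x v xv) (ℤP.+-mono-≤ (one z v zv)
               (ℤP.+-mono-≤ (one j u ju) (ℤP.+-mono-≤ (one l u lu) (ℤP.+-mono-≤ (0≤κ H o) (ℤP.≤-refl {+ 0}))))))))
             (∑-≥-list (T.κ H) V U (0≤κ H))
        edges : + 2 ≤ A H u v + A H u x + A H v x
        edges = subst₂ (λ p q → + 2 ≤ p + q + A H v x) (sym (A-adj H uv)) (sym (A-adj H ux)) (ℤP.+-mono-≤ (ℤP.≤-refl {+ 2}) (0≤𝟙 (adj H v x)))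
        7≤n : 7 ℕ.≤ n
        7≤n = unique-length≤ V U
        -- Without this edge 4 · 2 + 16 = 24 would have to be at most 20. So the third neighbour of
        -- `x` is the leaf, and nothing else can be attached.
        x~y : x ~ y
        x~y with adj H x y BoolP.≟ true
        ... | yes e = e
        ... | no ¬e = ⊥-elim (absurd (ℕP.m≤m+n 21 3) (crowded (sq 7≤n) u v x U₃ D₃ 2 edges u≁y v≁y (+ 0) (ℤP.≤-reflexive (A-nonadj H ¬e)) 16 κs))
        o≡y : o ≡ y
        o≡y with of-adj Nₓ x~y
        ... | here p = ⊥-elim (u≢y (sym p))
        ... | there (here p) = ⊥-elim (j≢y (sym p))
        ... | there (there (here p)) = sym p
        Nₒ : Nbrs H o (x ∷ [])
        Nₒ = nbrs-from H o (x ∷ []) ([] ∷ []) (λ { (here refl) → edge-sym H xo }) (ℕP.≤-reflexive (trans (cong (deg H) o≡y) deg1))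
        i₀ : u ∈ V
        i₀ = here refl
        i₁ : v ∈ V
        i₁ = there (here refl)
        i₂ : x ∈ V
        i₂ = there (there (here refl))
        i₃ : z ∈ V
        i₃ = there (there (there (here refl)))
        i₄ : j ∈ V
        i₄ = there (there (there (there (here refl))))
        i₅ : l ∈ V
        i₅ = there (there (there (there (there (here refl)))))
        i₆ : o ∈ V
        i₆ = there (there (there (there (there (there (here refl))))))
        complete : ∀ w → w ∈ V
        complete = fenced-spread H conn V i₀
          ((_ , Nᵤ , i₁ ∷ i₂ ∷ i₃ ∷ []) ∷ (_ , Nᵥ , i₀ ∷ i₄ ∷ i₅ ∷ []) ∷ (_ , Nₓ , i₀ ∷ i₄ ∷ i₆ ∷ []) ∷ (_ , N_z , i₀ ∷ i₅ ∷ [])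
            ∷ (_ , Nⱼ , i₁ ∷ i₂ ∷ []) ∷ (_ , Nₗ , i₁ ∷ i₃ ∷ []) ∷ (_ , Nₒ , i₂ ∷ []) ∷ [])

      -- Together with `mirror` this symmetry of the grid carries any corner to `x`.
      flip : Domino H → Domino H
      flip K = record { u = v ; v = u ; x = j ; z = l ; j = x ; l = z ; Nᵤ = Nᵥ ; Nᵥ = Nᵤ ; x~j = edge-sym H x~j ; z~l = edge-sym H z~l }
        where open Domino K

      mirror : Domino H → Domino H
      mirror K = record { u = u ; v = v ; x = z ; z = x ; j = l ; l = j ; Nᵤ = re Nᵤ ; Nᵥ = re Nᵥ ; x~j = z~l ; z~l = x~j }
        where
        open Domino K
        re : ∀ {w a b c} → Nbrs H w (a ∷ b ∷ c ∷ []) → Nbrs H w (a ∷ c ∷ b ∷ [])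
        re N with uniq N
        ... | (p ∷ q ∷ []) ∷ (o ∷ []) ∷ _ = nbrs-reorder H _ N (uniq₃ q p (≢-sym o))
                (λ { (here e) → here e ; (there (here e)) → there (there (here e)) ; (there (there (here e))) → there (here e) }) refl

    fromDomino : Domino H → Domino-Leaf H
    fromDomino K = go (3 ℕP.≤? deg H x) (3 ℕP.≤? deg H z) (3 ℕP.≤? deg H j) (3 ℕP.≤? deg H l)
      where
      open Domino K
      go : Dec (3 ℕ.≤ deg H x) → Dec (3 ℕ.≤ deg H z) → Dec (3 ℕ.≤ deg H j) → Dec (3 ℕ.≤ deg H l) → Domino-Leaf H
      go (yes d) _ _ _ = finish K d
      go _ (yes d) _ _ = finish (mirror K) d
      go _ _ (yes d) _ = finish (flip K) d
      go _ _ _ (yes d) = finish (mirror (flip K)) d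
      go (no dx) (no dz) (no dj) (no dl) = ⊥-elim
          (All≢⇒∉ (nbrs⇒y≢ Nᵤ ∷ nbrs⇒y≢ Nᵥ ∷ nbrs⇒y≢ Nₓ ∷ nbrs⇒y≢ N_z ∷ nbrs⇒y≢ Nⱼ ∷ nbrs⇒y≢ Nₗ ∷ [])
            (fenced-spread H conn V i₀ ((_ , Nᵤ , i₁ ∷ i₂ ∷ i₃ ∷ []) ∷ (_ , Nᵥ , i₀ ∷ i₄ ∷ i₅ ∷ []) ∷ (_ , Nₓ , i₀ ∷ i₄ ∷ [])
              ∷ (_ , N_z , i₀ ∷ i₅ ∷ []) ∷ (_ , Nⱼ , i₁ ∷ i₂ ∷ []) ∷ (_ , Nₗ , i₁ ∷ i₃ ∷ []) ∷ []) y))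
        where
        V : List (Fin n)
        V = u ∷ v ∷ x ∷ z ∷ j ∷ l ∷ []
        small : ∀ {w a b} → ¬ (3 ℕ.≤ deg H w) → a ≢ b → w ~ a → w ~ b → Nbrs H w (a ∷ b ∷ [])
        small d a≢b wa wb = two (ℕ.s≤s⁻¹ (ℕP.≰⇒> d)) a≢b wa wb
        Nₓ = small dx (≢₁₂ (uniq Nᵥ)) (edge-sym H (adj-of Nᵤ (there (here refl)))) x~j
        N_z = small dz (≢₁₃ (uniq Nᵥ)) (edge-sym H (adj-of Nᵤ (there (there (here refl))))) z~l
        Nⱼ = small dj (≢₁₂ (uniq Nᵤ)) (edge-sym H (adj-of Nᵥ (there (here refl)))) (edge-sym H x~j)
        Nₗ = small dl (≢₁₃ (uniq Nᵤ)) (edge-sym H (adj-of Nᵥ (there (there (here refl))))) (edge-sym H z~l)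
        i₀ : u ∈ V
        i₀ = here refl
        i₁ : v ∈ V
        i₁ = there (here refl)
        i₂ : x ∈ V
        i₂ = there (there (here refl))
        i₃ : z ∈ V
        i₃ = there (there (there (here refl)))
        i₄ : j ∈ V
        i₄ = there (there (there (there (here refl))))
        i₅ : l ∈ V
        i₅ = there (there (there (there (there (here refl)))))

  classify : (7 ℕ.≤ n → SquareCount) → ∀ v → + 3 ≤ T.κ H v → K₂₃-Leaf H ⊎ Domino-Leaf H
  classify sq v rich with find v rich
  ... | inj₁ K = inj₁ (FromK₂₃.fromK₂₃ sq K)
  ... | inj₂ K = inj₂ (FromDomino.fromDomino sq K)

-- Cospectral mates

-- The leaf is adjacent to at most one vertex of degree three, so two of them miss it. With five
-- vertices each of these is adjacent to all others but the leaf; both have at least 4 closed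
-- 3-walks, more than the 6 that remain when the rose consists of two triangles.
no-five : {H : Graph n} → n ≡ 5 → Mate H → ¬ (T.trA³ H ≤ + 6)
no-five {n} {H} n≡5 M few = choose (adj H y r BoolP.≟ true) (adj H y s BoolP.≟ true)
  where
  open MateFacts M
  full : ∀ {u} → deg H u ≡ 3 → ¬ (adj H u y ≡ true) → ∀ {w} → w ≢ u → w ≢ y → adj H u w ≡ true
  full {u} d u≁y {w} w≢u w≢y with neighbours H u
  ... | xs , N with full-complete (u ∷ y ∷ xs) uq (trans (cong (λ k → suc (suc k)) (trans (nbrs-deg H N) d)) (sym n≡5)) w
    where
    uq : Unique (u ∷ y ∷ xs)
    uq = (λ { (here e) → y≢u (sym e) ; (there p) → edge-≢ H (adj-of N p) refl }) ∷ᵁ ((λ p → u≁y (adj-of N p)) ∷ᵁ uniq N)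
      where
      y≢u : y ≢ u
      y≢u refl with trans (sym deg1) d
      ... | ()
  ...   | here e = ⊥-elim (w≢u e)
  ...   | there (here e) = ⊥-elim (w≢y e)
  ...   | there (there p) = adj-of N p
  many : ∀ {u v p q} → adj H u v ≡ true → adj H u p ≡ true → adj H u q ≡ true → adj H v p ≡ true → adj H v q ≡ true → p ≢ q → + 4 ≤ T.t H u
  many {u} {v} {p} {q} uv up uq vp vq p≢q =
    ℤP.≤-trans (ℤP.+-mono-≤ (term uv (c≥ H u v (p ∷ q ∷ []) ((p≢q ∷ []) ∷ [] ∷ []) (λ { (here refl) → up , edge-sym H vp ; (there (here refl)) → uq , edge-sym H vq })))
      (ℤP.+-mono-≤ (term up (c≥ H u p (v ∷ []) ([] ∷ []) (λ { (here refl) → uv , vp })))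
      (ℤP.+-mono-≤ (term uq (c≥ H u q (v ∷ []) ([] ∷ []) (λ { (here refl) → uv , vq }))) (ℤP.≤-refl {+ 0}))))
      (∑-≥-list (λ k → A H u k * T.c H u k) (v ∷ p ∷ q ∷ []) ((edge-≢ H vp ∷ edge-≢ H vq ∷ []) ∷ (p≢q ∷ []) ∷ [] ∷ []) (0≤t-term H u))
    where
    term : ∀ {k x} → adj H u k ≡ true → x ≤ T.c H u k → x ≤ A H u k * T.c H u k
    term {k} {x} e h = subst (x ≤_) (sym (trans (cong (_* T.c H u k) (A-adj H e)) (ℤP.*-identityˡ (T.c H u k)))) h
  dense : ∀ u v → u ≢ v → deg H u ≡ 3 → deg H v ≡ 3 → ¬ (adj H u y ≡ true) → ¬ (adj H v y ≡ true) → ⊥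
  dense u v u≢v du dv u≁y v≁y with neighbours H u
  ... | xs , N with escape xs (v ∷ []) (uniq N) ([] ∷ []) (subst (2 ℕ.≤_) (sym (trans (nbrs-deg H N) du)) (s≤s (s≤s z≤n)))
  ... | p , p∈ , p∉ with escape xs (v ∷ p ∷ []) (uniq N) (((λ e → p∉ (here (sym e))) ∷ []) ∷ [] ∷ []) (ℕP.≤-reflexive (sym (trans (nbrs-deg H N) du)))
  ... | q , q∈ , q∉ = absurd (ℤP.≤-trans (ℤP.+-mono-≤ (many uv up uq vp vq p≢q) (ℤP.+-mono-≤ (many (edge-sym H uv) vp vq up uq p≢q) (ℤP.≤-refl {+ 0})))
        (ℤP.≤-trans (∑-≥-list (T.t H) (u ∷ v ∷ []) ((u≢v ∷ []) ∷ [] ∷ []) (0≤t H)) few))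
    where
    absurd : ¬ (+ 8 ≤ + 6)
    absurd (ℤ.+≤+ (s≤s (s≤s (s≤s (s≤s (s≤s (s≤s ())))))))
    up = adj-of N p∈
    uq = adj-of N q∈
    ≢y : ∀ {w} → adj H u w ≡ true → w ≢ y
    ≢y e refl = u≁y e
    v≢y : v ≢ y
    v≢y refl with trans (sym deg1) dv
    ... | ()
    uv = full du u≁y (≢-sym u≢v) v≢y
    vp = full dv v≁y (λ e → p∉ (here e)) (≢y up)
    vq = full dv v≁y (λ e → q∉ (here e)) (≢y uq)
    p≢q : p ≢ q
    p≢q e = q∉ (there (here (sym e)))
  r≢s : r ≢ s
  r≢s = ≢₁₂ distinct
  r≢t : r ≢ t
  r≢t = ≢₁₃ distinct
  s≢t : s ≢ t
  s≢t = ≢₂₃ distinct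
  single : ∀ {a b} → adj H y a ≡ true → a ≢ b → ¬ (adj H b y ≡ true)
  single ya a≢b e = twoNbrs⇒≢y a≢b ya (edge-sym H e) refl
  d₁ = deg3 (here refl)
  d₂ = deg3 (there (here refl))
  d₃ = deg3 (there (there (here refl)))
  choose : Dec (adj H y r ≡ true) → Dec (adj H y s ≡ true) → ⊥
  choose (yes e) _ = dense s t s≢t d₂ d₃ (single e r≢s) (single e r≢t)
  choose (no ¬e) (yes f) = dense r t r≢t d₁ d₃ (λ g → ¬e (edge-sym H g)) (single f s≢t)
  choose (no ¬e) (no ¬f) = dense r s r≢s d₁ d₂ (λ g → ¬e (edge-sym H g)) (λ g → ¬f (edge-sym H g))

TriangleRoseOf : Graph n → Set
TriangleRoseOf G = Σ (Rose G) λ P → length (Rose.xs P) ≡ 1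

Exceptional : Graph n → Graph n → Set
Exceptional G H = TriangleRoseOf G × (K₂₃-Leaf H ⊎ Domino-Leaf H)

connected-degree : (H : Graph n) → Connected H → ∀ {u v} → u ≢ v → 1 ℕ.≤ deg H u
connected-degree H conn {u} {v} u≢v with conn u v
... | reach-refl = ⊥-elim (u≢v refl)
... | reach-step {j = j} e _ = ℤP.drop‿+≤+ (subst (+ 1 ≤_) (sym (deg≡∑ H u)) (length-⊆ (j ∷ []) (adj H u) ([] ∷ []) (λ { (here refl) → e })))

private
  one-triangle : (G H : Graph (suc n)) → Connected G → Connected H → SamePolys H G → Mate H → (P : Rose G) (z : Fin (suc n)) → Rose.xs P ≡ z ∷ [] →
    Nbrs G (Rose.x P) (Rose.c P ∷ z ∷ []) → Nbrs G z (Rose.x P ∷ Rose.c P ∷ []) →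
    (s q : Fin (suc n)) → Nbrs G (Rose.y P) (Rose.c P ∷ s ∷ []) → Nbrs G (lastOf (Rose.y P) (Rose.ys P)) (q ∷ Rose.c P ∷ []) →
    ¬ (adj G s (Rose.c P) ≡ true) → ¬ (adj G q (Rose.c P) ≡ true) → T.t G (Rose.c P) ≡ + 2 → Exceptional G H
  one-triangle {n} G H connG connH same M P z xs≡ Nx Nz s q Ny Nl s≁c q≁c tc =
    (P , cong length xs≡) , Classify.classify connH (triangleFree H free) M count (proj₁ R) (proj₂ (proj₂ R))
    where
    module C = Cospectral G H same P
    module TR = TriangleRose P z xs≡ Nx Nz s q Ny Nl s≁c q≁c
    free : T.trA³ H ≡ + 0
    free = trans (alg (T.trA³ H)) (cong (_- + 6) (trans (sym (C.WithMate.triangles M)) (cong (+ 3 *_) tc)))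
      where
      alg : ∀ x → x ≡ x + + 6 - + 6
      alg = solve-∀
    R = C.WithMate.OneTriangle.rich M tc free TR.trA⁵≤60
    -- From seven vertices on the rose has no 4-cycle, so its `κ` vanish and exactly 20 remains.
    count : 7 ℕ.≤ suc n → Classify.SquareCount connH (triangleFree H free) M
    count 7≤n M′ = trans (C.WithMate.OneTriangle.squares M′ tc free)
      (cong (λ z → + 20 + z) (∑-zero (κ-no-squares G (TR.no-squares connG 7≤n))))

mates : (G H : Graph (suc n)) → IsRose G → SamePolys H G → H ≅ G ⊎ Exceptional G H
mates {n} G H isRose@(connG , _) same = by-degrees (dichotomy H pos C.∑w≡2 C.∑w²≡4)
  where
  P = rose G isRose
  module P = RoseFacts P
  module C = Cospectral G H same P
  connH : Connected H
  connH = samePolys-connected G H same connG P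
  c≢x : P.c ≢ P.x
  c≢x = edge-≢ G (adj-of P.centre (here refl))
  pos : ∀ v → 1 ℕ.≤ deg H v
  pos v with v ≟ P.c
  ... | yes refl = connected-degree H connH c≢x
  ... | no v≢c = connected-degree H connH v≢c
  by-loops : Mate H → Ends G P.c P.x P.xs → Ends G P.c P.y P.ys → Exceptional G H
  -- A rose without triangles would leave -6 closed 3-walks for the mate.
  by-loops M E@(long _ _ _ _ _ _ _) E′@(long _ _ _ _ _ _ _) = ⊥-elim (negative (0≤trA³ H)
      (trans (cong (+ 3 *_) (sym (P.t-c≡ E E′))) (C.WithMate.triangles M)))
    where
    negative : ∀ {x} → + 0 ≤ x → ¬ (+ 0 ≡ x + + 6)
    negative {+ x} _ e with trans (ℤP.+-injective e) (ℕP.+-comm x 6)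
    ... | ()
  -- Two triangles make five vertices, and the mate keeps 12 - 6 = 6 closed 3-walks, so it is not
  -- triangle-free.
  by-loops M E@(short z xs≡ _ _) E′@(short z′ ys≡ _ _) = ⊥-elim (no-five size-5 M (ℤP.≤-reflexive six))
    where
    size-5 : suc n ≡ 5
    size-5 = trans (sym P.size) (cong₂ (λ us vs → suc (length (P.x ∷ us) ℕ.+ length (P.y ∷ vs))) xs≡ ys≡)
    alg : ∀ x → x ≡ x + + 6 - + 6
    alg = solve-∀
    six : T.trA³ H ≡ + 6
    six = trans (alg (T.trA³ H)) (cong (_- + 6) (trans (sym (C.WithMate.triangles M)) (cong (+ 3 *_) (P.t-c≡ E E′))))
  by-loops M E@(short z xs≡ Nx Nz) E′@(long s q Ny Nl s≁c q≁c _) =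
    one-triangle G H connG connH same M P z xs≡ Nx Nz s q Ny Nl s≁c q≁c (P.t-c≡ E E′)
  by-loops M E@(long s q Ny Nl s≁c q≁c _) E′@(short z xs≡ Nx Nz) =
    one-triangle G H connG connH same M (rose-swap P) z xs≡ Nx Nz s q Ny Nl s≁c q≁c (P.t-c≡ E E′)
  by-degrees : (Σ (Fin (suc n)) λ v → deg H v ≡ 4 × (∀ w → ¬ (w ≡ v) → deg H w ≡ 2)) ⊎ Mate H → H ≅ G ⊎ Exceptional G H
  by-degrees (inj₁ (v , d4 , d2)) = inj₁ (roses-determined G H connG connH P (rose H (connH , v , d4 , d2)) same)
  by-degrees (inj₂ M) = inj₂ (by-loops M (ends P.chainˣ P.uniqueˣ P.c∉ˣ) (ends P.chainʸ P.uniqueʸ P.c∉ʸ))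

-- Once one loop is a triangle, the order fixes the other. So R(3,4) and R(3,5) are recognised by
-- their six and seven vertices.
triangleRose-≅ : {G : Graph n} {H : Graph m} → n ≡ m → TriangleRoseOf G → TriangleRoseOf H → G ≅ H
triangleRose-≅ n≡m (P , p) (P′ , p′) = rose-≅ P P′ (trans p (sym p′))
  (ℕP.+-cancelˡ-≡ 4 (length (Rose.ys P)) (length (Rose.ys P′)) (trans (sizeOf P p) (trans n≡m (sym (sizeOf P′ p′)))))
  where
  sizeOf : ∀ {k} {K : Graph k} (R : Rose K) → length (Rose.xs R) ≡ 1 → 4 ℕ.+ length (Rose.ys R) ≡ k
  sizeOf R e = trans (cong (λ j → suc (suc j ℕ.+ suc (length (Rose.ys R)))) (sym e)) (Rose.size R)

-- R(3,4), R(3,5) and their mates by computation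

connected-dec : (G : Graph n) → Dec (∀ i j → j ∈ Component.members (component G i))
connected-dec G = FinP.all? λ i → FinP.all? λ j → j ∈? Component.members (component G i)

degrees-dec : (G : Graph n) (c : Fin n) → Dec (∀ w → w ≡ c ⊎ deg G w ≡ 2)
degrees-dec G c = FinP.all? λ w → (w ≟ c) ⊎-dec (deg G w ℕP.≟ 2)

isRose-by : (G : Graph n) (c : Fin n) → deg G c ≡ 4 → (∀ i j → j ∈ Component.members (component G i)) → (∀ w → w ≡ c ⊎ deg G w ≡ 2) → IsRose G
isRose-by G c d4 conn d2 = (λ i j → Component.reachable (component G i) (conn i j)) , c , d4 , others
  where
  others : ∀ w → ¬ (w ≡ c) → deg G w ≡ 2
  others w w≢c with d2 w
  ... | inj₁ e = ⊥-elim (w≢c e)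
  ... | inj₂ e = e

R3-4-rose : IsRose (R3 4)
R3-4-rose = isRose-by (R3 4) zero refl (from-yes (connected-dec (R3 4))) (from-yes (degrees-dec (R3 4) zero))

R3-5-rose : IsRose (R3 5)
R3-5-rose = isRose-by (R3 5) zero refl (from-yes (connected-dec (R3 5))) (from-yes (degrees-dec (R3 5) zero))

-- `rose` starts at the first neighbour of the centre, which lies on the longer cycle; the triangle
-- comes out as the second loop, hence the swap.
R3-4-triangle : TriangleRoseOf (R3 4)
R3-4-triangle = rose-swap (rose (R3 4) R3-4-rose) , refl

R3-5-triangle : TriangleRoseOf (R3 5)
R3-5-triangle = rose-swap (rose (R3 5) R3-5-rose) , refl

-- Coefficient lists, constant term first; they let the characteristic polynomials of concrete graphs be compared by computation.
Poly : Set
Poly = List ℤ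

eval : Poly → ℤ → ℤ
eval []      x = + 0
eval (a ∷ p) x = a + x * eval p x

_⊕_ : Poly → Poly → Poly
[]      ⊕ q       = q
(a ∷ p) ⊕ []      = a ∷ p
(a ∷ p) ⊕ (b ∷ q) = (a + b) ∷ (p ⊕ q)

_⊙_ : ℤ → Poly → Poly
a ⊙ []      = []
a ⊙ (b ∷ p) = (a * b) ∷ (a ⊙ p)

_⊗_ : Poly → Poly → Poly
[]      ⊗ q = []
(a ∷ p) ⊗ q = (a ⊙ q) ⊕ (+ 0 ∷ (p ⊗ q))

eval-⊕ : ∀ p q x → eval (p ⊕ q) x ≡ eval p x + eval q x
eval-⊕ [] q x = sym (ℤP.+-identityˡ (eval q x))
eval-⊕ (a ∷ p) [] x = sym (ℤP.+-identityʳ (eval (a ∷ p) x))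
eval-⊕ (a ∷ p) (b ∷ q) x = trans (cong (λ e → a + b + x * e) (eval-⊕ p q x)) (alg a b x (eval p x) (eval q x))
  where
  alg : ∀ a b x p q → a + b + x * (p + q) ≡ a + x * p + (b + x * q)
  alg = solve-∀

eval-⊙ : ∀ a p x → eval (a ⊙ p) x ≡ a * eval p x
eval-⊙ a [] x = sym (ℤP.*-zeroʳ a)
eval-⊙ a (b ∷ p) x = trans (cong (λ e → a * b + x * e) (eval-⊙ a p x)) (alg a b x (eval p x))
  where
  alg : ∀ a b x p → a * b + x * (a * p) ≡ a * (b + x * p)
  alg = solve-∀

eval-⊗ : ∀ p q x → eval (p ⊗ q) x ≡ eval p x * eval q x
eval-⊗ [] q x = refl
eval-⊗ (a ∷ p) q x = trans (eval-⊕ (a ⊙ q) (+ 0 ∷ (p ⊗ q)) x)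
  (trans (cong₂ (λ e f → e + (+ 0 + x * f)) (eval-⊙ a q x) (eval-⊗ p q x)) (alg a x (eval p x) (eval q x)))
  where
  alg : ∀ a x p q → a * q + (+ 0 + x * (p * q)) ≡ (a + x * p) * q
  alg = solve-∀

sumP : (Fin n → Poly) → Poly
sumP {zero}  f = []
sumP {suc n} f = f zero ⊕ sumP (f ∘ suc)

eval-sumP : (f : Fin n → Poly) → ∀ x → eval (sumP f) x ≡ ∑ (λ i → eval (f i) x)
eval-sumP {zero} f x = sym (∑-empty (λ i → eval (f i) x))
eval-sumP {suc n} f x = trans (eval-⊕ (f zero) (sumP (f ∘ suc)) x)
  (trans (cong (λ z → eval (f zero) x + z) (eval-sumP (f ∘ suc) x)) (sym (∑-suc (λ i → eval (f i) x))))

detP : ∀ n → (Fin n → Fin n → Poly) → Poly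
detP zero    M = + 1 ∷ []
detP (suc n) M = sumP λ j → sgn (toℕ j) ⊙ (M zero j ⊗ detP n (λ a b → M (suc a) (punchIn j b)))

eval-detP : ∀ n (M : Fin n → Fin n → Poly) x → eval (detP n M) x ≡ det n (λ i j → eval (M i j) x)
eval-detP zero M x = cong (λ z → + 1 + z) (ℤP.*-zeroʳ x)
eval-detP (suc n) M x = trans (eval-sumP term x)
  (trans (∑-cong (λ j → trans (eval-⊙ (sgn (toℕ j)) (M zero j ⊗ sub j) x) (cong (sgn (toℕ j) *_)
      (trans (eval-⊗ (M zero j) (sub j) x) (cong (eval (M zero j) x *_) (eval-detP n (λ a b → M (suc a) (punchIn j b)) x))))))
    (sym (det-expand (λ i j → eval (M i j) x))))
  where
  sub term : Fin (suc n) → Poly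
  sub j = detP n (λ a b → M (suc a) (punchIn j b))
  term j = sgn (toℕ j) ⊙ (M zero j ⊗ sub j)

lapPoly : Graph n → Poly
lapPoly {n} G = detP n λ i j → if does (i ≟ j) then (- + deg G i) ∷ + 1 ∷ [] else (if adj G i j then + 1 ∷ [] else [])

eval-lapPoly : (G : Graph n) (x : ℤ) → eval (lapPoly G) x ≡ lapCharPoly G x
eval-lapPoly {n} G x = trans (eval-detP n _ x) (det-cong entry)
  where
  alg₁ : ∀ x d → - d + x * (+ 1 + x * + 0) ≡ x - d
  alg₁ = solve-∀
  alg₂ : ∀ x → + 1 + x * + 0 ≡ + 0 - - + 1
  alg₂ = solve-∀
  entry : ∀ i j → eval (if does (i ≟ j) then (- + deg G i) ∷ + 1 ∷ [] else (if adj G i j then + 1 ∷ [] else [])) x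
    ≡ (if does (i ≟ j) then x else + 0) - laplacian G i j
  entry i j with does (i ≟ j) | adj G i j
  ... | true  | _     = alg₁ x (+ deg G i)
  ... | false | true  = alg₂ x
  ... | false | false = refl

lapPoly-cospectral : (G : Graph n) (H : Graph m) → lapPoly G ≡ lapPoly H → LapCospectral G H
lapPoly-cospectral G H e x = trans (sym (eval-lapPoly G x)) (trans (cong (λ p → eval p x) e) (eval-lapPoly H x))

-- Each edge is listed in one direction only; `simpleGraph` supplies the other.
fromEdges : List (ℕ × ℕ) → Graph n
fromEdges es = simpleGraph (λ i j → listed es (toℕ i) (toℕ j))
  where
  listed : List (ℕ × ℕ) → ℕ → ℕ → Bool
  listed []             a b = false
  listed ((c , d) ∷ es) a b = ((a ℕ.≡ᵇ c) ∧ (b ℕ.≡ᵇ d)) ∨ listed es a b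

mate₄ : Graph 6
mate₄ = fromEdges ((0 , 2) ∷ (0 , 3) ∷ (0 , 4) ∷ (1 , 2) ∷ (1 , 3) ∷ (1 , 4) ∷ (2 , 5) ∷ [])

mate₅ : Graph 7
mate₅ = fromEdges ((0 , 1) ∷ (0 , 2) ∷ (0 , 3) ∷ (1 , 4) ∷ (1 , 5) ∷ (2 , 4) ∷ (3 , 5) ∷ (2 , 6) ∷ [])

nbrs-dec : (G : Graph n) (v : Fin n) (xs : List (Fin n)) →
  Dec (Unique xs × All (λ u → adj G v u ≡ true) xs × deg G v ℕ.≤ length xs)
nbrs-dec G v xs = unique-dec _≟_ xs ×-dec (All.all? (λ u → adj G v u BoolP.≟ true) xs ×-dec (deg G v ℕP.≤? length xs))

nbrs-by : (G : Graph n) (v : Fin n) (xs : List (Fin n)) →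
  Unique xs × All (λ u → adj G v u ≡ true) xs × deg G v ℕ.≤ length xs → Nbrs G v xs
nbrs-by G v xs (u , a , d) = nbrs-from G v xs u (All.lookup a) d

mate₄-shape : K₂₃-Leaf mate₄
mate₄-shape = record
  { i = 0F ; j = 1F ; x₁ = 2F ; x₂ = 3F ; x₃ = 4F ; o = 5F
  ; unique = from-yes (unique-dec _≟_ V) ; all = from-yes (FinP.all? (_∈? V))
  ; Nᵢ = nbrs-by mate₄ 0F _ (from-yes (nbrs-dec mate₄ 0F (2F ∷ 3F ∷ 4F ∷ [])))
  ; Nⱼ = nbrs-by mate₄ 1F _ (from-yes (nbrs-dec mate₄ 1F (2F ∷ 3F ∷ 4F ∷ [])))
  ; N₁ = nbrs-by mate₄ 2F _ (from-yes (nbrs-dec mate₄ 2F (0F ∷ 1F ∷ 5F ∷ [])))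
  ; N₂ = nbrs-by mate₄ 3F _ (from-yes (nbrs-dec mate₄ 3F (0F ∷ 1F ∷ [])))
  ; N₃ = nbrs-by mate₄ 4F _ (from-yes (nbrs-dec mate₄ 4F (0F ∷ 1F ∷ [])))
  ; Nₒ = nbrs-by mate₄ 5F _ (from-yes (nbrs-dec mate₄ 5F (2F ∷ []))) }
  where
  V : List (Fin 6)
  V = 0F ∷ 1F ∷ 2F ∷ 3F ∷ 4F ∷ 5F ∷ []

mate₅-shape : Domino-Leaf mate₅
mate₅-shape = record
  { u = 0F ; v = 1F ; x = 2F ; z = 3F ; j = 4F ; l = 5F ; o = 6F
  ; unique = from-yes (unique-dec _≟_ V) ; all = from-yes (FinP.all? (_∈? V))
  ; Nᵤ = nbrs-by mate₅ 0F _ (from-yes (nbrs-dec mate₅ 0F (1F ∷ 2F ∷ 3F ∷ [])))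
  ; Nᵥ = nbrs-by mate₅ 1F _ (from-yes (nbrs-dec mate₅ 1F (0F ∷ 4F ∷ 5F ∷ [])))
  ; Nₓ = nbrs-by mate₅ 2F _ (from-yes (nbrs-dec mate₅ 2F (0F ∷ 4F ∷ 6F ∷ [])))
  ; N_z = nbrs-by mate₅ 3F _ (from-yes (nbrs-dec mate₅ 3F (0F ∷ 5F ∷ [])))
  ; Nⱼ = nbrs-by mate₅ 4F _ (from-yes (nbrs-dec mate₅ 4F (1F ∷ 2F ∷ [])))
  ; Nₗ = nbrs-by mate₅ 5F _ (from-yes (nbrs-dec mate₅ 5F (1F ∷ 3F ∷ [])))
  ; Nₒ = nbrs-by mate₅ 6F _ (from-yes (nbrs-dec mate₅ 6F (2F ∷ []))) }
  where
  V : List (Fin 7)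
  V = 0F ∷ 1F ∷ 2F ∷ 3F ∷ 4F ∷ 5F ∷ 6F ∷ []

-- The image of the leaf has a neighbour besides the image of `x`; pulled back, it would be a second
-- neighbour of the leaf.
leaf-≇ : (H : Graph n) (K : Graph m) {o x : Fin n} → Nbrs H o (x ∷ []) → (∀ v → 2 ℕ.≤ deg K v) → ¬ (H ≅ K)
leaf-≇ H K {o} {x} N two (π , pres) with neighbours K (Inverse.to π o)
... | xs , N′ with escape xs (Inverse.to π x ∷ []) (uniq N′) ([] ∷ []) (subst (2 ℕ.≤_) (sym (nbrs-deg K N′)) (two (Inverse.to π o)))
... | v , v∈ , v∉ with of-adj N (trans (pres o (Inverse.from π v)) (subst (λ w → adj K (Inverse.to π o) w ≡ true) (sym (Inverse.strictlyInverseˡ π v)) (adj-of N′ v∈)))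
... | here e = v∉ (here (trans (sym (Inverse.strictlyInverseˡ π v)) (cong (Inverse.to π) e)))

-- The order of `G` is kept with each exceptional shape. It identifies the rose when `G` is
-- arbitrary, and rules out the other shape when `G` is R(3,4) or R(3,5).
Outcome : Graph n → Graph m → Set
Outcome {n} G H = H ≅ G ⊎ (TriangleRoseOf G × (K₂₃-Leaf H × 6 ≡ n ⊎ Domino-Leaf H × 7 ≡ n))

cospectral-outcome : (G : Graph n) → IsRose G → (H : Graph m) → LapCospectral H G → Outcome G H
cospectral-outcome {n} {m} G isRose H co = go n m G isRose H same (charPoly-size (T.Q H) (T.Q G) same)
  where
  same : SamePolys H G
  same = cospectral⇒samePolys H G co
  sizes : ∀ {k} {G H : Graph k} → H ≅ G ⊎ Exceptional G H → Outcome G H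
  sizes (inj₁ iso) = inj₁ iso
  sizes (inj₂ (tri , inj₁ K)) = inj₂ (tri , inj₁ (K , complete-length _ (K₂₃-Leaf.unique K) (K₂₃-Leaf.all K)))
  sizes (inj₂ (tri , inj₂ K)) = inj₂ (tri , inj₂ (K , complete-length _ (Domino-Leaf.unique K) (Domino-Leaf.all K)))
  -- Both orders are variables here, so that their equality can be matched with `refl`; order zero
  -- is impossible because a rose has a centre.
  go : ∀ n m (G : Graph n) → IsRose G → (H : Graph m) → SamePolys H G → m ≡ n → Outcome G H
  go zero _ G (_ , () , _) H same e
  go (suc n) _ G isRose H same refl = sizes (mates G H isRose same)

theorem6p1 : (∀ {n} (G : Graph n) → IsRose G → ¬ (G ≅ R3 4) → ¬ (G ≅ R3 5) →
    ∀ {m} (H : Graph m) → LapCospectral H G → H ≅ G)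
    × (∀ (ℓ : ℕ) → (ℓ ≡ 4 ⊎ ℓ ≡ 5) →
    Σ (Graph (suc (suc ℓ))) λ H →
    ¬ (H ≅ R3 ℓ) × LapCospectral H (R3 ℓ)
    × (∀ {m} (K : Graph m) → LapCospectral K (R3 ℓ) → ¬ (K ≅ R3 ℓ) → K ≅ H))
theorem6p1 = determined , exceptions
  where
  determined : ∀ {n} (G : Graph n) → IsRose G → ¬ (G ≅ R3 4) → ¬ (G ≅ R3 5) → ∀ {m} (H : Graph m) → LapCospectral H G → H ≅ G
  determined {n} G isRose G≇R34 G≇R35 H co = conclude (cospectral-outcome G isRose H co)
    where
    conclude : Outcome G H → H ≅ G
    conclude (inj₁ iso) = iso
    conclude (inj₂ (tri , inj₁ (_ , 6≡n))) = ⊥-elim (G≇R34 (triangleRose-≅ (sym 6≡n) tri R3-4-triangle))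
    conclude (inj₂ (tri , inj₂ (_ , 7≡n))) = ⊥-elim (G≇R35 (triangleRose-≅ (sym 7≡n) tri R3-5-triangle))
  only₄ : ∀ {m} (G : Graph 6) (K : Graph m) → Outcome G K → ¬ (K ≅ G) → K ≅ mate₄
  only₄ G K (inj₁ iso) K≇ = ⊥-elim (K≇ iso)
  only₄ G K (inj₂ (_ , inj₁ (L , _))) _ = K₂₃-Leaf-≅ L mate₄-shape
  -- The grid with its pendant vertex would force seven vertices on a rose with six.
  only₄ G K (inj₂ (_ , inj₂ (_ , ()))) _
  only₅ : ∀ {m} (G : Graph 7) (K : Graph m) → Outcome G K → ¬ (K ≅ G) → K ≅ mate₅
  only₅ G K (inj₁ iso) K≇ = ⊥-elim (K≇ iso)
  only₅ G K (inj₂ (_ , inj₂ (L , _))) _ = Domino-Leaf-≅ L mate₅-shape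
  only₅ G K (inj₂ (_ , inj₁ (_ , ()))) _
  exceptions : ∀ (ℓ : ℕ) → (ℓ ≡ 4 ⊎ ℓ ≡ 5) → Σ (Graph (suc (suc ℓ))) λ H → ¬ (H ≅ R3 ℓ) × LapCospectral H (R3 ℓ)
    × (∀ {m} (K : Graph m) → LapCospectral K (R3 ℓ) → ¬ (K ≅ R3 ℓ) → K ≅ H)
  exceptions ℓ (inj₁ refl) = mate₄ , leaf-≇ mate₄ (R3 4) (K₂₃-Leaf.Nₒ mate₄-shape) (from-yes (FinP.all? (λ v → 2 ℕP.≤? deg (R3 4) v)))
    -- Here `refl` compares the two characteristic polynomials as computed lists of coefficients.
    , lapPoly-cospectral mate₄ (R3 4) refl , λ K co → only₄ (R3 4) K (cospectral-outcome (R3 4) R3-4-rose K co)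
  exceptions ℓ (inj₂ refl) = mate₅ , leaf-≇ mate₅ (R3 5) (Domino-Leaf.Nₒ mate₅-shape) (from-yes (FinP.all? (λ v → 2 ℕP.≤? deg (R3 5) v)))
    , lapPoly-cospectral mate₅ (R3 5) refl , λ K co → only₅ (R3 5) K (cospectral-outcome (R3 5) R3-5-rose K co)
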